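{- Let $n$ be a positive integer with prime factorization \[ n=2^{a}3^{b}5^{c}\prod_{i=1}^{y}p_i^{v_i}\prod_{j=1}^{s}q_j^{w_j}, \] where each $p_i$ satisfies $3<p_i\equiv 1,3,7,9\pmod{20}$ and each $q_j\equiv 11,13,17,19\pmod{20}$. Define $\Lambda(n)=\prod_{i=1}^{y}(1+v_i)\prod_{j=1}^{s}\frac{1+(-1)^{w_j}}{2}$. Let $t_1$, $t_2$, $t_3$ be the number of prime factors of $n$, counted with multiplicity, that are congruent to $3,7\pmod{20}$, to $23,29,41,47\pmod{60}$, and to $7,29,41,43\pmod{60}$, respectively. Then \[ (1,0,45;n)=\begin{cases}\tfrac12\left(1+(-1)^{a+t_1}+(-1)^{a+c+t_2}+(-1)^{c+t_3}\right)\Lambda(n), & b=0,\\ (b-1)(1+(-1)^{a+t_1})\Lambda(n), & b>0,\end{cases} \] \[ (5,0,9;n)=\begin{cases}\tfrac12\left(1+(-1)^{a+t_1}-(-1)^{a+c+t_2}-(-1)^{c+t_3}\right)\Lambda(n), & b=0,\\ (b-1)(1+(-1)^{a+t_1})\Lambda(n), & b>0,\end{cases} \] \[ (7,4,7;n)=\begin{cases}\tfrac12\left(1-(-1)^{a+t_1}+(-1)^{a+c+t_2}-(-1)^{c+t_3}\right)\Lambda(n), & b=0,\\ (b-1)(1-(-1)^{a+t_1})\Lambda(n), & b>0,\end{cases} \] \[ (2,2,23;n)=\begin{cases}\tfrac12\left(1-(-1)^{a+t_1}-(-1)^{a+c+t_2}+(-1)^{c+t_3}\right)\Lambda(n), &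 b=0,\\ (b-1)(1-(-1)^{a+t_1})\Lambda(n), & b>0.\end{cases} \]
   Context: For a binary quadratic form $(a,b,c)$, i.e. $ax^2+bxy+cy^2$, the quantity $(a,b,c;n)$ denotes the number of pairs $(x,y)\in\mathbb{Z}^2$ with $ax^2+bxy+cy^2=n$. -}

module Defs where

open import Data.Nat as ℕ using (ℕ; zero; suc; _%_)
open import Data.Nat.Divisibility using (_∣?_)
open import Data.Nat.Primality using (prime?)
open import Data.Integer as ℤ using (ℤ; +_; -_; _^_; _/ℕ_)
open import Data.List using (List; []; _∷_; filter; upTo; map; foldr)
open import Data.Nat.ListAction using (sum)
open import Data.List.Membership.DecPropositional (ℕ._≟_) using (_∈?_)
open import Data.Product using (Σ; _×_; _,_)
open import Data.Fin using (Fin)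
open import Relation.Nullary using (does)
open import Relation.Binary.PropositionalEquality using (_≡_)
open import Function.Bundles using (_↔_)
open import Data.Bool using (if_then_else_; _∧_)

record BQF : Set where
  constructor form
  field
    fa fb fc : ℤ

evalForm : BQF → ℤ → ℤ → ℤ
evalForm (form a b c) x y = a ℤ.* x ℤ.* x ℤ.+ b ℤ.* x ℤ.* y ℤ.+ c ℤ.* y ℤ.* y

Reps : BQF → ℕ → Set
Reps f n = Σ (ℤ × ℤ) (λ { (x , y) → evalForm f x y ≡ + n })

RepCount : BQF → ℕ → ℕ → Set
RepCount f n k = Fin k ↔ Reps f n

-- p-adic valuation: largest k ≤ fuel with p^k ∣ n (fuel n suffices for n ≥ 1, p ≥ 2)
valAux : ℕ → ℕ → ℕ → ℕ
valAux p n zero = zero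
valAux p n (suc k) = if does ((p ℕ.^ suc k) ∣? n) then suc k else valAux p n k

val : ℕ → ℕ → ℕ
val p n = valAux p n n

-- primes p ≤ n (all prime divisors of n ≥ 1 lie here)
primesUpTo : ℕ → List ℕ
primesUpTo n = filter prime? (upTo (suc n))

countPrimes : ℕ → (m : ℕ) → .{{ℕ.NonZero m}} → List ℕ → ℕ
countPrimes n m rs = sum (map (λ p → val p n) (filter (λ p → (p % m) ∈? rs) (primesUpTo n)))

sgn : ℕ → ℤ
sgn k = (- ℤ.1ℤ) ^ k

ΛFactor : ℕ → ℕ → ℤ
ΛFactor p v =
  if does (3 ℕ.<? p) ∧ does ((p % 20) ∈? (1 ∷ 3 ∷ 7 ∷ 9 ∷ []))
  then + (1 ℕ.+ v)
  else (if does ((p % 20) ∈? (11 ∷ 13 ∷ 17 ∷ 19 ∷ []))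
        then (ℤ.1ℤ ℤ.+ sgn v) /ℕ 2
        else ℤ.1ℤ)

Λ : ℕ → ℤ
Λ n = foldr (λ p acc → ΛFactor p (val p n) ℤ.* acc) ℤ.1ℤ (primesUpTo n)

{-# OPTIONS --safe #-}

-- Everything reduces to the forms f₁ = (1,0,5) and f₂ = (2,2,3) of discriminant -20.  The forms of
-- discriminant -180 restrict them to sublattices of index 3: if 9 ∣ n the representations of n
-- correspond to those of n/9 by f₁ or f₂, if 3 ∥ n there are none, and if 3 ∤ n the representations
-- of n by f₁ (by f₂) are all representations by one of the two forms above it, selected by n mod 3.
--
-- For f₁ and f₂ the count r satisfies a Hecke relation at every prime p.  If c² ≡ -5 (mod p), the
-- vectors with value divisible by p fill two lattices, meeting in the multiples of p (for p = 2, 5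
-- the two lattices coincide, and r(pn) is a count for n); on each of them the form is p times
-- a form of determinant 5, which reduction theory identifies with f₁ or f₂ according to p mod 20.
-- Hence r(p²m) + r(m) = 2 r′(pm) with r′ = r or the count for the other form.
-- If -5 is not a square mod p, then r(p²m) = r(m) and r(pm) = 0 for p ∤ m.  Gauss's lemma shows that
-- -5 is a square for p ≡ 1, 3, 7, 9 (mod 20); for p ≡ 11, 13, 17, 19 a root would yield a form
-- representing p, which congruences modulo 20 exclude.

module Submission where

open import Defs
open import Data.Nat using (ℕ; _<_; _≡ᵇ_)
open import Data.List using (List; []; _∷_)
open import Data.Bool using (if_then_else_)
open import Relation.Binary.PropositionalEquality using (_≡_)
open import Data.Integer using (ℤ; +_; -_; _+_; _-_; _*_; _/ℕ_; 1ℤ)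
open import Data.Product using (Σ; _×_)
open import Data.Nat as ℕ using (zero; suc; z≤n; s≤s)
import Data.Nat.Properties as ℕₚ
import Data.Nat.Divisibility as ℕ∣
import Data.Nat.DivMod as ℕ%
open import Data.Nat.Primality using (Prime; euclidsLemma; prime⇒nonZero; prime⇒nonTrivial; ¬prime[1]; prime⇒irreducible; prime?; prime[2]; ¬prime[0])
open import Data.Nat.ListAction using (product; sum)
open import Data.Nat.ListAction.Properties using (product-↭)
open import Data.Integer as ℤ using (-[1+_]; _^_; 0ℤ; -1ℤ; _%ℕ_) renaming (∣_∣ to abs)
import Data.Integer.Properties as ℤₚ
open import Data.Integer.Divisibility.Signed
open import Data.Integer.Tactic.RingSolver using (solve-∀)
open import Data.List using (map; downFrom; length; _++_; upTo; cartesianProduct; lookup; deduplicate; foldr; filter)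
open import Data.List.Properties using (length-map; length-downFrom)
open import Data.List.Membership.Propositional using (_∈_)
open import Data.List.Membership.Propositional.Properties using (∈-∃++; ∈-map⁺; ∈-map⁻; ∈-downFrom⁺; ∈-downFrom⁻; ∈-++⁺ˡ; ∈-++⁺ʳ; ∈-upTo⁺; ∈-cartesianProduct⁺; ∈-lookup; ∈-deduplicate⁺; ∈-filter⁺)
open import Data.List.Relation.Unary.Any as Any using (here; there)
open import Data.List.Relation.Unary.All as All using (All; []; _∷_)
open import Data.List.Relation.Unary.AllPairs using ([]; _∷_; AllPairs)
open import Data.List.Relation.Unary.Unique.Propositional using (Unique)
import Data.List.Relation.Unary.Unique.Propositional.Properties as Unique
open import Data.List.Relation.Binary.Permutation.Propositional using (_↭_; ↭-refl; ↭-sym; ↭-trans; prep)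
open import Data.List.Relation.Binary.Permutation.Propositional.Properties using (shift; ↭-length; ∈-resp-↭)
open import Data.Vec using (Vec; []; _∷_; replicate)
open import Data.Product using (∃; _,_; proj₁; proj₂; ∃₂)
open import Data.Sum as Sum using (_⊎_; inj₁; inj₂; [_,_]′)
open import Function using (_∘_; id; _↔_; mk↔ₛ′)
open import Data.Empty using (⊥; ⊥-elim)
open import Relation.Nullary using (¬_; Dec; yes; no; does)
open import Relation.Nullary.Decidable using (map′; from-yes; from-no; True; toWitness; fromWitness; _→-dec_; T?; ¬?; dec-true; dec-false; _×-dec_; _⊎-dec_)
open import Relation.Binary.PropositionalEquality
open import Data.Nat.Tactic.RingSolver using () renaming (solve-∀ to ℕ-solve-∀)
open import Data.List.Membership.DecPropositional ℕ._≟_ using (_∈?_)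
import Data.Integer.DivMod as ℤ%
open import Data.Bool as Bool using (Bool; true; false; _xor_; _∧_)
open import Data.Bool.Properties using (T-irrelevant; xor-identityʳ; xor-assoc; xor-same)
open import Data.Product.Properties using (≡-dec)
open import Data.Sum.Function.Propositional using (_⊎-↔_)
open import Data.Fin as Fin using (Fin)
open import Data.Fin.Properties using (+↔⊎; 0↔⊥)
open import Data.Fin.Permutation using (↔⇒≡)
open import Data.Unit using (⊤; tt)
open import Function.Properties.Inverse using (↔-sym; ↔-trans)
open import Relation.Binary.Definitions using (DecidableEquality)
open import Data.List.Relation.Unary.Any.Properties using (lookup-index)
import Data.List.Relation.Unary.Unique.DecPropositional.Properties as UniqueDec
open import Data.Nat.Coprimality using (Coprime; coprime-Bézout)
open import Data.Nat.GCD using (module Bézout)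
open import Data.Nat.Primality.Factorisation using (factorise; module PrimeFactorisation)
open import Data.List.Relation.Unary.All.Properties using (all-filter)

-- Gauss's lemma

-- The class group of discriminant -20 has order two and is encoded as `Bool` under `xor`: `false`
-- is the class of `f₁`, `true` that of `f₂`. Write A, B, C for the signs with exponents a + t₁, a +
-- c + t₂, c + t₃. Iterating the Hecke relations gives the count (1 + A) Λ (1 + b) for `f₁` and (1 -
-- A) Λ (1 + b) for `f₂`. The factor 1 + b stands apart because 3 is an ordinary split prime for
-- these forms, whereas Λ ignores it; for n / 9 it becomes the b - 1 of the theorem.
--
-- The sums of four signs for 3 ∤ n are disguised products. Unless Λ vanishes, B is the residue of n
-- modulo 3, and C = A B, so the four sums are (1 ± A)(1 ± B): the first factor belongs to `f₁` or
-- `f₂`, the second selects n modulo 3, and half the product is 1 ± A or 0. Both facts about B are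
-- multiplicative and are checked prime by prime, by a table modulo 60. They fail at the prime 3
-- itself, where A is -1 and B and C are 1; hence the separate treatment of 3 ∤ n.

≡⇒∣ : ∀ {k z w : ℤ} → z ≡ w → k ∣ z → k ∣ w
≡⇒∣ {k} = subst (k ∣_)

prime-∣* : ∀ {p} → Prime p → ∀ x y → + p ∣ x * y → + p ∣ x ⊎ + p ∣ y
prime-∣* pp x y d with euclidsLemma (abs x) (abs y) pp (subst (_ ℕ∣.∣_) (ℤₚ.abs-* x y) (∣⇒∣ᵤ d))
... | inj₁ e = inj₁ (∣ᵤ⇒∣ e)
... | inj₂ e = inj₂ (∣ᵤ⇒∣ e)

∣⇒∣ℕ : ∀ {m n} → + m ∣ + n → m ℕ∣.∣ n
∣⇒∣ℕ = ∣⇒∣ᵤ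

∣∧<⇒≡0 : ∀ {p} z → + p ∣ z → abs z ℕ.< p → z ≡ 0ℤ
∣∧<⇒≡0 z d lt with abs z in eq
... | zero = ℤₚ.∣i∣≡0⇒i≡0 eq
... | suc k = ⊥-elim (ℕ∣.>⇒∤ lt (subst (_ ℕ∣.∣_) eq (∣⇒∣ᵤ d)))

prime-∤1 : ∀ {p} → Prime p → ¬ (+ p ∣ 1ℤ)
prime-∤1 pp d = ℕ∣.>⇒∤ (ℕ.nonTrivial⇒n>1 _ {{prime⇒nonTrivial pp}}) (∣⇒∣ℕ d)

-- The pigeonhole principle as a permutation. In Gauss's lemma it turns the injectivity of the
-- absolute residues into an equality of products.
Unique-⊆⇒↭ : ∀ {A : Set} {xs ys : List A} → Unique xs → (∀ {z} → z ∈ xs → z ∈ ys) →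
  length ys ℕ.≤ length xs → xs ↭ ys
Unique-⊆⇒↭ {xs = []} {[]} _ _ _ = ↭-refl
Unique-⊆⇒↭ {xs = x ∷ xs} (x∉ ∷ u) sub len with ∈-∃++ (sub (here refl))
... | as , bs , refl = ↭-trans (prep x (Unique-⊆⇒↭ u sub′ len′)) (↭-sym (shift x as bs))
  where
  len′ : length (as Data.List.++ bs) ℕ.≤ length xs
  len′ = ℕ.s≤s⁻¹ (subst (ℕ._≤ _) (↭-length (shift x as bs)) len)
  sub′ : ∀ {z} → z ∈ xs → z ∈ as Data.List.++ bs
  sub′ z∈ with ∈-resp-↭ (shift x as bs) (sub (there z∈))
  ... | here refl = ⊥-elim (All.lookup x∉ z∈ refl)
  ... | there q = q

∏ : (ℕ → ℤ) → ℕ → ℤ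
∏ f zero = 1ℤ
∏ f (suc n) = f n * ∏ f n

∏-+ : ∀ f m n → ∏ f (m ℕ.+ n) ≡ ∏ f m * ∏ (λ i → f (m ℕ.+ i)) n
∏-+ f m zero = trans (cong (∏ f) (ℕₚ.+-identityʳ m)) (sym (ℤₚ.*-identityʳ _))
∏-+ f m (suc n) = trans (cong (∏ f) (ℕₚ.+-suc m n))
  (trans (cong (f (m ℕ.+ n) *_) (∏-+ f m n)) (lem (f (m ℕ.+ n)) (∏ f m) (∏ (λ i → f (m ℕ.+ i)) n)))
  where
  lem : ∀ a b c → a * (b * c) ≡ b * (a * c)
  lem = solve-∀

∏-const : ∀ {f c} n → (∀ i → i ℕ.< n → f i ≡ c) → ∏ f n ≡ c ^ n
∏-const zero _ = refl
∏-const (suc n) h = cong₂ _*_ (h n ℕₚ.≤-refl) (∏-const n (λ i l → h i (ℕₚ.m<n⇒m<1+n l)))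

∏-* : ∀ f g n → ∏ (λ i → f i * g i) n ≡ ∏ f n * ∏ g n
∏-* f g zero = refl
∏-* f g (suc n) = trans (cong (f n * g n *_) (∏-* f g n)) (lem (f n) (g n) (∏ f n) (∏ g n))
  where
  lem : ∀ a b c d → a * b * (c * d) ≡ a * c * (b * d)
  lem = solve-∀

∏-cong-∣ : ∀ {k f g} n → (∀ i → i ℕ.< n → k ∣ f i - g i) → k ∣ ∏ f n - ∏ g n
∏-cong-∣ zero _ = divides 0ℤ refl
∏-cong-∣ {k} {f} {g} (suc n) h = ≡⇒∣ (lem (f n) (g n) (∏ f n) (∏ g n))
  (∣m∣n⇒∣m+n (∣n⇒∣m*n (f n) (∏-cong-∣ n (λ i l → h i (ℕₚ.m<n⇒m<1+n l))))
             (∣m⇒∣m*n (∏ g n) (h n ℕₚ.≤-refl)))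
  where
  lem : ∀ a b c d → a * (c - d) + (a - b) * d ≡ a * c - b * d
  lem = solve-∀

∏-product : ∀ (m : ℕ → ℕ) n → ∏ (λ i → + m i) n ≡ + product (map m (downFrom n))
∏-product m zero = refl
∏-product m (suc n) = trans (cong (+ m n *_) (∏-product m n)) (sym (ℤₚ.pos-* (m n) _))

∏-square : ∀ s n → (∀ i → i ℕ.< n → s i * s i ≡ 1ℤ) → ∏ s n * ∏ s n ≡ 1ℤ
∏-square s n h = trans (sym (∏-* s s n)) (trans (∏-const n h) (ℤₚ.^-zeroˡ n))

module OddPrime (p h : ℕ) (pp : Prime p) (p≡ : p ≡ suc (h ℕ.+ h)) where

  P = + p

  -- `p` divides the product of the difference and the sum of two numbers from 1, ..., h. Both
  -- factors are below `p` in absolute value and the sum is positive, so the difference is 0.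
  square-injective : ∀ i j → i ℕ.< h → j ℕ.< h →
    P ∣ + suc i * + suc i - + suc j * + suc j → i ≡ j
  square-injective i j i<h j<h d = [ equal , ⊥-elim ∘ distinct ]′
    (prime-∣* pp (+ suc i - + suc j) (+ suc i + + suc j) (≡⇒∣ (lem (+ suc i) (+ suc j)) d))
    where
    lem : ∀ x y → x * x - y * y ≡ (x - y) * (x + y)
    lem = solve-∀
    lt : abs (+ suc i - + suc j) ℕ.< p
    lt = subst (abs (+ suc i - + suc j) ℕ.<_) (sym p≡)
      (s≤s (ℕₚ.≤-trans (subst (λ z → abs z ℕ.≤ suc i ℕ.⊔ suc j) (sym (ℤₚ.m-n≡m⊖n (suc i) (suc j)))
          (ℤₚ.∣m⊝n∣≤m⊔n (suc i) (suc j)))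
           (ℕₚ.≤-trans (ℕₚ.⊔-lub i<h j<h) (ℕₚ.m≤m+n h h))))
    equal : P ∣ + suc i - + suc j → i ≡ j
    equal e = ℕₚ.suc-injective (ℤₚ.+-injective (ℤₚ.i-j≡0⇒i≡j (+ suc i) (+ suc j) (∣∧<⇒≡0 (+ suc i - + suc j) e lt)))
    distinct : P ∣ + suc i + + suc j → ⊥
    distinct e = ℕ∣.>⇒∤ (subst (suc i ℕ.+ suc j ℕ.<_) (sym p≡) (s≤s (ℕₚ.+-mono-≤ i<h j<h))) (∣⇒∣ℕ e)

  ∤∏suc : ∀ n → n ℕ.≤ h → ¬ (P ∣ ∏ (λ i → + suc i) n)
  ∤∏suc zero _ d = prime-∤1 pp d
  ∤∏suc (suc n) n<h d with prime-∣* pp (+ suc n) _ d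
  ... | inj₁ e = ℕ∣.>⇒∤ (subst (suc n ℕ.<_) (sym p≡) (s≤s (ℕₚ.≤-trans n<h (ℕₚ.m≤m+n h h)))) (∣⇒∣ℕ e)
  ... | inj₂ e = ∤∏suc n (ℕₚ.<⇒≤ n<h) e

  -- The signs `s` and absolute residues `m` are parameters: `fermat` obtains them by division with
  -- remainder, `gauss-minus5` from explicit formulas. Since the `m i` permute 1, ..., h,
  -- multiplying all congruences and cancelling the factorial of h leaves `a ^ h` against the
  -- product of the signs.
  gauss : (a : ℤ) → ¬ (P ∣ a) → (m : ℕ → ℕ) (s : ℕ → ℤ) →
    (∀ i → i ℕ.< h → m i ℕ.≤ h × s i * s i ≡ 1ℤ × P ∣ a * + suc i - s i * + m i) →
    P ∣ a ^ h - ∏ s h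
  gauss a p∤a m s hyp = [ (λ e → e) , (λ e → ⊥-elim (∤∏suc h ℕₚ.≤-refl e)) ]′
    (prime-∣* pp (a ^ h - ∏ s h) (∏ (λ i → + suc i) h) factored)
    where
    nonzero : ∀ i → i ℕ.< h → m i ≢ 0
    nonzero i i<h mi≡0 = [ p∤a , (λ e → ℕ∣.>⇒∤ (subst (suc i ℕ.<_) (sym p≡) (s≤s (ℕₚ.≤-trans i<h (ℕₚ.m≤m+n h h))))
        (∣⇒∣ℕ e)) ]′
      (prime-∣* pp a (+ suc i)
        (≡⇒∣ (trans (cong (λ z → a * + suc i - s i * + z) mi≡0) (lem (a * + suc i) (s i))) (proj₂ (proj₂ (hyp i i<h)))))
      where
      lem : ∀ x y → x - y * 0ℤ ≡ x
      lem = solve-∀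

    -- Multiplying each congruence by its sign isolates the common residue, so the difference is `a`
    -- times `s i * + suc i - s j * + suc j`. Cancelling `a` and passing to squares removes the
    -- signs.
    inj : ∀ i j → i ℕ.< h → j ℕ.< h → m i ≡ m j → i ≡ j
    inj i j i<h j<h eq = [ (λ e → ⊥-elim (p∤a e)) , same ]′
      (prime-∣* pp a (s i * + suc i - s j * + suc j) (≡⇒∣ (eq1 a (s i) (s j) (+ suc i) (+ suc j) (+ m i)) combined))
      where
      si² = proj₁ (proj₂ (hyp i i<h))
      sj² = proj₁ (proj₂ (hyp j j<h))
      eq1 : ∀ a s t x y m → (s * (a * x - s * m) + (s * s) * m) - (t * (a * y - t * m) + (t * t) * m) ≡ a *
          (s * x - t * y)
      eq1 = solve-∀
      eq2 : ∀ u v m → u - v ≡ (u + 1ℤ * m) - (v + 1ℤ * m)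
      eq2 = solve-∀
      combined : P ∣ (s i * (a * + suc i - s i * + m i) + (s i * s i) * + m i)
          - (s j * (a * + suc j - s j * + m i) + (s j * s j) * + m i)
      combined rewrite si² | sj² = ≡⇒∣ (eq2 (s i * (a * + suc i - s i * + m i)) (s j * (a * + suc j - s j * + m i))
          (+ m i))
        (∣m∣n⇒∣m-n (∣n⇒∣m*n (s i) (proj₂ (proj₂ (hyp i i<h))))
                   (∣n⇒∣m*n (s j) (subst (λ z → P ∣ a * + suc j - s j * + z) (sym eq) (proj₂ (proj₂ (hyp j j<h))))))
      eq3 : ∀ s t x y → (s * x - t * y) * (s * x + t * y) ≡ s * s * (x * x) - t * t * (y * y)
      eq3 = solve-∀
      eq5 : ∀ x y → 1ℤ * x - 1ℤ * y ≡ x - y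
      eq5 = solve-∀
      eq4 : s i * s i * (+ suc i * + suc i) - s j * s j * (+ suc j * + suc j) ≡ + suc i * + suc i - + suc j * + suc j
      eq4 rewrite si² | sj² = eq5 (+ suc i * + suc i) (+ suc j * + suc j)
      same : P ∣ s i * + suc i - s j * + suc j → i ≡ j
      same e = square-injective i j i<h j<h
        (≡⇒∣ (trans (eq3 (s i) (s j) (+ suc i) (+ suc j)) eq4) (∣m⇒∣m*n (s i * + suc i + s j * + suc j) e))

    unique : ∀ n → n ℕ.≤ h → Unique (map m (downFrom n))
    unique zero _ = []
    unique (suc n) n<h = All.tabulate fresh ∷ unique n (ℕₚ.<⇒≤ n<h)
      where
      fresh : ∀ {z} → z ∈ map m (downFrom n) → m n ≢ z
      fresh z∈ eq with ∈-map⁻ m z∈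
      ... | j , j∈ , refl with ∈-downFrom⁻ j∈
      ... | j<n = ℕₚ.<-irrefl (sym (inj n j n<h (ℕₚ.<-trans j<n n<h) eq)) j<n

    sub : ∀ {z} → z ∈ map m (downFrom h) → z ∈ map suc (downFrom h)
    sub z∈ with ∈-map⁻ m z∈
    ... | j , j∈ , refl with m j in eq | nonzero j (∈-downFrom⁻ j∈) | proj₁ (hyp j (∈-downFrom⁻ j∈))
    ... | zero | nz | _ = ⊥-elim (nz refl)
    ... | suc k | _ | k<h = ∈-map⁺ suc (∈-downFrom⁺ k<h)

    perm : ∏ (λ i → + m i) h ≡ ∏ (λ i → + suc i) h
    perm = trans (∏-product m h) (trans (cong +_ (product-↭ (Unique-⊆⇒↭ (unique h ℕₚ.≤-refl) sub
      (ℕₚ.≤-reflexive (trans (length-map suc (downFrom h)) (sym (length-map m (downFrom h))))))))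
          (sym (∏-product suc h)))

    factored : P ∣ (a ^ h - ∏ s h) * ∏ (λ i → + suc i) h
    factored = ≡⇒∣ (trans (cong₂ _-_ (trans (∏-* (λ _ → a) (λ i → + suc i) h)
        (cong (_* ∏ (λ i → + suc i) h) (∏-const h (λ _ _ → refl))))
                                     (trans (∏-* s (λ i → + m i) h) (cong (∏ s h *_) perm)))
                          (lem (a ^ h) (∏ s h) (∏ (λ i → + suc i) h)))
                   (∏-cong-∣ h (λ i l → proj₂ (proj₂ (hyp i l))))
      where
      lem : ∀ x y z → x * z - y * z ≡ (x - y) * z
      lem = solve-∀

-- Euler's criterion

-- [c₀ , … , c_{d-1}] stands for the monic polynomial c₀ + c₁x + … + c_{d-1}x^{d-1} + x^d.
evalMonic : ∀ {d} → Vec ℤ d → ℤ → ℤ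
evalMonic [] x = 1ℤ
evalMonic (c ∷ cs) x = c + x * evalMonic cs x

-- Synthetic division: the coefficients of the quotient are the Horner values of the tails at `r`.
divideByRoot : ∀ {d} → ℤ → Vec ℤ (suc d) → Vec ℤ d
divideByRoot r (c ∷ []) = []
divideByRoot r (c ∷ cs@(_ ∷ _)) = evalMonic cs r ∷ divideByRoot r cs

divideByRoot-correct : ∀ {d} r (v : Vec ℤ (suc d)) x →
  evalMonic v x - evalMonic v r ≡ (x - r) * evalMonic (divideByRoot r v) x
divideByRoot-correct r (c ∷ []) x = lem c x r
  where
  lem : ∀ c x r → c + x * 1ℤ - (c + r * 1ℤ) ≡ (x - r) * 1ℤ
  lem = solve-∀
divideByRoot-correct r (c ∷ cs@(_ ∷ _)) x =
  trans (lem₁ c x r (evalMonic cs x) (evalMonic cs r))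
    (trans (cong (λ z → x * z + (x - r) * evalMonic cs r) (divideByRoot-correct r cs x))
           (lem₂ x (x - r) (evalMonic (divideByRoot r cs) x) (evalMonic cs r)))
  where
  lem₁ : ∀ c x r e f → c + x * e - (c + r * f) ≡ x * (e - f) + (x - r) * f
  lem₁ = solve-∀
  lem₂ : ∀ x y q f → x * (y * q) + y * f ≡ y * (f + x * q)
  lem₂ = solve-∀

-- Lagrange's bound. Dividing by `x - r` lowers the degree by one and keeps the polynomial monic;
-- the other roots survive because `p` is prime and they are incongruent to `r`. In degree 0 a root
-- would make `p` divide 1.
monic-roots-bound : ∀ {p d} → Prime p → (v : Vec ℤ d) (rs : List ℤ) → length rs ≡ suc d →
  AllPairs (λ x y → ¬ (+ p ∣ y - x)) rs → All (λ x → + p ∣ evalMonic v x) rs → ⊥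
monic-roots-bound pp [] (r ∷ rs) _ _ (d ∷ _) = prime-∤1 pp d
monic-roots-bound {p} pp v@(_ ∷ _) (r ∷ rs) len (r# ∷ ps) (dr ∷ ds) =
  monic-roots-bound pp (divideByRoot r v) rs (ℕₚ.suc-injective len) ps (roots r# ds)
  where
  roots : ∀ {xs} → All (λ y → ¬ (+ p ∣ y - r)) xs → All (λ x → + p ∣ evalMonic v x) xs →
    All (λ x → + p ∣ evalMonic (divideByRoot r v) x) xs
  roots [] [] = []
  roots {x ∷ _} (n ∷ ns) (e ∷ es) =
    [ ⊥-elim ∘ n , id ]′ (prime-∣* pp (x - r) _ (≡⇒∣ (divideByRoot-correct r v x) (∣m∣n⇒∣m-n e dr))) ∷ roots ns es

evalMonic-0s : ∀ n x → evalMonic (replicate n 0ℤ) x ≡ x ^ n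
evalMonic-0s zero x = refl
evalMonic-0s (suc n) x = trans (ℤₚ.+-identityˡ _) (cong (x *_) (evalMonic-0s n x))

square-^ : ∀ (x : ℤ) n → (x * x) ^ n ≡ x ^ n * x ^ n
square-^ x zero = refl
square-^ x (suc n) = trans (cong (x * x *_) (square-^ x n)) (lem x (x ^ n))
  where
  lem : ∀ x y → x * x * (y * y) ≡ x * y * (x * y)
  lem = solve-∀

m+m≤1+h+h⇒m≤h : ∀ m h → m ℕ.+ m ℕ.≤ suc (h ℕ.+ h) → m ℕ.≤ h
m+m≤1+h+h⇒m≤h zero h _ = z≤n
m+m≤1+h+h⇒m≤h (suc m) zero (s≤s le) = ⊥-elim (ℕₚ.<⇒≱ (ℕₚ.≤-<-trans z≤n
    (subst (m ℕ.<_) (sym (ℕₚ.+-suc m m)) (s≤s (ℕₚ.m≤m+n m m)))) le)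
m+m≤1+h+h⇒m≤h (suc m) (suc h) (s≤s le) = s≤s (m+m≤1+h+h⇒m≤h m h
    (ℕ.s≤s⁻¹ (subst₂ ℕ._≤_ (ℕₚ.+-suc m m) (cong suc (ℕₚ.+-suc h h)) le)))

pos-∸ : ∀ {a b} → b ℕ.≤ a → + (a ℕ.∸ b) ≡ + a - + b
pos-∸ {a} {b} le = trans (sym (ℤₚ.⊖-≥ le)) (sym (ℤₚ.m-n≡m⊖n a b))

module Euler (p h : ℕ) (pp : Prime p) (p≡ : p ≡ suc (h ℕ.+ h)) where

  open OddPrime p h pp p≡

  private instance
    p≢0 : ℕ.NonZero p
    p≢0 = prime⇒nonZero pp

  -- Gauss's lemma with least absolute residues makes `x ^ h` congruent to a product of signs, whose
  -- square is 1. In this form the result says that squares are roots of x^h - 1.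
  fermat : ∀ x → ¬ (P ∣ + x) → P ∣ (+ x * + x) ^ h - 1ℤ
  fermat x p∤x = ≡⇒∣ (trans (lem ((+ x) ^ h) (∏ s h)) (cong₂ _-_ (sym (square-^ (+ x) h))
      (∏-square s h (λ i l → proj₁ (proj₂ (hyp i l))))))
    (∣m⇒∣m*n ((+ x) ^ h + ∏ s h) (gauss (+ x) p∤x m s hyp))
    where
    lem : ∀ a b → (a - b) * (a + b) ≡ a * a - b * b
    lem = solve-∀
    t : ℕ → ℕ
    t i = (x ℕ.* suc i) ℕ.% p
    choose : ∀ r → Dec (r ℕ.≤ h) → ℕ × ℤ
    choose r (yes _) = r , 1ℤ
    choose r (no _) = p ℕ.∸ r , -1ℤ
    m : ℕ → ℕ
    m i = proj₁ (choose (t i) (t i ℕ.≤? h))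
    s : ℕ → ℤ
    s i = proj₂ (choose (t i) (t i ℕ.≤? h))
    div : ∀ i → P ∣ + x * + suc i - + t i
    div i = divides (+ (x ℕ.* suc i ℕ./ p)) (trans (cong (_- + t i) (trans (sym (ℤₚ.pos-* x (suc i)))
      (trans (cong +_ (ℕ%.m≡m%n+[m/n]*n (x ℕ.* suc i) p))
        (trans (ℤₚ.pos-+ (t i) _) (cong (λ z → + t i + z) (ℤₚ.pos-* (x ℕ.* suc i ℕ./ p) p))))))
      (lem′ (+ t i) (+ (x ℕ.* suc i ℕ./ p) * + p)))
      where
      lem′ : ∀ a b → a + b - a ≡ b
      lem′ = solve-∀
    aux : ∀ y r (d : Dec (r ℕ.≤ h)) → r ℕ.< p → P ∣ y - + r → proj₁ (choose r d) ℕ.≤ h × proj₂ (choose r d) * proj₂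
        (choose r d) ≡ 1ℤ × P ∣ y - proj₂ (choose r d) * + proj₁ (choose r d)
    aux y r (yes le) _ d = le , refl , ≡⇒∣ (cong (λ z → y - z) (sym (ℤₚ.*-identityˡ (+ r)))) d
    aux y r (no r≰h) r<p d = ℕₚ.+-cancelʳ-≤ r (p ℕ.∸ r) h (subst (ℕ._≤ h ℕ.+ r) (sym (ℕₚ.m∸n+n≡m (ℕₚ.<⇒≤ r<p)))
                                  (subst₂ ℕ._≤_ (sym p≡) refl (subst (ℕ._≤ h ℕ.+ r) (ℕₚ.+-suc h h)
                                      (ℕₚ.+-monoʳ-≤ h (ℕₚ.≰⇒> r≰h)))))
      , refl , ≡⇒∣ (trans (lem″ y P (+ r)) (cong (λ z → y - -1ℤ * z) (sym (pos-∸ (ℕₚ.<⇒≤ r<p)))))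
          (∣m∣n⇒∣m+n d (∣-refl {P}))
      where
      lem″ : ∀ y p r → y - r + p ≡ y - -1ℤ * (p - r)
      lem″ = solve-∀
    hyp : ∀ i → i ℕ.< h → m i ℕ.≤ h × s i * s i ≡ 1ℤ × P ∣ + x * + suc i - s i * + m i
    hyp i _ = aux (+ x * + suc i) (t i) (t i ℕ.≤? h) (ℕ%.m%n<n (x ℕ.* suc i) p) (div i)

  -- The squares of 1, …, h already exhaust the roots of x^h - 1.
  euler : ∀ a → P ∣ a ^ h - 1ℤ → ∃ λ e → P ∣ + e * + e - a
  euler a d = search (ℕₚ.anyUpTo? (λ i → P ∣? (+ suc i * + suc i - a)) h)
    where
    sq : ℕ → ℤ
    sq i = + suc i * + suc i
    0<h : 0 ℕ.< h
    0<h = ℕₚ.n≢0⇒n>0 (λ h≡0 → ¬prime[1] (subst Prime (trans p≡ (cong (λ z → suc (z ℕ.+ z)) h≡0)) pp))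
    distinct : ∀ n → n ℕ.≤ h → AllPairs (λ x y → ¬ (P ∣ y - x)) (map sq (downFrom n))
    distinct zero _ = []
    distinct (suc n) n<h = All.tabulate fresh ∷ distinct n (ℕₚ.<⇒≤ n<h)
      where
      fresh : ∀ {z} → z ∈ map sq (downFrom n) → ¬ (P ∣ z - sq n)
      fresh z∈ e with ∈-map⁻ sq z∈
      ... | j , j∈ , refl = ℕₚ.<-irrefl (square-injective j n (ℕₚ.<-trans (∈-downFrom⁻ j∈) n<h) n<h e) (∈-downFrom⁻ j∈)
    root : ∀ x → P ∣ x ^ h - 1ℤ → ∀ k → h ≡ suc k → P ∣ evalMonic (-1ℤ ∷ replicate k 0ℤ) x
    root x e k refl = ≡⇒∣ (trans (ℤₚ.+-comm (x ^ suc k) -1ℤ) (cong (λ z → -1ℤ + x * z) (sym (evalMonic-0s k x)))) e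
    search : Dec (∃ λ i → i ℕ.< h × P ∣ + suc i * + suc i - a) → ∃ λ e → P ∣ + e * + e - a
    search (yes (i , _ , e)) = suc i , e
    search (no none) = ⊥-elim (contra (h ℕ.∸ 1) (sym (ℕₚ.m+[n∸m]≡n 0<h)))
      where
      contra : ∀ k → h ≡ suc k → ⊥
      contra k eq = monic-roots-bound pp (-1ℤ ∷ replicate k 0ℤ) (a ∷ map sq (downFrom h))
        (cong suc (trans (length-map sq (downFrom h)) (trans (length-downFrom h) eq)))
        (All.tabulate fresh ∷ distinct h ℕₚ.≤-refl)
        (root a d k eq ∷ All.tabulate squares)
        where
        fresh : ∀ {z} → z ∈ map sq (downFrom h) → ¬ (P ∣ z - a)
        fresh z∈ e with ∈-map⁻ sq z∈
        ... | j , j∈ , refl = none (j , ∈-downFrom⁻ j∈ , e)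
        squares : ∀ {z} → z ∈ map sq (downFrom h) → P ∣ evalMonic (-1ℤ ∷ replicate k 0ℤ) z
        squares z∈ with ∈-map⁻ sq z∈
        ... | j , j∈ , refl = root (sq j) (fermat (suc j) p∤) k eq
          where
          p∤ : ¬ (P ∣ + suc j)
          p∤ e = ℕ∣.>⇒∤ (subst (suc j ℕ.<_) (sym p≡) (s≤s (ℕₚ.≤-trans (∈-downFrom⁻ j∈) (ℕₚ.m≤m+n h h)))) (∣⇒∣ℕ e)

-- Square roots of -5

/-unique : ∀ j y p .{{_ : ℕ.NonZero p}} → j ℕ.* p ℕ.≤ y → y ℕ.< suc j ℕ.* p → y ℕ./ p ≡ j
/-unique j y p lo hi = ℕₚ.≤-antisym (ℕ.s≤s⁻¹ (ℕ%.m<n*o⇒m/o<n hi))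
  (subst (ℕ._≤ y ℕ./ p) (ℕ%.m*n/n≡m j p) (ℕ%./-monoˡ-≤ p lo))

a+a≤b+b⇒a≤b : ∀ {a b} → a ℕ.+ a ℕ.≤ b ℕ.+ b → a ℕ.≤ b
a+a≤b+b⇒a≤b {a} {b} le = ℕₚ.≮⇒≥ (λ b<a → ℕₚ.<⇒≱ (ℕₚ.+-mono-< b<a b<a) le)

-- Sign and absolute value of the least residue of -5x, for x with j p < 10 x ≤ (j + 1) p.
segmentSign : ℕ → ℤ
segmentSign 0 = -1ℤ
segmentSign 1 = 1ℤ
segmentSign 2 = -1ℤ
segmentSign 3 = 1ℤ
segmentSign _ = -1ℤ

segmentResidue : ℕ → ℕ → ℕ → ℕ
segmentResidue p 0 x = 5 ℕ.* x ℕ.∸ 0 ℕ.* p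
segmentResidue p 1 x = 1 ℕ.* p ℕ.∸ 5 ℕ.* x
segmentResidue p 2 x = 5 ℕ.* x ℕ.∸ 1 ℕ.* p
segmentResidue p 3 x = 2 ℕ.* p ℕ.∸ 5 ℕ.* x
segmentResidue p _ x = 5 ℕ.* x ℕ.∸ 2 ℕ.* p

module MinusFive (p h : ℕ) (pp : Prime p) (p≡ : p ≡ suc (h ℕ.+ h)) (p∤5 : ¬ (+ p ∣ + 5)) where

  open OddPrime p h pp p≡
  open Euler p h pp p≡

  private instance
    p≢0 : ℕ.NonZero p
    p≢0 = prime⇒nonZero pp

  half-distance : ∀ a b → a ℕ.≤ b → b ℕ.+ b ℕ.≤ a ℕ.+ a ℕ.+ p → b ℕ.∸ a ℕ.≤ h
  half-distance a b a≤b le = m+m≤1+h+h⇒m≤h m h (subst (m ℕ.+ m ℕ.≤_) p≡ (ℕₚ.+-cancelˡ-≤ (a ℕ.+ a) _ _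
    (subst (ℕ._≤ a ℕ.+ a ℕ.+ p) (trans (cong (λ z → z ℕ.+ z) (sym (ℕₚ.m+[n∸m]≡n a≤b))) (lem a m)) le)))
    where
    m = b ℕ.∸ a
    lem : ∀ a m → (a ℕ.+ m) ℕ.+ (a ℕ.+ m) ≡ a ℕ.+ a ℕ.+ (m ℕ.+ m)
    lem = ℕ-solve-∀

  below : ∀ t x → t ℕ.* p ℕ.≤ 5 ℕ.* x → P ∣ - (+ 5) * + x - -1ℤ * + (5 ℕ.* x ℕ.∸ t ℕ.* p)
  below t x le = divides (- + t) (trans (cong (λ z → - (+ 5) * + x - -1ℤ * z)
      (trans (pos-∸ le) (cong₂ _-_ (ℤₚ.pos-* 5 x) (ℤₚ.pos-* t p)))) (lem (+ x) (+ t) P))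
    where
    lem : ∀ x t p → - (+ 5) * x - -1ℤ * (+ 5 * x - t * p) ≡ - t * p
    lem = solve-∀

  above : ∀ t x → 5 ℕ.* x ℕ.≤ t ℕ.* p → P ∣ - (+ 5) * + x - 1ℤ * + (t ℕ.* p ℕ.∸ 5 ℕ.* x)
  above t x le = divides (- + t) (trans (cong (λ z → - (+ 5) * + x - 1ℤ * z)
      (trans (pos-∸ le) (cong₂ _-_ (ℤₚ.pos-* t p) (ℤₚ.pos-* 5 x)))) (lem (+ x) (+ t) P))
    where
    lem : ∀ x t p → - (+ 5) * x - 1ℤ * (t * p - + 5 * x) ≡ - t * p
    lem = solve-∀

  -- On a segment the multiple `t * p` nearest to `5 * x` is fixed: `t` is 0, 1, 1, 2, 2 for `j`
  -- from 0 to 4. The bounds are stated for `10 * x` because the segments are half as long as `p` on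
  -- the scale of `5 * x`.
  segment-residue : ∀ j x → j ℕ.< 5 → j ℕ.* p ℕ.≤ 5 ℕ.* x ℕ.+ 5 ℕ.* x → 5 ℕ.* x ℕ.+ 5 ℕ.* x ℕ.≤ suc j ℕ.* p →
    segmentResidue p j x ℕ.≤ h × segmentSign j * segmentSign j ≡ 1ℤ × P ∣ - (+ 5) * + x - segmentSign j *
        + segmentResidue p j x
  segment-residue 0 x _ lo hi = half-distance 0 (5 ℕ.* x) z≤n (subst (5 ℕ.* x ℕ.+ 5 ℕ.* x ℕ.≤_) (lem p) hi) , refl ,
      below 0 x z≤n
    where
    lem : ∀ p → 1 ℕ.* p ≡ p
    lem = ℕ-solve-∀
  segment-residue 1 x _ lo hi = half-distance (5 ℕ.* x) (1 ℕ.* p) le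
      (subst (ℕ._≤ 5 ℕ.* x ℕ.+ 5 ℕ.* x ℕ.+ p) (lem₁ p) (ℕₚ.+-monoˡ-≤ p lo)) , refl , above 1 x le
    where
    lem : ∀ p → 2 ℕ.* p ≡ 1 ℕ.* p ℕ.+ 1 ℕ.* p
    lem = ℕ-solve-∀
    lem₁ : ∀ p → 1 ℕ.* p ℕ.+ p ≡ 1 ℕ.* p ℕ.+ 1 ℕ.* p
    lem₁ = ℕ-solve-∀
    le : 5 ℕ.* x ℕ.≤ 1 ℕ.* p
    le = a+a≤b+b⇒a≤b (subst (5 ℕ.* x ℕ.+ 5 ℕ.* x ℕ.≤_) (lem p) hi)
  segment-residue 2 x _ lo hi = half-distance (1 ℕ.* p) (5 ℕ.* x) le (subst (5 ℕ.* x ℕ.+ 5 ℕ.* x ℕ.≤_) (lem₁ p) hi)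
      , refl , below 1 x le
    where
    lem : ∀ p → 2 ℕ.* p ≡ 1 ℕ.* p ℕ.+ 1 ℕ.* p
    lem = ℕ-solve-∀
    lem₁ : ∀ p → 3 ℕ.* p ≡ 1 ℕ.* p ℕ.+ 1 ℕ.* p ℕ.+ p
    lem₁ = ℕ-solve-∀
    le : 1 ℕ.* p ℕ.≤ 5 ℕ.* x
    le = a+a≤b+b⇒a≤b (subst (ℕ._≤ 5 ℕ.* x ℕ.+ 5 ℕ.* x) (lem p) lo)
  segment-residue 3 x _ lo hi = half-distance (5 ℕ.* x) (2 ℕ.* p) le
      (subst (ℕ._≤ 5 ℕ.* x ℕ.+ 5 ℕ.* x ℕ.+ p) (lem₁ p) (ℕₚ.+-monoˡ-≤ p lo)) , refl , above 2 x le
    where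
    lem : ∀ p → 4 ℕ.* p ≡ 2 ℕ.* p ℕ.+ 2 ℕ.* p
    lem = ℕ-solve-∀
    lem₁ : ∀ p → 3 ℕ.* p ℕ.+ p ≡ 2 ℕ.* p ℕ.+ 2 ℕ.* p
    lem₁ = ℕ-solve-∀
    le : 5 ℕ.* x ℕ.≤ 2 ℕ.* p
    le = a+a≤b+b⇒a≤b (subst (5 ℕ.* x ℕ.+ 5 ℕ.* x ℕ.≤_) (lem p) hi)
  segment-residue 4 x _ lo hi = half-distance (2 ℕ.* p) (5 ℕ.* x) le (subst (5 ℕ.* x ℕ.+ 5 ℕ.* x ℕ.≤_) (lem₁ p) hi)
      , refl , below 2 x le
    where
    lem : ∀ p → 4 ℕ.* p ≡ 2 ℕ.* p ℕ.+ 2 ℕ.* p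
    lem = ℕ-solve-∀
    lem₁ : ∀ p → 5 ℕ.* p ≡ 2 ℕ.* p ℕ.+ 2 ℕ.* p ℕ.+ p
    lem₁ = ℕ-solve-∀
    le : 2 ℕ.* p ℕ.≤ 5 ℕ.* x
    le = a+a≤b+b⇒a≤b (subst (ℕ._≤ 5 ℕ.* x ℕ.+ 5 ℕ.* x) (lem p) lo)
  segment-residue (suc (suc (suc (suc (suc _))))) x (s≤s (s≤s (s≤s (s≤s (s≤s ()))))) _ _

  -- The numerator is one less than `10 * suc i`, so that a boundary point falls into the lower
  -- segment.
  segment : ℕ → ℕ
  segment i = (9 ℕ.+ 10 ℕ.* i) ℕ./ p

  gauss-minus5 : P ∣ (- (+ 5)) ^ h - ∏ (segmentSign ∘ segment) h
  gauss-minus5 = gauss (- (+ 5)) (p∤5 ∘ ≡⇒∣ refl ∘ ∣m⇒∣-m) (λ i → segmentResidue p (segment i) (suc i))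
      (segmentSign ∘ segment) hyp
    where
    10x : ∀ i → suc (9 ℕ.+ 10 ℕ.* i) ≡ 5 ℕ.* suc i ℕ.+ 5 ℕ.* suc i
    10x = ℕ-solve-∀
    hyp : ∀ i → i ℕ.< h → segmentResidue p (segment i) (suc i) ℕ.≤ h × segmentSign (segment i) * segmentSign
        (segment i) ≡ 1ℤ
      × P ∣ - (+ 5) * + suc i - segmentSign (segment i) * + segmentResidue p (segment i) (suc i)
    hyp i i<h = segment-residue (segment i) (suc i) (ℕ%.m<n*o⇒m/o<n {n = 5} y<5p)
      (ℕₚ.≤-trans (ℕ%.m/n*n≤m y p) (subst (y ℕ.≤_) (10x i) (ℕₚ.n≤1+n y)))
      (subst (ℕ._≤ suc (segment i) ℕ.* p) (10x i) (subst (ℕ._< suc (segment i) ℕ.* p) (sym (ℕ%.m≡m%n+[m/n]*n y p))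
          (ℕₚ.+-monoˡ-< (segment i ℕ.* p) (ℕ%.m%n<n y p))))
      where
      y = 9 ℕ.+ 10 ℕ.* i
      lem : ∀ h → 5 ℕ.* suc (h ℕ.+ h) ≡ 5 ℕ.+ 5 ℕ.* h ℕ.+ 5 ℕ.* h
      lem = ℕ-solve-∀
      y<5p : y ℕ.< 5 ℕ.* p
      y<5p = subst₂ ℕ._≤_ (sym (10x i)) (trans (sym (lem h)) (cong (5 ℕ.*_) (sym p≡)))
        (ℕₚ.+-mono-≤ (ℕₚ.≤-trans (ℕₚ.*-monoʳ-≤ 5 i<h) (ℕₚ.m≤n+m (5 ℕ.* h) 5)) (ℕₚ.*-monoʳ-≤ 5 i<h))

  -- `c` is the integer part of `j * p / 10`, so everything after the first `c` positions lies
  -- beyond the lower end of segment `j`, and everything before `c′` stays below its upper end.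
  segment≡ : ∀ j c u c′ u′ → u ℕ.≤ 9 → j ℕ.* p ≡ u ℕ.+ 10 ℕ.* c → suc j ℕ.* p ≡ u′ ℕ.+ 10 ℕ.* c′ →
    ∀ i → c ℕ.+ i ℕ.< c′ → segment (c ℕ.+ i) ≡ j
  segment≡ j c u c′ u′ u≤9 eq eq′ i lt = /-unique j (9 ℕ.+ 10 ℕ.* (c ℕ.+ i)) p
    (subst (ℕ._≤ 9 ℕ.+ 10 ℕ.* (c ℕ.+ i)) (sym eq) (ℕₚ.+-mono-≤ u≤9 (ℕₚ.*-monoʳ-≤ 10 (ℕₚ.m≤m+n c i))))
    (subst (9 ℕ.+ 10 ℕ.* (c ℕ.+ i) ℕ.<_) (sym eq′) (ℕₚ.≤-trans
        (subst (ℕ._≤ 10 ℕ.* c′) (lem (c ℕ.+ i)) (ℕₚ.*-monoʳ-≤ 10 lt)) (ℕₚ.m≤n+m (10 ℕ.* c′) u′)))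
    where
    lem : ∀ z → 10 ℕ.* suc z ≡ suc (9 ℕ.+ 10 ℕ.* z)
    lem = ℕ-solve-∀

  -- The `d`s are the numbers of x in the five segments, the `u`s the remainders of p, 2p, 3p, 4p
  -- modulo 10; the last endpoint is 5p = 5 + 10h. Only segments 0, 2 and 4 have sign -1, so an even
  -- `d₀ ℕ.+ d₂ ℕ.+ d₄` makes Gauss's sign 1, and Euler's criterion yields the root.
  sqrt-minus5 : ∀ d₀ d₁ d₂ d₃ d₄ u₁ u₂ u₃ u₄ e →
    u₁ ℕ.≤ 9 → u₂ ℕ.≤ 9 → u₃ ℕ.≤ 9 → u₄ ℕ.≤ 9 →
    1 ℕ.* p ≡ u₁ ℕ.+ 10 ℕ.* d₀ →
    2 ℕ.* p ≡ u₂ ℕ.+ 10 ℕ.* (d₀ ℕ.+ d₁) →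
    3 ℕ.* p ≡ u₃ ℕ.+ 10 ℕ.* (d₀ ℕ.+ d₁ ℕ.+ d₂) →
    4 ℕ.* p ≡ u₄ ℕ.+ 10 ℕ.* (d₀ ℕ.+ d₁ ℕ.+ d₂ ℕ.+ d₃) →
    h ≡ d₀ ℕ.+ d₁ ℕ.+ d₂ ℕ.+ d₃ ℕ.+ d₄ →
    d₀ ℕ.+ d₂ ℕ.+ d₄ ≡ e ℕ.+ e →
    ∃ λ c → P ∣ + c * + c + + 5
  sqrt-minus5 d₀ d₁ d₂ d₃ d₄ u₁ u₂ u₃ u₄ e l₁ l₂ l₃ l₄ e₁ e₂ e₃ e₄ h≡ even =
    euler (- (+ 5)) (subst (λ z → P ∣ (- (+ 5)) ^ h - z) sign≡1 gauss-minus5)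
    where
    s = segmentSign ∘ segment
    5p : ∀ h → 5 ℕ.* suc (h ℕ.+ h) ≡ 5 ℕ.+ 10 ℕ.* h
    5p = ℕ-solve-∀
    e₅ : 5 ℕ.* p ≡ 5 ℕ.+ 10 ℕ.* (d₀ ℕ.+ d₁ ℕ.+ d₂ ℕ.+ d₃ ℕ.+ d₄)
    e₅ = trans (cong (5 ℕ.*_) p≡) (trans (5p h) (cong (λ z → 5 ℕ.+ 10 ℕ.* z) h≡))
    piece : ∀ j c d u u′ → u ℕ.≤ 9 → j ℕ.* p ≡ u ℕ.+ 10 ℕ.* c → suc j ℕ.* p ≡ u′ ℕ.+ 10 ℕ.* (c ℕ.+ d) →
      ∏ (λ i → s (c ℕ.+ i)) d ≡ segmentSign j ^ d
    piece j c d u u′ l q q′ = ∏-const d (λ i i<d → cong segmentSign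
        (segment≡ j c u (c ℕ.+ d) u′ l q q′ i (ℕₚ.+-monoʳ-< c i<d)))
    step : ∀ c d {y z} → ∏ s c ≡ y → ∏ (λ i → s (c ℕ.+ i)) d ≡ z → ∏ s (c ℕ.+ d) ≡ y * z
    step c d q r = trans (∏-+ s c d) (cong₂ _*_ q r)
    sign≡1 : ∏ s h ≡ 1ℤ
    sign≡1 = begin
      ∏ s h ≡⟨ cong (∏ s) h≡ ⟩
      ∏ s (d₀ ℕ.+ d₁ ℕ.+ d₂ ℕ.+ d₃ ℕ.+ d₄)
        ≡⟨ step (d₀ ℕ.+ d₁ ℕ.+ d₂ ℕ.+ d₃) d₄ (step (d₀ ℕ.+ d₁ ℕ.+ d₂) d₃ (step (d₀ ℕ.+ d₁) d₂ (step d₀ d₁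
             (piece 0 0 d₀ 0 u₁ z≤n refl e₁) (piece 1 d₀ d₁ u₁ u₂ l₁ e₁ e₂))
             (piece 2 (d₀ ℕ.+ d₁) d₂ u₂ u₃ l₂ e₂ e₃)) (piece 3 (d₀ ℕ.+ d₁ ℕ.+ d₂) d₃ u₃ u₄ l₃ e₃ e₄))
                 (piece 4 (d₀ ℕ.+ d₁ ℕ.+ d₂ ℕ.+ d₃) d₄ u₄ 5 l₄ e₄ e₅) ⟩
      -1ℤ ^ d₀ * 1ℤ ^ d₁ * -1ℤ ^ d₂ * 1ℤ ^ d₃ * -1ℤ ^ d₄
        ≡⟨ cong₂ (λ y z → -1ℤ ^ d₀ * y * -1ℤ ^ d₂ * z * -1ℤ ^ d₄) (ℤₚ.^-zeroˡ d₁) (ℤₚ.^-zeroˡ d₃) ⟩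
      -1ℤ ^ d₀ * 1ℤ * -1ℤ ^ d₂ * 1ℤ * -1ℤ ^ d₄
        ≡⟨ lem (-1ℤ ^ d₀) (-1ℤ ^ d₂) (-1ℤ ^ d₄) ⟩
      -1ℤ ^ d₀ * -1ℤ ^ d₂ * -1ℤ ^ d₄
        ≡⟨ sym (trans (ℤₚ.^-distribˡ-+-* -1ℤ (d₀ ℕ.+ d₂) d₄) (cong (_* -1ℤ ^ d₄) (ℤₚ.^-distribˡ-+-* -1ℤ d₀ d₂))) ⟩
      -1ℤ ^ (d₀ ℕ.+ d₂ ℕ.+ d₄) ≡⟨ cong (-1ℤ ^_) even ⟩
      -1ℤ ^ (e ℕ.+ e) ≡⟨ ℤₚ.^-distribˡ-+-* -1ℤ e e ⟩
      -1ℤ ^ e * -1ℤ ^ e ≡⟨ sym (square-^ -1ℤ e) ⟩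
      1ℤ ^ e ≡⟨ ℤₚ.^-zeroˡ e ⟩
      1ℤ ∎
      where
      open ≡-Reasoning
      lem : ∀ a b c → a * 1ℤ * b * 1ℤ * c ≡ a * b * c
      lem = solve-∀

prime-∣⇒≡ : ∀ {p q} → Prime p → Prime q → p ℕ∣.∣ q → p ≡ q
prime-∣⇒≡ pp qq d with prime⇒irreducible qq d
... | inj₁ refl = ⊥-elim (¬prime[1] pp)
... | inj₂ eq = eq

prime[3] : Prime 3
prime[3] = from-yes (prime? 3)

prime[5] : Prime 5
prime[5] = from-yes (prime? 5)

≤9 : ∀ m {_ : True (m ℕ.≤? 9)} → m ℕ.≤ 9
≤9 m {t} = toWitness t

-- For p = 20k + r each segment has 2k points plus a correction read off from r, 2r, 3r, 4r on
-- division by 10. The number of minus signs is 6k for r = 1, 3 and 6k + 2 for r = 7, 9.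
∃sqrt-minus5 : ∀ p → Prime p → p ℕ.% 20 ∈ (1 ∷ 3 ∷ 7 ∷ 9 ∷ []) → ∃ λ c → + p ∣ + c * + c + + 5
∃sqrt-minus5 p pp r∈ = go (p ℕ./ 20) r∈ (ℕ%.m≡m%n+[m/n]*n p 20)
  where
  p∤5 : ¬ (+ p ∣ + 5)
  p∤5 d = from-no (5 ∈? (1 ∷ 3 ∷ 7 ∷ 9 ∷ [])) (subst (λ z → z ℕ.% 20 ∈ (1 ∷ 3 ∷ 7 ∷ 9 ∷ []))
      (prime-∣⇒≡ pp prime[5] (∣⇒∣ℕ d)) r∈)
  go : ∀ {r} k → r ∈ (1 ∷ 3 ∷ 7 ∷ 9 ∷ []) → p ≡ r ℕ.+ k ℕ.* 20 → ∃ λ c → + p ∣ + c * + c + + 5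
  go k (here refl) p≡ = MinusFive.sqrt-minus5 p (10 ℕ.* k) pp (trans p≡ (q k)) p∤5
    (2 ℕ.* k) (2 ℕ.* k) (2 ℕ.* k) (2 ℕ.* k) (2 ℕ.* k) 1 2 3 4 (3 ℕ.* k)
    (≤9 1) (≤9 2) (≤9 3) (≤9 4)
    (trans (cong (1 ℕ.*_) p≡) (q₁ k)) (trans (cong (2 ℕ.*_) p≡) (q₂ k)) (trans (cong (3 ℕ.*_) p≡) (q₃ k))
        (trans (cong (4 ℕ.*_) p≡) (q₄ k)) (q₅ k) (q₆ k)
    where
    q : ∀ k → 1 ℕ.+ k ℕ.* 20 ≡ suc (10 ℕ.* k ℕ.+ (10 ℕ.* k))
    q = ℕ-solve-∀
    q₁ : ∀ k → 1 ℕ.* (1 ℕ.+ k ℕ.* 20) ≡ 1 ℕ.+ 10 ℕ.* (2 ℕ.* k)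
    q₁ = ℕ-solve-∀
    q₂ : ∀ k → 2 ℕ.* (1 ℕ.+ k ℕ.* 20) ≡ 2 ℕ.+ 10 ℕ.* ((2 ℕ.* k) ℕ.+ (2 ℕ.* k))
    q₂ = ℕ-solve-∀
    q₃ : ∀ k → 3 ℕ.* (1 ℕ.+ k ℕ.* 20) ≡ 3 ℕ.+ 10 ℕ.* ((2 ℕ.* k) ℕ.+ (2 ℕ.* k) ℕ.+ (2 ℕ.* k))
    q₃ = ℕ-solve-∀
    q₄ : ∀ k → 4 ℕ.* (1 ℕ.+ k ℕ.* 20) ≡ 4 ℕ.+ 10 ℕ.* ((2 ℕ.* k) ℕ.+ (2 ℕ.* k) ℕ.+ (2 ℕ.* k) ℕ.+ (2 ℕ.* k))
    q₄ = ℕ-solve-∀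
    q₅ : ∀ k → 10 ℕ.* k ≡ (2 ℕ.* k) ℕ.+ (2 ℕ.* k) ℕ.+ (2 ℕ.* k) ℕ.+ (2 ℕ.* k) ℕ.+ (2 ℕ.* k)
    q₅ = ℕ-solve-∀
    q₆ : ∀ k → (2 ℕ.* k) ℕ.+ (2 ℕ.* k) ℕ.+ (2 ℕ.* k) ≡ (3 ℕ.* k) ℕ.+ (3 ℕ.* k)
    q₆ = ℕ-solve-∀
  go k (there (here refl)) p≡ = MinusFive.sqrt-minus5 p (1 ℕ.+ 10 ℕ.* k) pp (trans p≡ (q k)) p∤5
    (2 ℕ.* k) (2 ℕ.* k) (2 ℕ.* k) (1 ℕ.+ 2 ℕ.* k) (2 ℕ.* k) 3 6 9 2 (3 ℕ.* k)
    (≤9 3) (≤9 6) (≤9 9) (≤9 2)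
    (trans (cong (1 ℕ.*_) p≡) (q₁ k)) (trans (cong (2 ℕ.*_) p≡) (q₂ k)) (trans (cong (3 ℕ.*_) p≡) (q₃ k))
        (trans (cong (4 ℕ.*_) p≡) (q₄ k)) (q₅ k) (q₆ k)
    where
    q : ∀ k → 3 ℕ.+ k ℕ.* 20 ≡ suc (1 ℕ.+ 10 ℕ.* k ℕ.+ (1 ℕ.+ 10 ℕ.* k))
    q = ℕ-solve-∀
    q₁ : ∀ k → 1 ℕ.* (3 ℕ.+ k ℕ.* 20) ≡ 3 ℕ.+ 10 ℕ.* (2 ℕ.* k)
    q₁ = ℕ-solve-∀
    q₂ : ∀ k → 2 ℕ.* (3 ℕ.+ k ℕ.* 20) ≡ 6 ℕ.+ 10 ℕ.* ((2 ℕ.* k) ℕ.+ (2 ℕ.* k))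
    q₂ = ℕ-solve-∀
    q₃ : ∀ k → 3 ℕ.* (3 ℕ.+ k ℕ.* 20) ≡ 9 ℕ.+ 10 ℕ.* ((2 ℕ.* k) ℕ.+ (2 ℕ.* k) ℕ.+ (2 ℕ.* k))
    q₃ = ℕ-solve-∀
    q₄ : ∀ k → 4 ℕ.* (3 ℕ.+ k ℕ.* 20) ≡ 2 ℕ.+ 10 ℕ.* ((2 ℕ.* k) ℕ.+ (2 ℕ.* k) ℕ.+ (2 ℕ.* k) ℕ.+ (1 ℕ.+ 2 ℕ.* k))
    q₄ = ℕ-solve-∀
    q₅ : ∀ k → 1 ℕ.+ 10 ℕ.* k ≡ (2 ℕ.* k) ℕ.+ (2 ℕ.* k) ℕ.+ (2 ℕ.* k) ℕ.+ (1 ℕ.+ 2 ℕ.* k) ℕ.+ (2 ℕ.* k)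
    q₅ = ℕ-solve-∀
    q₆ : ∀ k → (2 ℕ.* k) ℕ.+ (2 ℕ.* k) ℕ.+ (2 ℕ.* k) ≡ (3 ℕ.* k) ℕ.+ (3 ℕ.* k)
    q₆ = ℕ-solve-∀
  go k (there (there (here refl))) p≡ = MinusFive.sqrt-minus5 p (3 ℕ.+ 10 ℕ.* k) pp (trans p≡ (q k)) p∤5
    (2 ℕ.* k) (1 ℕ.+ 2 ℕ.* k) (1 ℕ.+ 2 ℕ.* k) (2 ℕ.* k) (1 ℕ.+ 2 ℕ.* k) 7 4 1 8 (1 ℕ.+ 3 ℕ.* k)
    (≤9 7) (≤9 4) (≤9 1) (≤9 8)
    (trans (cong (1 ℕ.*_) p≡) (q₁ k)) (trans (cong (2 ℕ.*_) p≡) (q₂ k)) (trans (cong (3 ℕ.*_) p≡) (q₃ k))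
        (trans (cong (4 ℕ.*_) p≡) (q₄ k)) (q₅ k) (q₆ k)
    where
    q : ∀ k → 7 ℕ.+ k ℕ.* 20 ≡ suc (3 ℕ.+ 10 ℕ.* k ℕ.+ (3 ℕ.+ 10 ℕ.* k))
    q = ℕ-solve-∀
    q₁ : ∀ k → 1 ℕ.* (7 ℕ.+ k ℕ.* 20) ≡ 7 ℕ.+ 10 ℕ.* (2 ℕ.* k)
    q₁ = ℕ-solve-∀
    q₂ : ∀ k → 2 ℕ.* (7 ℕ.+ k ℕ.* 20) ≡ 4 ℕ.+ 10 ℕ.* ((2 ℕ.* k) ℕ.+ (1 ℕ.+ 2 ℕ.* k))
    q₂ = ℕ-solve-∀
    q₃ : ∀ k → 3 ℕ.* (7 ℕ.+ k ℕ.* 20) ≡ 1 ℕ.+ 10 ℕ.* ((2 ℕ.* k) ℕ.+ (1 ℕ.+ 2 ℕ.* k) ℕ.+ (1 ℕ.+ 2 ℕ.* k))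
    q₃ = ℕ-solve-∀
    q₄ : ∀ k → 4 ℕ.* (7 ℕ.+ k ℕ.* 20) ≡ 8 ℕ.+ 10 ℕ.* ((2 ℕ.* k) ℕ.+ (1 ℕ.+ 2 ℕ.* k) ℕ.+ (1 ℕ.+ 2 ℕ.* k) ℕ.+ (2 ℕ.* k))
    q₄ = ℕ-solve-∀
    q₅ : ∀ k → 3 ℕ.+ 10 ℕ.* k ≡ (2 ℕ.* k) ℕ.+ (1 ℕ.+ 2 ℕ.* k) ℕ.+ (1 ℕ.+ 2 ℕ.* k) ℕ.+ (2 ℕ.* k) ℕ.+ (1 ℕ.+ 2 ℕ.* k)
    q₅ = ℕ-solve-∀
    q₆ : ∀ k → (2 ℕ.* k) ℕ.+ (1 ℕ.+ 2 ℕ.* k) ℕ.+ (1 ℕ.+ 2 ℕ.* k) ≡ (1 ℕ.+ 3 ℕ.* k) ℕ.+ (1 ℕ.+ 3 ℕ.* k)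
    q₆ = ℕ-solve-∀
  go k (there (there (there (here refl)))) p≡ = MinusFive.sqrt-minus5 p (4 ℕ.+ 10 ℕ.* k) pp (trans p≡ (q k)) p∤5
    (2 ℕ.* k) (1 ℕ.+ 2 ℕ.* k) (1 ℕ.+ 2 ℕ.* k) (1 ℕ.+ 2 ℕ.* k) (1 ℕ.+ 2 ℕ.* k) 9 8 7 6 (1 ℕ.+ 3 ℕ.* k)
    (≤9 9) (≤9 8) (≤9 7) (≤9 6)
    (trans (cong (1 ℕ.*_) p≡) (q₁ k)) (trans (cong (2 ℕ.*_) p≡) (q₂ k)) (trans (cong (3 ℕ.*_) p≡) (q₃ k))
        (trans (cong (4 ℕ.*_) p≡) (q₄ k)) (q₅ k) (q₆ k)
    where
    q : ∀ k → 9 ℕ.+ k ℕ.* 20 ≡ suc (4 ℕ.+ 10 ℕ.* k ℕ.+ (4 ℕ.+ 10 ℕ.* k))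
    q = ℕ-solve-∀
    q₁ : ∀ k → 1 ℕ.* (9 ℕ.+ k ℕ.* 20) ≡ 9 ℕ.+ 10 ℕ.* (2 ℕ.* k)
    q₁ = ℕ-solve-∀
    q₂ : ∀ k → 2 ℕ.* (9 ℕ.+ k ℕ.* 20) ≡ 8 ℕ.+ 10 ℕ.* ((2 ℕ.* k) ℕ.+ (1 ℕ.+ 2 ℕ.* k))
    q₂ = ℕ-solve-∀
    q₃ : ∀ k → 3 ℕ.* (9 ℕ.+ k ℕ.* 20) ≡ 7 ℕ.+ 10 ℕ.* ((2 ℕ.* k) ℕ.+ (1 ℕ.+ 2 ℕ.* k) ℕ.+ (1 ℕ.+ 2 ℕ.* k))
    q₃ = ℕ-solve-∀
    q₄ : ∀ k → 4 ℕ.* (9 ℕ.+ k ℕ.* 20) ≡ 6 ℕ.+ 10 ℕ.* ((2 ℕ.* k) ℕ.+ (1 ℕ.+ 2 ℕ.* k) ℕ.+ (1 ℕ.+ 2 ℕ.* k) ℕ.+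
        (1 ℕ.+ 2 ℕ.* k))
    q₄ = ℕ-solve-∀
    q₅ : ∀ k → 4 ℕ.+ 10 ℕ.* k ≡ (2 ℕ.* k) ℕ.+ (1 ℕ.+ 2 ℕ.* k) ℕ.+ (1 ℕ.+ 2 ℕ.* k) ℕ.+ (1 ℕ.+ 2 ℕ.* k) ℕ.+
        (1 ℕ.+ 2 ℕ.* k)
    q₅ = ℕ-solve-∀
    q₆ : ∀ k → (2 ℕ.* k) ℕ.+ (1 ℕ.+ 2 ℕ.* k) ℕ.+ (1 ℕ.+ 2 ℕ.* k) ≡ (1 ℕ.+ 3 ℕ.* k) ℕ.+ (1 ℕ.+ 3 ℕ.* k)
    q₆ = ℕ-solve-∀

-- Forms of determinant 5

Point : Set
Point = ℤ × ℤ

value : BQF → Point → ℤ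
value f (x , y) = evalForm f x y

uip : {A : Set} {x y : A} (p q : x ≡ y) → p ≡ q
uip refl refl = refl

Reps-≡ : ∀ f n {u v : Reps f n} → proj₁ u ≡ proj₁ v → u ≡ v
Reps-≡ f n {z , p} {_ , q} refl = cong (z ,_) (uip p q)

infix 4 _≅_
-- A bijection of points rather than a matrix, since only numbers of representations are compared.
-- Improper equivalences, such as changing the sign of y, are included.
record _≅_ (f g : BQF) : Set where
  field
    to from : Point → Point
    to-from : ∀ z → to (from z) ≡ z
    from-to : ∀ z → from (to z) ≡ z
    value-to : ∀ z → value g (to z) ≡ value f z

≅-refl : ∀ {f} → f ≅ f
≅-refl = record { to = id ; from = id ; to-from = λ _ → refl ; from-to = λ _ → refl ; value-to = λ _ → refl }

≅-trans : ∀ {f g h} → f ≅ g → g ≅ h → f ≅ h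
≅-trans p q = record
  { to = Q.to ∘ P.to ; from = P.from ∘ Q.from
  ; to-from = λ z → trans (cong Q.to (P.to-from (Q.from z))) (Q.to-from z)
  ; from-to = λ z → trans (cong P.from (Q.from-to (P.to z))) (P.from-to z)
  ; value-to = λ z → trans (Q.value-to (P.to z)) (P.value-to z) }
  where
  module P = _≅_ p
  module Q = _≅_ q

≅⇒↔ : ∀ {f g} → f ≅ g → ∀ n → Reps f n ↔ Reps g n
≅⇒↔ {f} {g} p n = mk↔ₛ′
  (λ (z , e) → to z , trans (value-to z) e)
  (λ (z , e) → from z , trans (sym (value-to (from z))) (trans (cong (value g) (to-from z)) e))
  (λ (z , _) → Reps-≡ g n (to-from z))
  (λ (z , _) → Reps-≡ f n (from-to z))
  where open _≅_ p

form-flip : ∀ a b c → form a (+ 2 * b) c ≅ form a (+ 2 * - b) c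
form-flip a b c = record
  { to = λ (x , y) → x , - y ; from = λ (x , y) → x , - y
  ; to-from = λ (x , y) → cong (x ,_) (ℤₚ.neg-involutive y)
  ; from-to = λ (x , y) → cong (x ,_) (ℤₚ.neg-involutive y)
  ; value-to = λ (x , y) → lem a b c x y }
  where
  lem : ∀ a b c x y → a * x * x + (+ 2 * - b) * x * - y + c * - y * - y ≡ a * x * x + (+ 2 * b) * x * y + c * y * y
  lem = solve-∀

form-swap : ∀ a b c → form a b c ≅ form c b a
form-swap a b c = record
  { to = λ (x , y) → y , x ; from = λ (x , y) → y , x
  ; to-from = λ _ → refl ; from-to = λ _ → refl
  ; value-to = λ (x , y) → lem a b c x y }
  where
  lem : ∀ a b c x y → c * y * y + b * y * x + a * x * x ≡ a * x * x + b * x * y + c * y * y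
  lem = solve-∀

form-shear : ∀ a b c → form a (+ 2 * b) c ≅ form a (+ 2 * (b - a)) (a - + 2 * b + c)
form-shear a b c = record
  { to = λ (x , y) → x + y , y ; from = λ (x , y) → x - y , y
  ; to-from = λ (x , y) → cong (_, y) (lem₁ x y)
  ; from-to = λ (x , y) → cong (_, y) (lem₂ x y)
  ; value-to = λ (x , y) → lem a b c x y }
  where
  lem₁ : ∀ x y → x - y + y ≡ x
  lem₁ = solve-∀
  lem₂ : ∀ x y → x + y - y ≡ x
  lem₂ = solve-∀
  lem : ∀ a b c x y → a * (x + y) * (x + y) + (+ 2 * (b - a)) * (x + y) * y + (a - + 2 * b + c) * y * y ≡ a * x * x
      + (+ 2 * b) * x * y + c * y * y
  lem = solve-∀

form-abs : ∀ a b c → form a (+ 2 * b) c ≅ form a (+ 2 * + abs b) c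
form-abs a (+ b) c = ≅-refl
form-abs a -[1+ b ] c = form-flip a -[1+ b ] c

f₁ f₂ : BQF
f₁ = form (+ 1) (+ 0) (+ 5)
f₂ = form (+ 2) (+ 2) (+ 3)

positive-cofactor : ∀ a z n → + a * z ≡ + suc n → ∃ λ k → z ≡ + k
positive-cofactor a (+ k) n _ = k , refl
positive-cofactor zero -[1+ k ] n ()
positive-cofactor (suc a) -[1+ k ] n ()

abs-square : ∀ z → + (abs z ℕ.* abs z) ≡ z * z
abs-square (+ n) = ℤₚ.pos-* n n
abs-square -[1+ n ] = refl

Reducible : ℕ → ℕ → ℕ → Set
Reducible a b c = form (+ a) (+ 2 * + b) (+ c) ≅ f₁ ⊎ form (+ a) (+ 2 * + b) (+ c) ≅ f₂

reducible-via : ∀ {a b c} {g} → form (+ a) (+ 2 * + b) (+ c) ≅ g → g ≅ f₁ ⊎ g ≅ f₂ → Reducible a b c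
reducible-via e = Sum.map (≅-trans e) (≅-trans e)

-- The product of the two bounds is 4b² ≤ ac = b² + 5, whence b ≤ 1. Then ac is 5 or 6, and up to
-- the order of a and c only `f₁` and `f₂` are left.
reduced : ∀ a b c → a ℕ.* c ≡ b ℕ.* b ℕ.+ 5 → b ℕ.+ b ℕ.≤ a → b ℕ.+ b ℕ.≤ c → Reducible a b c
reduced a 0 c eq _ _ = go (prime⇒irreducible prime[5] (ℕ∣.divides c (trans (sym eq) (ℕₚ.*-comm a c)))) eq
  where
  go : ∀ {a} → a ≡ 1 ⊎ a ≡ 5 → a ℕ.* c ≡ 5 → Reducible a 0 c
  go (inj₁ refl) e with refl ← trans (sym (ℕₚ.+-identityʳ c)) e = inj₁ ≅-refl
  go (inj₂ refl) e with refl ← ℕₚ.*-cancelˡ-≡ c 1 5 e = inj₁ (form-swap (+ 5) (+ 0) (+ 1))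
reduced (suc (suc zero)) 1 c eq _ _ with refl ← ℕₚ.*-cancelˡ-≡ c 3 2 eq = inj₂ ≅-refl
reduced (suc (suc (suc zero))) 1 c eq _ _ with refl ← ℕₚ.*-cancelˡ-≡ c 2 3 eq = inj₂ (form-swap (+ 3) (+ 2) (+ 2))
reduced (suc (suc (suc (suc a)))) 1 c eq _ 2≤c =
  ⊥-elim (ℕₚ.<⇒≱ {6} {8} (s≤s (s≤s (s≤s (s≤s (s≤s (s≤s (s≤s z≤n)))))))
    (subst (8 ℕ.≤_) eq (ℕₚ.*-mono-≤ {4} {4 ℕ.+ a} (ℕₚ.m≤m+n 4 a) 2≤c)))
reduced (suc zero) 1 c eq (s≤s ()) _
reduced a (suc (suc k)) c eq la lc =
  ⊥-elim (ℕₚ.<⇒≱ (subst (b ℕ.* b ℕ.+ 5 ℕ.<_) (sym (lem k)) (s≤s (ℕₚ.m≤m+n _ _)))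
      (subst ((b ℕ.+ b) ℕ.* (b ℕ.+ b) ℕ.≤_) eq (ℕₚ.*-mono-≤ la lc)))
  where
  b = suc (suc k)
  lem : ∀ k → (2 ℕ.+ k ℕ.+ (2 ℕ.+ k)) ℕ.* (2 ℕ.+ k ℕ.+ (2 ℕ.+ k)) ≡ suc
      ((2 ℕ.+ k) ℕ.* (2 ℕ.+ k) ℕ.+ 5 ℕ.+ (6 ℕ.+ 12 ℕ.* k ℕ.+ 3 ℕ.* k ℕ.* k))
  lem = ℕ-solve-∀

ℤ-det : ∀ a b c → a ℕ.* c ≡ b ℕ.* b ℕ.+ 5 → + a * + c ≡ + b * + b + + 5
ℤ-det a b c eq = trans (sym (ℤₚ.pos-* a c)) (trans (cong +_ eq)
    (trans (ℤₚ.pos-+ (b ℕ.* b) 5) (cong (_+ + 5) (ℤₚ.pos-* b b))))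

-- Shearing replaces b by b - a and c by a - 2b + c, which is smaller than c because a < 2b and
-- still positive because the determinant remains 5. A sign change then makes the middle coefficient
-- nonnegative.
shear-step : ∀ a b c → a ℕ.* c ≡ b ℕ.* b ℕ.+ 5 → a ℕ.< b ℕ.+ b →
  ∃₂ λ b′ c′ → a ℕ.* c′ ≡ b′ ℕ.* b′ ℕ.+ 5 × c′ ℕ.< c × form (+ a) (+ 2 * + b) (+ c) ≅ form (+ a) (+ 2 * + b′) (+ c′)
shear-step a b c eq a<2b = abs bℤ , c′ , ℤₚ.+-injective det′ , c′<c ,
  ≅-trans (subst (λ z → form (+ a) (+ 2 * + b) (+ c) ≅ form (+ a) (+ 2 * bℤ) z) (proj₂ cofactor)
      (form-shear (+ a) (+ b) (+ c)))
          (form-abs (+ a) bℤ (+ c′))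
  where
  bℤ = + b - + a
  cℤ = + a - + 2 * + b + + c
  lem : ∀ a b c → a * (a - + 2 * b + c) ≡ (b - a) * (b - a) + (a * c - b * b)
  lem = solve-∀
  lem₁ : ∀ b f → b * b + f - b * b ≡ f
  lem₁ = solve-∀
  det : + a * cℤ ≡ + (abs bℤ ℕ.* abs bℤ ℕ.+ 5)
  det = trans (lem (+ a) (+ b) (+ c)) (trans (cong (λ z → bℤ * bℤ + z)
      (trans (cong (_- + b * + b) (ℤ-det a b c eq)) (lem₁ (+ b) (+ 5))))
    (trans (cong (_+ + 5) (sym (abs-square bℤ))) (sym (ℤₚ.pos-+ (abs bℤ ℕ.* abs bℤ) 5))))
  cofactor : ∃ λ k → cℤ ≡ + k
  cofactor = positive-cofactor a cℤ (abs bℤ ℕ.* abs bℤ ℕ.+ 4) (trans det (cong +_ (ℕₚ.+-suc _ 4)))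
  c′ = proj₁ cofactor
  det′ : + (a ℕ.* c′) ≡ + (abs bℤ ℕ.* abs bℤ ℕ.+ 5)
  det′ = trans (ℤₚ.pos-* a c′) (trans (cong (+ a *_) (sym (proj₂ cofactor))) det)
  lem₂ : ∀ a b c → a - + 2 * b + c + (b + b) ≡ a + c
  lem₂ = solve-∀
  sum≡ : c′ ℕ.+ (b ℕ.+ b) ≡ a ℕ.+ c
  sum≡ = ℤₚ.+-injective (trans (cong (_+ (+ b + + b)) (sym (proj₂ cofactor))) (lem₂ (+ a) (+ b) (+ c)))
  c′<c : c′ ℕ.< c
  c′<c = ℕₚ.≰⇒> (λ c≤c′ → ℕₚ.<⇒≢ (ℕₚ.+-mono-<-≤ a<2b c≤c′) (trans (sym sum≡) (ℕₚ.+-comm c′ (b ℕ.+ b))))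

-- Each step keeps one outer coefficient and lowers the other, so a + c measures the descent.
reduce : ∀ fuel a b c → a ℕ.+ c ℕ.< fuel → a ℕ.* c ≡ b ℕ.* b ℕ.+ 5 → Reducible a b c
reduce (suc fuel) a b c (s≤s lt) eq = go (a ℕ.<? b ℕ.+ b) (c ℕ.<? b ℕ.+ b)
  where
  go : Dec (a ℕ.< b ℕ.+ b) → Dec (c ℕ.< b ℕ.+ b) → Reducible a b c
  go (yes a<2b) _ = let b′ , c′ , eq′ , c′<c , e = shear-step a b c eq a<2b in
    reducible-via {a} {b} {c} e (reduce fuel a b′ c′ (ℕₚ.<-≤-trans (ℕₚ.+-monoʳ-< a c′<c) lt) eq′)
  go (no _) (yes c<2b) = let b′ , a′ , eq′ , a′<a , e = shear-step c b a (trans (ℕₚ.*-comm c a) eq) c<2b in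
    reducible-via {a} {b} {c} (≅-trans (form-swap (+ a) (+ 2 * + b) (+ c)) e)
      (reduce fuel c b′ a′ (ℕₚ.<-≤-trans (ℕₚ.+-monoʳ-< c a′<a) (subst (ℕ._≤ fuel) (ℕₚ.+-comm a c) lt)) eq′)
  go (no a≮2b) (no c≮2b) = reduced a b c eq (ℕₚ.≮⇒≥ a≮2b) (ℕₚ.≮⇒≥ c≮2b)

reduction : ∀ a b c → + a * c ≡ b * b + + 5 → form (+ a) (+ 2 * b) c ≅ f₁ ⊎ form (+ a) (+ 2 * b) c ≅ f₂
reduction a b c eq = go (positive-cofactor a c (abs b ℕ.* abs b ℕ.+ 4) (trans det (cong +_ (ℕₚ.+-suc _ 4)))) det
  where
  det : + a * c ≡ + (abs b ℕ.* abs b ℕ.+ 5)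
  det = trans eq (trans (cong (_+ + 5) (sym (abs-square b))) (sym (ℤₚ.pos-+ (abs b ℕ.* abs b) 5)))
  go : ∀ {c} → (∃ λ k → c ≡ + k) → + a * c ≡ + (abs b ℕ.* abs b ℕ.+ 5) → form (+ a) (+ 2 * b) c ≅ f₁ ⊎ form (+ a)
      (+ 2 * b) c ≅ f₂
  go (k , refl) e = Sum.map (≅-trans (form-abs (+ a) b (+ k))) (≅-trans (form-abs (+ a) b (+ k)))
    (reduce (suc (a ℕ.+ k)) a (abs b) k ℕₚ.≤-refl (ℤₚ.+-injective (trans (ℤₚ.pos-* a k) e)))

∣-⇒%≡ : ∀ d v w .{{_ : ℕ.NonZero d}} → + d ∣ + v - + w → v ℕ.% d ≡ w ℕ.% d
∣-⇒%≡ d v w (divides (+ q) eq) = trans (cong (ℕ._% d) v≡) (ℕ%.[m+kn]%n≡m%n w q d)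
  where
  lem : ∀ v w → v ≡ w + (v - w)
  lem = solve-∀
  v≡ : v ≡ w ℕ.+ q ℕ.* d
  v≡ = ℤₚ.+-injective (trans (lem (+ v) (+ w)) (trans (cong (λ z → + w + z) (trans eq (sym (ℤₚ.pos-* q d))))
      (sym (ℤₚ.pos-+ w (q ℕ.* d)))))
∣-⇒%≡ d v w (divides -[1+ q ] eq) = sym (trans (cong (ℕ._% d) w≡) (ℕ%.[m+kn]%n≡m%n v (suc q) d))
  where
  lem : ∀ v w → w ≡ v - (v - w)
  lem = solve-∀
  lem₁ : ∀ v q d → v - - q * d ≡ v + q * d
  lem₁ = solve-∀
  w≡ : w ≡ v ℕ.+ suc q ℕ.* d
  w≡ = ℤₚ.+-injective (trans (lem (+ v) (+ w)) (trans (cong (λ z → + v - z) eq) (trans (lem₁ (+ v) (+ suc q) (+ d))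
    (trans (cong (λ z → + v + z) (sym (ℤₚ.pos-* (suc q) d))) (sym (ℤₚ.pos-+ v (suc q ℕ.* d)))))))

valueℕ : ℕ → ℕ → ℕ → ℕ → ℕ → ℕ
valueℕ a b c i j = a ℕ.* i ℕ.* i ℕ.+ b ℕ.* i ℕ.* j ℕ.+ c ℕ.* j ℕ.* j

pos-value : ∀ a b c i j → + valueℕ a b c i j ≡ evalForm (form (+ a) (+ b) (+ c)) (+ i) (+ j)
pos-value a b c i j = trans (ℤₚ.pos-+ (a ℕ.* i ℕ.* i ℕ.+ b ℕ.* i ℕ.* j) _)
  (cong₂ _+_ (trans (ℤₚ.pos-+ (a ℕ.* i ℕ.* i) _) (cong₂ _+_ (mono a i i) (mono b i j))) (mono c j j))
  where
  mono : ∀ a i j → + (a ℕ.* i ℕ.* j) ≡ + a * + i * + j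
  mono a i j = trans (ℤₚ.pos-* (a ℕ.* i) j) (cong (_* + j) (ℤₚ.pos-* a i))

residues : ∀ a b c d .{{_ : ℕ.NonZero d}} {x y v} → evalForm (form (+ a) (+ b) (+ c)) x y ≡ + v →
  v ℕ.% d ≡ valueℕ a b c (x %ℕ d) (y %ℕ d) ℕ.% d
residues a b c d {x} {y} {v} eq = ∣-⇒%≡ d v (valueℕ a b c i j)
  (≡⇒∣ (trans (cong₂ (λ x y → evalForm f x y - evalForm f (+ i) (+ j)) (sym (ℤ%.a≡a%ℕn+[a/ℕn]*n x d))
      (sym (ℤ%.a≡a%ℕn+[a/ℕn]*n y d)))
               (cong₂ _-_ eq (sym (pos-value a b c i j))))
    (divides (q (x /ℕ d) (y /ℕ d)) (lem (+ a) (+ b) (+ c) (+ i) (+ j) (x /ℕ d) (y /ℕ d) (+ d))))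
  where
  f = form (+ a) (+ b) (+ c)
  i = x %ℕ d
  j = y %ℕ d
  q : ℤ → ℤ → ℤ
  q u v = + a * (+ 2 * + i * u + u * u * + d) + + b * (+ i * v + + j * u + u * v * + d) + + c *
      (+ 2 * + j * v + v * v * + d)
  lem : ∀ a b c i j u v d → a * (i + u * d) * (i + u * d) + b * (i + u * d) * (j + v * d) + c * (j + v * d) *
      (j + v * d) - (a * i * i + b * i * j + c * j * j)
    ≡ (a * (+ 2 * i * u + u * u * d) + b * (i * v + j * u + u * v * d) + c * (+ 2 * j * v + v * v * d)) * d
  lem = solve-∀

residue-check : ∀ d .{{_ : ℕ.NonZero d}} {P : ℕ → ℕ → Set} (P? : ∀ i j → Dec (P i j)) →
  {_ : True (ℕₚ.allUpTo? (λ i → ℕₚ.allUpTo? (P? i) d) d)} → ∀ x y → P (x %ℕ d) (y %ℕ d)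
residue-check d P? {t} x y = toWitness t (ℤ%.n%ℕd<d x d) (ℤ%.n%ℕd<d y d)

-- Residues modulo 20 of the values of `f₁` and `f₂`. Among the units, 1 and 9 occur only in the
-- first list, 3 and 7 only in the second, and 11, 13, 17, 19 in neither.
values₁ values₂ : List ℕ
values₁ = 0 ∷ 1 ∷ 4 ∷ 5 ∷ 6 ∷ 9 ∷ 10 ∷ 14 ∷ 16 ∷ []
values₂ = 0 ∷ 2 ∷ 3 ∷ 7 ∷ 8 ∷ 10 ∷ 12 ∷ 15 ∷ 18 ∷ []

f₁-values : ∀ z {v} → value f₁ z ≡ + v → v ℕ.% 20 ∈ values₁
f₁-values (x , y) eq = subst (_∈ values₁) (sym (residues 1 0 5 20 {x} {y} eq))
  (residue-check 20 (λ i j → (valueℕ 1 0 5 i j ℕ.% 20) ∈? values₁) x y)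

f₂-values : ∀ z {v} → value f₂ z ≡ + v → v ℕ.% 20 ∈ values₂
f₂-values (x , y) eq = subst (_∈ values₂) (sym (residues 2 2 3 20 {x} {y} eq))
  (residue-check 20 (λ i j → (valueℕ 2 2 3 i j ℕ.% 20) ∈? values₂) x y)

-- Counting representations

Finite : Set → Set
Finite A = Σ ℕ λ k → Fin k ↔ A

finite-≡ : ∀ {A B} (F : Finite A) (G : Finite B) → A ↔ B → proj₁ F ≡ proj₁ G
finite-≡ (_ , F) (_ , G) e = ↔⇒≡ (↔-trans F (↔-trans e (↔-sym G)))

finite-⊎ : ∀ {A B} → Finite A → Finite B → Finite (A ⊎ B)
finite-⊎ (k , F) (l , G) = k ℕ.+ l , ↔-trans +↔⊎ (F ⊎-↔ G)

finite-⊥ : ∀ {A : Set} → ¬ A → Finite A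
finite-⊥ ¬a = 0 , ↔-trans 0↔⊥ (mk↔ₛ′ (λ ()) ¬a (λ a → ⊥-elim (¬a a)) (λ ()))

lookup-injective : ∀ {A : Set} {xs : List A} → Unique xs → ∀ i j → lookup xs i ≡ lookup xs j → i ≡ j
lookup-injective (_ ∷ _) Fin.zero Fin.zero _ = refl
lookup-injective (x∉ ∷ _) Fin.zero (Fin.suc j) eq = ⊥-elim (All.lookup x∉ (∈-lookup j) eq)
lookup-injective (x∉ ∷ _) (Fin.suc i) Fin.zero eq = ⊥-elim (All.lookup x∉ (∈-lookup i) (sym eq))
lookup-injective (_ ∷ u) (Fin.suc i) (Fin.suc j) eq = cong Fin.suc (lookup-injective u i j eq)

finite-list : ∀ {A : Set} → DecidableEquality A → (xs : List A) → (∀ a → a ∈ xs) → Finite A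
finite-list {A} _≟_ xs all = length ys , mk↔ₛ′ (lookup ys) (λ a → Any.index (all′ a))
    (λ a → sym (lookup-index (all′ a)))
  (λ i → lookup-injective unique _ _ (sym (lookup-index (all′ (lookup ys i)))))
  where
  ys = deduplicate _≟_ xs
  unique = UniqueDec.deduplicate-! _≟_ xs
  all′ : ∀ a → a ∈ ys
  all′ a = ∈-deduplicate⁺ _≟_ (all a)

box : ℕ → List ℤ
box B = map +_ (upTo (suc B)) ++ map (λ n → - + n) (upTo (suc B))

∈-box : ∀ B z → abs z ℕ.≤ B → z ∈ box B
∈-box B (+ n) le = ∈-++⁺ˡ (∈-map⁺ +_ (∈-upTo⁺ (s≤s le)))
∈-box B -[1+ n ] le = ∈-++⁺ʳ (map +_ (upTo (suc B))) (∈-map⁺ (λ n → - + n) (∈-upTo⁺ (s≤s le)))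

finite-Reps : ∀ f n B → (∀ x y → evalForm f x y ≡ + n → abs x ℕ.≤ B × abs y ℕ.≤ B) → Finite (Reps f n)
finite-Reps f n B bound = finite-list _≟_ (collect points)
  (λ (z , e) → complete points z e (∈-cartesianProduct⁺ (∈-box B (proj₁ z) (proj₁ (bound (proj₁ z) (proj₂ z) e)))
      (∈-box B (proj₂ z) (proj₂ (bound (proj₁ z) (proj₂ z) e)))))
  where
  points = cartesianProduct (box B) (box B)
  _≟_ : DecidableEquality (Reps f n)
  u ≟ v = map′ (Reps-≡ f n) (cong proj₁) (≡-dec ℤ._≟_ ℤ._≟_ (proj₁ u) (proj₁ v))
  add : ∀ z → Dec (value f z ≡ + n) → List (Reps f n) → List (Reps f n)
  add z (yes e) us = (z , e) ∷ us
  add z (no _) us = us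
  collect : List Point → List (Reps f n)
  collect [] = []
  collect (z ∷ zs) = add z (value f z ℤ.≟ + n) (collect zs)
  add-here : ∀ z d us (e : value f z ≡ + n) → (z , e) ∈ add z d us
  add-here z (yes _) us e = here (Reps-≡ f n refl)
  add-here z (no ne) us e = ⊥-elim (ne e)
  add-there : ∀ z d us u → u ∈ us → u ∈ add z d us
  add-there z (yes _) us u u∈ = there u∈
  add-there z (no _) us u u∈ = u∈
  complete : ∀ zs z (e : value f z ≡ + n) → z ∈ zs → (z , e) ∈ collect zs
  complete (z ∷ zs) .z e (here refl) = add-here z (value f z ℤ.≟ + n) (collect zs) e
  complete (z′ ∷ zs) z e (there z∈) = add-there z′ (value f z′ ℤ.≟ + n) (collect zs) (z , e) (complete zs z e z∈)

-- Inclusion and exclusion without subtraction: an element satisfying `P` goes to the `P` side, and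
-- the extra copy of a common element supplies the `Q` side.
cover-↔ : ∀ {A : Set} (P Q : A → Set) → (∀ a → Dec (P a)) → (∀ {a} (s t : P a) → s ≡ t) → (∀ {a} (s t : Q a) → s ≡ t) →
  (∀ a → P a ⊎ Q a) → (A ⊎ Σ A (λ a → P a × Q a)) ↔ (Σ A P ⊎ Σ A Q)
cover-↔ {A} P Q P? irrP irrQ cover = mk↔ₛ′ to from to-from from-to
  where
  other : ∀ a → ¬ P a → Q a
  other a ¬p = [ ⊥-elim ∘ ¬p , id ]′ (cover a)
  to₁ : ∀ a → Dec (P a) → Σ A P ⊎ Σ A Q
  to₁ a (yes p) = inj₁ (a , p)
  to₁ a (no ¬p) = inj₂ (a , other a ¬p)
  to : A ⊎ Σ A (λ a → P a × Q a) → Σ A P ⊎ Σ A Q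
  to (inj₁ a) = to₁ a (P? a)
  to (inj₂ (a , _ , q)) = inj₂ (a , q)
  from₂ : ∀ a → Q a → Dec (P a) → A ⊎ Σ A (λ a → P a × Q a)
  from₂ a q (yes p) = inj₂ (a , p , q)
  from₂ a q (no _) = inj₁ a
  from : Σ A P ⊎ Σ A Q → A ⊎ Σ A (λ a → P a × Q a)
  from (inj₁ (a , _)) = inj₁ a
  from (inj₂ (a , q)) = from₂ a q (P? a)
  to-from : ∀ u → to (from u) ≡ u
  to-from (inj₁ (a , p)) with P? a
  ... | yes p′ = cong (λ s → inj₁ (a , s)) (irrP p′ p)
  ... | no ¬p = ⊥-elim (¬p p)
  to-from (inj₂ (a , q)) with P? a in eq
  ... | yes p = refl
  ... | no ¬p rewrite eq = cong (λ s → inj₂ (a , s)) (irrQ _ q)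
  from-to : ∀ u → from (to u) ≡ u
  from-to (inj₁ a) with P? a in eq
  ... | yes p = refl
  ... | no ¬p rewrite eq = refl
  from-to (inj₂ (a , p , q)) with P? a
  ... | yes p′ = cong (λ s → inj₂ (a , s , q)) (irrP p′ p)
  ... | no ¬p = ⊥-elim (¬p p)

linear : ℤ → ℤ → ℤ → ℤ → Point → Point
linear α β γ δ (x , y) = α * x + β * y , γ * x + δ * y

linear-injective : ∀ α β γ δ {D} .{{_ : ℤ.NonZero D}} → α * δ - β * γ ≡ D → ∀ {w w′} →
  linear α β γ δ w ≡ linear α β γ δ w′ → w ≡ w′
linear-injective α β γ δ {D} det {x , y} {x′ , y′} eq = cong₂ _,_
  (ℤₚ.*-cancelˡ-≡ D x x′ (trans (sym (X x y)) (trans (cong (λ (u , v) → δ * u - β * v) eq) (X x′ y′))))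
  (ℤₚ.*-cancelˡ-≡ D y y′ (trans (sym (Y x y)) (trans (cong (λ (u , v) → α * v - γ * u) eq) (Y x′ y′))))
  where
  lemX : ∀ α β γ δ x y → δ * (α * x + β * y) - β * (γ * x + δ * y) ≡ (α * δ - β * γ) * x
  lemX = solve-∀
  lemY : ∀ α β γ δ x y → α * (γ * x + δ * y) - γ * (α * x + β * y) ≡ (α * δ - β * γ) * y
  lemY = solve-∀
  X : ∀ x y → δ * (α * x + β * y) - β * (γ * x + δ * y) ≡ D * x
  X x y = trans (lemX α β γ δ x y) (cong (_* x) det)
  Y : ∀ x y → α * (γ * x + δ * y) - γ * (α * x + β * y) ≡ D * y
  Y x y = trans (lemY α β γ δ x y) (cong (_* y) det)

-- A change of variables: the linear map multiplies values by `d`, is injective because its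
-- determinant is nonzero, and reaches every representation of `d ℕ.* n` inside `S`.
sublattice-↔ : ∀ f g d n .{{_ : ℕ.NonZero d}} (S : Point → Set) → (∀ {z} (s t : S z) → s ≡ t) →
  ∀ α β γ δ {D} .{{_ : ℤ.NonZero D}} → α * δ - β * γ ≡ D →
  (∀ w → value f (linear α β γ δ w) ≡ + d * value g w) →
  (∀ w → S (linear α β γ δ w)) →
  (∀ z → value f z ≡ + (d ℕ.* n) → S z → ∃ λ w → linear α β γ δ w ≡ z) →
  Σ (Reps f (d ℕ.* n)) (S ∘ proj₁) ↔ Reps g n
sublattice-↔ f g d n S irr α β γ δ det scale inS onto = mk↔ₛ′ to from
  (λ (w , e) → Reps-≡ g n (linear-injective α β γ δ det (proj₂ (pre (from (w , e))))))
  (λ u → full (proj₂ (pre u)))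
  where
  pre : (u : Σ (Reps f (d ℕ.* n)) (S ∘ proj₁)) → ∃ λ w → linear α β γ δ w ≡ proj₁ (proj₁ u)
  pre ((z , e) , s) = onto z e s
  to : Σ (Reps f (d ℕ.* n)) (S ∘ proj₁) → Reps g n
  to u@((z , e) , s) = proj₁ (pre u) , ℤₚ.*-cancelˡ-≡ (+ d) (value g (proj₁ (pre u))) (+ n)
    (trans (sym (scale (proj₁ (pre u)))) (trans (cong (value f) (proj₂ (pre u))) (trans e (ℤₚ.pos-* d n))))
  from : Reps g n → Σ (Reps f (d ℕ.* n)) (S ∘ proj₁)
  from (w , e) = (linear α β γ δ w , trans (scale w) (trans (cong (+ d *_) e) (sym (ℤₚ.pos-* d n)))) , inS w
  full : ∀ {u v : Σ (Reps f (d ℕ.* n)) (S ∘ proj₁)} → proj₁ (proj₁ u) ≡ proj₁ (proj₁ v) → u ≡ v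
  full {(z , e) , s} {(.z , e′) , s′} refl with refl ← uip e e′ | refl ← irr s s′ = refl

sublattice-full-↔ : ∀ f g d n .{{_ : ℕ.NonZero d}} →
  ∀ α β γ δ {D} .{{_ : ℤ.NonZero D}} → α * δ - β * γ ≡ D →
  (∀ w → value f (linear α β γ δ w) ≡ + d * value g w) →
  (∀ z → value f z ≡ + (d ℕ.* n) → ∃ λ w → linear α β γ δ w ≡ z) →
  Reps f (d ℕ.* n) ↔ Reps g n
sublattice-full-↔ f g d n α β γ δ det scale onto = ↔-trans (mk↔ₛ′ (_, tt) proj₁ (λ _ → refl) (λ _ → refl))
  (sublattice-↔ f g d n (λ _ → ⊤) (λ _ _ → refl) α β γ δ det scale (λ _ → tt) (λ z e _ → onto z e))

square-bound : ∀ x a b n → + suc a * (x * x) + + b ≡ + n → abs x ℕ.≤ n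
square-bound x a b n eq = ℕₚ.≤-trans (ℕₚ.≤-trans (x≤x² (abs x))
    (ℕₚ.≤-trans (ℕₚ.m≤m+n _ (a ℕ.* (abs x ℕ.* abs x))) (ℕₚ.m≤m+n _ b))) (ℕₚ.≤-reflexive eqℕ)
  where
  x≤x² : ∀ x → x ℕ.≤ x ℕ.* x
  x≤x² zero = z≤n
  x≤x² (suc x) = ℕₚ.m≤m*n (suc x) (suc x)
  eqℕ : suc a ℕ.* (abs x ℕ.* abs x) ℕ.+ b ≡ n
  eqℕ = ℤₚ.+-injective (trans (ℤₚ.pos-+ (suc a ℕ.* (abs x ℕ.* abs x)) b)
      (trans (cong (_+ + b) (trans (ℤₚ.pos-* (suc a) (abs x ℕ.* abs x)) (cong (+ suc a *_) (abs-square x)))) eq))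

F : Bool → BQF
F false = f₁
F true = f₂

-- The factor 3 comes from `f₂`, where squares are completed after scaling: 3 f₂ = 5x² + (x + 3y)²
-- and 2 f₂ = 5y² + (2x + y)².
bounded : ∀ b n x y → evalForm (F b) x y ≡ + n → abs x ℕ.≤ 3 ℕ.* n × abs y ℕ.≤ 3 ℕ.* n
bounded false n x y e = ℕₚ.≤-trans (square-bound x 0 (5 ℕ.* (abs y ℕ.* abs y)) n
    (trans (cong (λ t → + 1 * (x * x) + t) (trans (ℤₚ.pos-* 5 (abs y ℕ.* abs y)) (cong (+ 5 *_) (abs-square y))))
    (trans (lem₁ x y) e))) (ℕₚ.m≤m+n n (2 ℕ.* n))
  , ℕₚ.≤-trans (square-bound y 4 (abs x ℕ.* abs x) n (trans (cong (λ t → + 5 * (y * y) + t) (abs-square x))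
      (trans (lem₂ x y) e))) (ℕₚ.m≤m+n n (2 ℕ.* n))
  where
  lem₁ : ∀ x y → + 1 * (x * x) + + 5 * (y * y) ≡ + 1 * x * x + + 0 * x * y + + 5 * y * y
  lem₁ = solve-∀
  lem₂ : ∀ x y → + 5 * (y * y) + x * x ≡ + 1 * x * x + + 0 * x * y + + 5 * y * y
  lem₂ = solve-∀
bounded true n x y e = square-bound x 4 (abs u ℕ.* abs u) (3 ℕ.* n)
    (trans (cong (λ t → + 5 * (x * x) + t) (abs-square u))
    (trans (lem₁ x y) (trans (cong (+ 3 *_) e) (sym (ℤₚ.pos-* 3 n)))))
  , ℕₚ.≤-trans (square-bound y 4 (abs v ℕ.* abs v) (2 ℕ.* n)
      (trans (cong (λ t → + 5 * (y * y) + t) (abs-square v))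
      (trans (lem₂ x y) (trans (cong (+ 2 *_) e) (sym (ℤₚ.pos-* 2 n)))))) (ℕₚ.m≤n+m (2 ℕ.* n) n)
  where
  u = x + + 3 * y
  v = + 2 * x + y
  lem₁ : ∀ x y → + 5 * (x * x) + (x + + 3 * y) * (x + + 3 * y) ≡ + 3 * (+ 2 * x * x + + 2 * x * y + + 3 * y * y)
  lem₁ = solve-∀
  lem₂ : ∀ x y → + 5 * (y * y) + (+ 2 * x + y) * (+ 2 * x + y) ≡ + 2 * (+ 2 * x * x + + 2 * x * y + + 3 * y * y)
  lem₂ = solve-∀

abstract
  -- The enumeration is opaque outside this block. Only the case n = 1 is computed, as the start of
  -- the induction in `count-formula`.
  finiteF : ∀ b n → Finite (Reps (F b) n)
  finiteF b n = finite-Reps (F b) n (3 ℕ.* n) (bounded b n)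

  finiteF-1 : ∀ b → proj₁ (finiteF b 1) ≡ (if b then 0 else 2)
  finiteF-1 false = refl
  finiteF-1 true = refl

r : Bool → ℕ → ℕ
r b n = proj₁ (finiteF b n)

form-∣ : ∀ a b c d .{{_ : ℕ.NonZero d}} ρ α β →
  {_ : True (ℕₚ.allUpTo? (λ i → ℕₚ.allUpTo? (λ j → (valueℕ a b c i j ℕ.% d ℕ.≟ ρ) →-dec
      ((α ℕ.* i ℕ.+ β ℕ.* j) ℕ.% d ℕ.≟ 0)) d) d)} →
  ∀ x y {v} → evalForm (form (+ a) (+ b) (+ c)) x y ≡ + v → v ℕ.% d ≡ ρ → + d ∣ + α * x + + β * y
form-∣ a b c d ρ α β {t} x y {v} eq v≡ρ = ≡⇒∣ (sym x+y≡)
  (∣m∣n⇒∣m+n {m = + (α ℕ.* i ℕ.+ β ℕ.* j)} (∣ᵤ⇒∣ (ℕ∣.m%n≡0⇒n∣m (α ℕ.* i ℕ.+ β ℕ.* j) d check))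
      (divides (+ α * (x /ℕ d) + + β * (y /ℕ d)) refl))
  where
  i = x %ℕ d
  j = y %ℕ d
  check : (α ℕ.* i ℕ.+ β ℕ.* j) ℕ.% d ≡ 0
  check = residue-check d (λ i j → (valueℕ a b c i j ℕ.% d ℕ.≟ ρ) →-dec ((α ℕ.* i ℕ.+ β ℕ.* j) ℕ.% d ℕ.≟ 0)) {t} x y
    (trans (sym (residues a b c d {x} {y} eq)) v≡ρ)
  lem : ∀ α β i j u v d → α * (i + u * d) + β * (j + v * d) ≡ α * i + β * j + (α * u + β * v) * d
  lem = solve-∀
  x+y≡ : + α * x + + β * y ≡ + (α ℕ.* i ℕ.+ β ℕ.* j) + (+ α * (x /ℕ d) + + β * (y /ℕ d)) * + d
  x+y≡ = trans (cong₂ (λ x y → + α * x + + β * y) (ℤ%.a≡a%ℕn+[a/ℕn]*n x d) (ℤ%.a≡a%ℕn+[a/ℕn]*n y d))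
    (trans (lem (+ α) (+ β) (+ i) (+ j) (x /ℕ d) (y /ℕ d) (+ d))
      (cong (_+ (+ α * (x /ℕ d) + + β * (y /ℕ d)) * + d)
        (sym (trans (ℤₚ.pos-+ (α ℕ.* i) (β ℕ.* j)) (cong₂ _+_ (ℤₚ.pos-* α i) (ℤₚ.pos-* β j))))))

-- Representations of pn

d*n%d≡0 : ∀ d n .{{_ : ℕ.NonZero d}} → (d ℕ.* n) ℕ.% d ≡ 0
d*n%d≡0 d n = trans (cong (ℕ._% d) (ℕₚ.*-comm d n)) (ℕ%.m*n%n≡0 n d)

r-↔ : ∀ b n b′ n′ → Reps (F b) n ↔ Reps (F b′) n′ → r b n ≡ r b′ n′
r-↔ b n b′ n′ = finite-≡ (finiteF b n) (finiteF b′ n′)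

-- Even values occur exactly for x + y even (`f₁`) or y even (`f₂`). On this lattice half the form
-- is the form of the other class: the prime ideal above 2 is not principal.
r-2 : ∀ b n → r b (2 ℕ.* n) ≡ r (b xor true) n
r-2 false n = r-↔ false (2 ℕ.* n) true n (sublattice-full-↔ f₁ f₂ 2 n (+ 2) (+ 1) (+ 0) (+ 1) refl
    (λ (x , y) → scale x y)
  (λ (x , y) e → onto x y (form-∣ 1 0 5 2 0 1 1 x y e (d*n%d≡0 2 n))))
  where
  scale : ∀ x y → + 1 * (+ 2 * x + + 1 * y) * (+ 2 * x + + 1 * y) + + 0 * (+ 2 * x + + 1 * y) * (+ 0 * x + + 1 * y)
      + + 5 * (+ 0 * x + + 1 * y) * (+ 0 * x + + 1 * y)
    ≡ + 2 * (+ 2 * x * x + + 2 * x * y + + 3 * y * y)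
  scale = solve-∀
  lem₁ : ∀ q y → + 2 * (q - y) + + 1 * y ≡ q * + 2 - y
  lem₁ = solve-∀
  lem₂ : ∀ x y → + 1 * x + + 1 * y - y ≡ x
  lem₂ = solve-∀
  lem₃ : ∀ x y → + 0 * x + + 1 * y ≡ y
  lem₃ = solve-∀
  onto : ∀ x y → + 2 ∣ + 1 * x + + 1 * y → ∃ λ w → linear (+ 2) (+ 1) (+ 0) (+ 1) w ≡ (x , y)
  onto x y (divides q eq) = (q - y , y) , cong₂ _,_ (trans (lem₁ q y) (trans (cong (_- y) (sym eq)) (lem₂ x y)))
      (lem₃ (q - y) y)
r-2 true n = r-↔ true (2 ℕ.* n) false n (sublattice-full-↔ f₂ f₁ 2 n (+ 1) -1ℤ (+ 0) (+ 2) refl (λ (x , y) → scale x y)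
  (λ (x , y) e → onto x y (form-∣ 2 2 3 2 0 0 1 x y e (d*n%d≡0 2 n))))
  where
  scale : ∀ x y → + 2 * (+ 1 * x + -1ℤ * y) * (+ 1 * x + -1ℤ * y) + + 2 * (+ 1 * x + -1ℤ * y) * (+ 0 * x + + 2 * y)
      + + 3 * (+ 0 * x + + 2 * y) * (+ 0 * x + + 2 * y)
    ≡ + 2 * (+ 1 * x * x + + 0 * x * y + + 5 * y * y)
  scale = solve-∀
  lem₁ : ∀ x q → + 1 * (x + q) + -1ℤ * q ≡ x
  lem₁ = solve-∀
  lem₂ : ∀ x q → + 0 * (x + q) + + 2 * q ≡ q * + 2
  lem₂ = solve-∀
  lem₃ : ∀ x y → + 0 * x + + 1 * y ≡ y
  lem₃ = solve-∀
  onto : ∀ x y → + 2 ∣ + 0 * x + + 1 * y → ∃ λ w → linear (+ 1) -1ℤ (+ 0) (+ 2) w ≡ (x , y)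
  onto x y (divides q eq) = (x + q , q) , cong₂ _,_ (lem₁ x q) (trans (lem₂ x q) (trans (sym eq) (lem₃ x y)))

-- Modulo 5 the forms are x² and 2(x + 3y)², so divisibility by 5 is a single linear congruence. On
-- that lattice a fifth of the form is the same form again, the prime ideal above 5 being generated
-- by √-5.
r-5 : ∀ b n → r b (5 ℕ.* n) ≡ r b n
r-5 false n = r-↔ false (5 ℕ.* n) false n (sublattice-full-↔ f₁ f₁ 5 n (+ 0) (+ 5) (+ 1) (+ 0) refl
    (λ (x , y) → scale x y)
  (λ (x , y) e → onto x y (form-∣ 1 0 5 5 0 1 0 x y e (d*n%d≡0 5 n))))
  where
  scale : ∀ x y → + 1 * (+ 0 * x + + 5 * y) * (+ 0 * x + + 5 * y) + + 0 * (+ 0 * x + + 5 * y) * (+ 1 * x + + 0 * y)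
      + + 5 * (+ 1 * x + + 0 * y) * (+ 1 * x + + 0 * y)
    ≡ + 5 * (+ 1 * x * x + + 0 * x * y + + 5 * y * y)
  scale = solve-∀
  lem₁ : ∀ y q → + 0 * y + + 5 * q ≡ q * + 5
  lem₁ = solve-∀
  lem₂ : ∀ x y → + 1 * x + + 0 * y ≡ x
  lem₂ = solve-∀
  onto : ∀ x y → + 5 ∣ + 1 * x + + 0 * y → ∃ λ w → linear (+ 0) (+ 5) (+ 1) (+ 0) w ≡ (x , y)
  onto x y (divides q eq) = (y , q) , cong₂ _,_ (trans (lem₁ y q) (trans (sym eq) (lem₂ x y))) (lem₂ y q)
r-5 true n = r-↔ true (5 ℕ.* n) true n (sublattice-full-↔ f₂ f₂ 5 n -1ℤ (- + 3) (+ 2) (+ 1) refl (λ (x , y) → scale x y)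
  (λ (x , y) e → onto x y (form-∣ 2 2 3 5 0 1 3 x y e (d*n%d≡0 5 n))))
  where
  scale : ∀ x y → + 2 * (-1ℤ * x + (- + 3) * y) * (-1ℤ * x + (- + 3) * y) + + 2 * (-1ℤ * x + (- + 3) * y) *
      (+ 2 * x + + 1 * y) + + 3 * (+ 2 * x + + 1 * y) * (+ 2 * x + + 1 * y)
    ≡ + 5 * (+ 2 * x * x + + 2 * x * y + + 3 * y * y)
  scale = solve-∀
  lem₁ : ∀ q y → -1ℤ * q + (- + 3) * (y - + 2 * q) ≡ q * + 5 - + 3 * y
  lem₁ = solve-∀
  lem₂ : ∀ q y → + 2 * q + + 1 * (y - + 2 * q) ≡ y
  lem₂ = solve-∀
  lem₃ : ∀ x y → + 1 * x + + 3 * y - + 3 * y ≡ x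
  lem₃ = solve-∀
  onto : ∀ x y → + 5 ∣ + 1 * x + + 3 * y → ∃ λ w → linear -1ℤ (- + 3) (+ 2) (+ 1) w ≡ (x , y)
  onto x y (divides q eq) = (q , y - + 2 * q) , cong₂ _,_
      (trans (lem₁ q y) (trans (cong (_- + 3 * y) (sym eq)) (lem₃ x y))) (lem₂ q y)

scaled-↔ : ∀ a b c p m .{{_ : ℕ.NonZero p}} (S : Point → Set) → (∀ {z} (s t : S z) → s ≡ t) →
  (∀ x y → S (+ p * x + 0ℤ * y , 0ℤ * x + + p * y)) →
  (∀ x y → evalForm (form a b c) x y ≡ + (p ℕ.* (p ℕ.* m)) → S (x , y) → + p ∣ x × + p ∣ y) →
  Σ (Reps (form a b c) (p ℕ.* (p ℕ.* m))) (S ∘ proj₁) ↔ Reps (form a b c) m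
scaled-↔ a b c p m S irr inS both = subst (λ n → Σ (Reps f n) (S ∘ proj₁) ↔ Reps f m) (ℕₚ.*-assoc p p m)
  (sublattice-↔ f f (p ℕ.* p) m {{ℕₚ.m*n≢0 p p}} S irr (+ p) 0ℤ 0ℤ (+ p) {{ℕₚ.m*n≢0 p p}}
      (trans (lem (+ p)) (sym (ℤₚ.pos-* p p)))
    (λ (x , y) → trans (scale a b c (+ p) x y) (cong (_* evalForm f x y) (sym (ℤₚ.pos-* p p))))
    (λ (x , y) → inS x y)
    (λ (x , y) e s → let dx , dy = both x y (trans e (cong +_ (ℕₚ.*-assoc p p m))) s in onto x y dx dy))
  where
  f = form a b c
  lem : ∀ p → p * p - 0ℤ * 0ℤ ≡ p * p
  lem = solve-∀
  scale : ∀ a b c p x y → a * (p * x + 0ℤ * y) * (p * x + 0ℤ * y) + b * (p * x + 0ℤ * y) * (0ℤ * x + p * y) + c *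
      (0ℤ * x + p * y) * (0ℤ * x + p * y)
    ≡ p * p * (a * x * x + b * x * y + c * y * y)
  scale = solve-∀
  lem₁ : ∀ p u v → p * u + 0ℤ * v ≡ u * p
  lem₁ = solve-∀
  lem₂ : ∀ p u v → 0ℤ * u + p * v ≡ v * p
  lem₂ = solve-∀
  onto : ∀ x y → + p ∣ x → + p ∣ y → ∃ λ w → linear (+ p) 0ℤ 0ℤ (+ p) w ≡ (x , y)
  onto x y (divides u eu) (divides v ev) = (u , v) , cong₂ _,_ (trans (lem₁ (+ p) u v) (sym eu))
      (trans (lem₂ (+ p) u v) (sym ev))

value-∣² : ∀ a b c p n x y .{{_ : ℕ.NonZero p}} → evalForm (form a b c) x y ≡ + (p ℕ.* n) → + p ∣ x → + p ∣ y → p ℕ∣.∣ n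
value-∣² a b c p n x y e (divides u refl) (divides v refl) = ∣⇒∣ℕ (*-cancelˡ-∣ (+ p) {+ p} {+ n}
  (divides (evalForm (form a b c) u v) (trans (sym (ℤₚ.pos-* p n)) (trans (sym e) (lem a b c u v (+ p))))))
  where
  lem : ∀ a b c u v p → a * (u * p) * (u * p) + b * (u * p) * (v * p) + c * (v * p) * (v * p) ≡
      (a * u * u + b * u * v + c * v * v) * (p * p)
  lem = solve-∀

-- Primes modulo which -5 is a square

module Split (p : ℕ) (pp : Prime p) (b b′ : Bool) (A : ℕ) (B C e e′ t : ℤ)
  (F≡ : F b ≡ form (+ A) (+ 2 * B) C) (p∤A : ¬ (+ p ∣ + A))
  -- An equality of integers, not merely a congruence: the second root then has the same cofactor
  -- `t`, and the single equivalence `cls` settles both lattices.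
  (sum-roots : + 2 * B ≡ - (+ A * (e + e′))) (root : + A * e * e + + 2 * B * e + C ≡ + p * t)
  (distinct : ¬ (+ p ∣ e - e′))
  (cls : form (+ A * + p) (+ 2 * (+ A * e + B)) t ≅ F b′) where

  private
    P = + p
    f = form (+ A) (+ 2 * B) C
    instance
      p≢0 : ℕ.NonZero p
      p≢0 = prime⇒nonZero pp

    OnLine : ℤ → Point → Set
    OnLine e (x , y) = True (P ∣? (x - e * y))

    -- The lattice x ≡ e y has the basis (p, 0), (e, 1). In these coordinates the form is p times
    -- one whose determinant A p t - (A e + B)² is again A C - B².
    line-↔ : ∀ e n → + A * e * e + + 2 * B * e + C ≡ P * t →
      Σ (Reps f (p ℕ.* n)) (OnLine e ∘ proj₁) ↔ Reps (form (+ A * P) (+ 2 * (+ A * e + B)) t) n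
    line-↔ e n root = sublattice-↔ f (form (+ A * P) (+ 2 * (+ A * e + B)) t) p n (OnLine e) T-irrelevant P e 0ℤ 1ℤ
        (det P e)
      (λ (x , y) → trans (scale (+ A) B C e P t x y) (trans
          (cong (λ z → P * evalForm (form (+ A * P) (+ 2 * (+ A * e + B)) t) x y + z * (y * y))
                     (trans (cong (_- P * t) root) (lem₀ (P * t))))
                         (lem₁ (P * evalForm (form (+ A * P) (+ 2 * (+ A * e + B)) t) x y) (y * y))))
      (λ (x , y) → fromWitness (divides x (lem₂ P e x y)))
      (λ (x , y) _ s → onto x y (toWitness s))
      where
      det : ∀ p e → p * 1ℤ - e * 0ℤ ≡ p
      det = solve-∀
      scale : ∀ a b c e p t x y → a * (p * x + e * y) * (p * x + e * y) + (+ 2 * b) * (p * x + e * y) *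
          (0ℤ * x + 1ℤ * y) + c * (0ℤ * x + 1ℤ * y) * (0ℤ * x + 1ℤ * y)
        ≡ p * (a * p * x * x + (+ 2 * (a * e + b)) * x * y + t * y * y) + (a * e * e + + 2 * b * e + c - p * t) *
            (y * y)
      scale = solve-∀
      lem₀ : ∀ u → u - u ≡ 0ℤ
      lem₀ = solve-∀
      lem₁ : ∀ u v → u + 0ℤ * v ≡ u
      lem₁ = solve-∀
      lem₂ : ∀ p e x y → p * x + e * y - e * (0ℤ * x + 1ℤ * y) ≡ x * p
      lem₂ = solve-∀
      lem₃ : ∀ p e q y → p * q + e * y ≡ q * p + e * y
      lem₃ = solve-∀
      lem₄ : ∀ e x y → x - e * y + e * y ≡ x
      lem₄ = solve-∀
      lem₅ : ∀ x y → 0ℤ * x + 1ℤ * y ≡ y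
      lem₅ = solve-∀
      onto : ∀ x y → P ∣ x - e * y → ∃ λ w → linear P e 0ℤ 1ℤ w ≡ (x , y)
      onto x y (divides q eq) = (q , y) , cong₂ _,_ (trans (lem₃ P e q y)
          (trans (cong (_+ e * y) (sym eq)) (lem₄ e x y))) (lem₅ q y)

    root′ : + A * e′ * e′ + + 2 * B * e′ + C ≡ P * t
    root′ = trans (cong (λ w → + A * e′ * e′ + w * e′ + C) sum-roots) (trans (lem (+ A) C e e′)
      (trans (cong (λ w → + A * e * e + w * e + C) (sym sum-roots)) root))
      where
      lem : ∀ a c e e′ → a * e′ * e′ + - (a * (e + e′)) * e′ + c ≡ a * e * e + - (a * (e + e′)) * e + c
      lem = solve-∀

    -- Modulo p the form factors as A (x - e y)(x - e′ y), and A is prime to p.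
    cover : ∀ x y n → evalForm f x y ≡ + (p ℕ.* n) → OnLine e (x , y) ⊎ OnLine e′ (x , y)
    cover x y n eq = Sum.map fromWitness fromWitness
      (prime-∣* pp (x - e * y) (x - e′ * y)
        ([ ⊥-elim ∘ p∤A , id ]′ (prime-∣* pp (+ A) ((x - e * y) * (x - e′ * y))
          (≡⇒∣ (sym factor) (∣m∣n⇒∣m-n (divides (+ n) (trans (cong +_ (ℕₚ.*-comm p n)) (ℤₚ.pos-* n p)))
              (divides (t * (y * y)) (lem₁ P t (y * y))))))))
      where
      lem₁ : ∀ p t z → p * t * z ≡ t * z * p
      lem₁ = solve-∀
      lem : ∀ a c e e′ x y → a * ((x - e * y) * (x - e′ * y)) ≡ a * x * x + - (a * (e + e′)) * x * y + c * y * y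
          - (a * e * e + - (a * (e + e′)) * e + c) * (y * y)
      lem = solve-∀
      factor : + A * ((x - e * y) * (x - e′ * y)) ≡ + (p ℕ.* n) - P * t * (y * y)
      factor = trans (lem (+ A) C e e′ x y) (trans (cong
          (λ w → + A * x * x + w * x * y + C * y * y - (+ A * e * e + w * e + C) * (y * y)) (sym sum-roots))
        (cong₂ (λ u v → u - v * (y * y)) eq root))

    both-∣ : ∀ x y → OnLine e (x , y) × OnLine e′ (x , y) → P ∣ x × P ∣ y
    both-∣ x y (s , s′) = P∣x , P∣y
      where
      lem : ∀ e e′ x y → x - e′ * y - (x - e * y) ≡ (e - e′) * y
      lem = solve-∀
      lem₁ : ∀ e x y → x - e * y + e * y ≡ x
      lem₁ = solve-∀
      P∣y : P ∣ y
      P∣y = [ ⊥-elim ∘ distinct , id ]′ (prime-∣* pp (e - e′) y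
          (≡⇒∣ (lem e e′ x y) (∣m∣n⇒∣m-n (toWitness s′) (toWitness s))))
      P∣x : P ∣ x
      P∣x = ≡⇒∣ (lem₁ e x y) (∣m∣n⇒∣m+n (toWitness s) (∣n⇒∣m*n e P∣y))

    -- By `sum-roots` the middle coefficients for `e` and `e′` are opposite, so the two lattices
    -- carry forms that differ by the sign of y.
    cls′ : form (+ A * P) (+ 2 * (+ A * e′ + B)) t ≅ F b′
    cls′ = ≅-trans (subst (λ z → form (+ A * P) (+ 2 * (+ A * e′ + B)) t ≅ form (+ A * P) (+ 2 * z) t) neg
        (form-flip (+ A * P) (+ A * e′ + B) t)) cls
      where
      lem : ∀ a b e e′ → - (a * e′ + b) ≡ (a * e + b) - (+ 2 * b - - (a * (e + e′)))
      lem = solve-∀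
      lem₁ : ∀ u v → u - (v - v) ≡ u
      lem₁ = solve-∀
      neg : - (+ A * e′ + B) ≡ + A * e + B
      neg = trans (lem (+ A) B e e′) (trans (cong (λ w → + A * e + B - (+ 2 * B - w)) (sym sum-roots))
          (lem₁ (+ A * e + B) (+ 2 * B)))

    Both : Point → Set
    Both z = OnLine e z × OnLine e′ z

    Both-irrelevant : ∀ {z} (s t : Both z) → s ≡ t
    Both-irrelevant (s , s′) (t , t′) = cong₂ _,_ (T-irrelevant s t) (T-irrelevant s′ t′)

    finite-f : ∀ n → Finite (Reps f n)
    finite-f n = subst (λ g → Finite (Reps g n)) F≡ (finiteF b n)

    count-f : ∀ n → proj₁ (finite-f n) ≡ r b n
    count-f n = lem F≡
      where
      lem : ∀ {g} (eq : F b ≡ g) → proj₁ (subst (λ g → Finite (Reps g n)) eq (finiteF b n)) ≡ r b n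
      lem refl = refl

    -- The number of vectors common to both lines is left as `D`: it is 0 if p ∤ n, and the count
    -- for n / p otherwise.
    count : ∀ n (D : Finite (Σ (Reps f (p ℕ.* n)) (Both ∘ proj₁))) → r b (p ℕ.* n) ℕ.+ proj₁ D ≡ r b′ n ℕ.+ r b′ n
    count n D = trans (cong (ℕ._+ proj₁ D) (sym (count-f (p ℕ.* n))))
      (finite-≡ (finite-⊎ (finite-f (p ℕ.* n)) D) (finite-⊎ (finiteF b′ n) (finiteF b′ n))
        (↔-trans (cover-↔ (OnLine e ∘ proj₁) (OnLine e′ ∘ proj₁) (λ _ → T? _) T-irrelevant T-irrelevant
            (λ (z , eq) → cover (proj₁ z) (proj₂ z) n eq))
          (↔-trans (line-↔ e n root) (≅⇒↔ cls n) ⊎-↔ ↔-trans (line-↔ e′ n root′) (≅⇒↔ cls′ n))))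

  r-coprime : ∀ n → ¬ (p ℕ∣.∣ n) → r b (p ℕ.* n) ≡ r b′ n ℕ.+ r b′ n
  r-coprime n p∤n = trans (sym (ℕₚ.+-identityʳ _)) (count n (finite-⊥ empty))
    where
    empty : ¬ Σ (Reps f (p ℕ.* n)) (Both ∘ proj₁)
    empty (((x , y) , eq) , s) = let dx , dy = both-∣ x y s in p∤n (value-∣² (+ A) (+ 2 * B) C p n x y eq dx dy)

  r-multiple : ∀ m → r b (p ℕ.* (p ℕ.* m)) ℕ.+ r b m ≡ r b′ (p ℕ.* m) ℕ.+ r b′ (p ℕ.* m)
  r-multiple m = trans (cong (r b (p ℕ.* (p ℕ.* m)) ℕ.+_) (sym (count-f m)))
    (count (p ℕ.* m) (proj₁ (finite-f m) , ↔-trans (proj₂ (finite-f m)) (↔-sym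
      (scaled-↔ (+ A) (+ 2 * B) C p m Both (λ {z} → Both-irrelevant {z})
        (λ x y → fromWitness (divides (x - e * y) (lem P e x y)) , fromWitness (divides (x - e′ * y) (lem P e′ x y)))
        (λ x y _ s → both-∣ x y s)))))
    where
    lem : ∀ p e x y → p * x + 0ℤ * y - e * (0ℤ * x + p * y) ≡ (x - e * y) * p
    lem = solve-∀

splitResidues : Bool → List ℕ
splitResidues false = 1 ∷ 9 ∷ []
splitResidues true = 3 ∷ 7 ∷ []

inertResidues : List ℕ
inertResidues = 11 ∷ 13 ∷ 17 ∷ 19 ∷ []

values : Bool → List ℕ
values false = values₁
values true = values₂

leading : Bool → ℕ
leading false = 1
leading true = 2

F-values : ∀ b z {v} → value (F b) z ≡ + v → v ℕ.% 20 ∈ values b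
F-values false = f₁-values
F-values true = f₂-values

≅-leading : ∀ a {b c g} → form (+ a) b c ≅ g → ∃ λ z → value g z ≡ + a
≅-leading a {b} {c} e = to (1ℤ , 0ℤ) , trans (value-to (1ℤ , 0ℤ)) (lem (+ a) b c)
  where
  open _≅_ e
  lem : ∀ a b c → a * 1ℤ * 1ℤ + b * 1ℤ * 0ℤ + c * 0ℤ * 0ℤ ≡ a
  lem = solve-∀

-- The products occurring modulo 20 are 1, 9, 6, 14, which only `f₁` represents, and 3, 7, 2, 18,
-- which only `f₂` represents.
split-class : ∀ b κ c ρ → ρ ℕ.< 20 → ρ ∈ splitResidues κ → (leading b ℕ.* ρ) ℕ.% 20 ∈ values c → c ≡ b xor κ
split-class b κ c ρ ρ<20 = check b κ c ρ<20
  where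
  Check : Bool → Bool → Bool → Set
  Check b κ c = ∀ {ρ} → ρ ℕ.< 20 → ρ ∈ splitResidues κ → (leading b ℕ.* ρ) ℕ.% 20 ∈ values c → c ≡ b xor κ
  check? : ∀ b κ c → Dec (Check b κ c)
  check? b κ c = ℕₚ.allUpTo? (λ ρ → (ρ ∈? splitResidues κ) →-dec
      (((leading b ℕ.* ρ) ℕ.% 20 ∈? values c) →-dec (c Bool.≟ (b xor κ)))) 20
  check : ∀ b κ c → Check b κ c
  check false false false = from-yes (check? false false false)
  check false false true = from-yes (check? false false true)
  check false true false = from-yes (check? false true false)
  check false true true = from-yes (check? false true true)
  check true false false = from-yes (check? true false false)
  check true false true = from-yes (check? true false true)
  check true true false = from-yes (check? true true false)
  check true true true = from-yes (check? true true true)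

splitResidues⊆ : ∀ κ {ρ} → ρ ∈ splitResidues κ → ρ ∈ (1 ∷ 3 ∷ 7 ∷ 9 ∷ [])
splitResidues⊆ false (here refl) = here refl
splitResidues⊆ false (there (here refl)) = there (there (there (here refl)))
splitResidues⊆ true (here refl) = there (here refl)
splitResidues⊆ true (there (here refl)) = there (there (here refl))

∤-prime : ∀ {p q} → Prime p → Prime q → ¬ (q ℕ.% 20 ≡ p ℕ.% 20) → ¬ (+ p ∣ + q)
∤-prime pp qq ne d = ne (cong (ℕ._% 20) (sym (prime-∣⇒≡ pp qq (∣⇒∣ℕ d))))

module SplitPrime (p : ℕ) (pp : Prime p) (κ : Bool) (p%20∈ : p ℕ.% 20 ∈ splitResidues κ) where

  private
    P = + p

    p∤2 : ¬ (P ∣ + 2)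
    p∤2 = ∤-prime pp prime[2] (λ eq → from-no (2 ∈? (1 ∷ 3 ∷ 7 ∷ 9 ∷ []))
        (splitResidues⊆ κ (subst (_∈ splitResidues κ) (sym eq) p%20∈)))

    p∤5 : ¬ (P ∣ + 5)
    p∤5 = ∤-prime pp prime[5] (λ eq → from-no (5 ∈? (1 ∷ 3 ∷ 7 ∷ 9 ∷ []))
        (splitResidues⊆ κ (subst (_∈ splitResidues κ) (sym eq) p%20∈)))

    -- Reduction leaves two classes. The form represents its own leading coefficient, and the
    -- residue of that number modulo 20 rules out one of them.
    classify : ∀ b {B t} → + leading b * P * t ≡ B * B + + 5 → form (+ leading b * P) (+ 2 * B) t ≅ F (b xor κ)
    classify b {B} {t} det = subst (λ a → form a (+ 2 * B) t ≅ F (b xor κ)) (ℤₚ.pos-* (leading b) p)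
      (decide (reduction (leading b ℕ.* p) B t (trans (cong (_* t) (ℤₚ.pos-* (leading b) p)) det)))
      where
      is : ∀ c → form (+ (leading b ℕ.* p)) (+ 2 * B) t ≅ F c → form (+ (leading b ℕ.* p)) (+ 2 * B) t ≅ F (b xor κ)
      is c e = subst (λ c → form (+ (leading b ℕ.* p)) (+ 2 * B) t ≅ F c)
        (split-class b κ c (p ℕ.% 20) (ℕ%.m%n<n p 20) p%20∈
          (subst (_∈ values c) (trans (ℕ%.%-distribˡ-* (leading b) p 20)
              (cong (λ l → (l ℕ.* (p ℕ.% 20)) ℕ.% 20) (small b)))
            (F-values c (proj₁ (≅-leading (leading b ℕ.* p) e)) (proj₂ (≅-leading (leading b ℕ.* p) e))))) e
        where
        small : ∀ b → leading b ℕ.% 20 ≡ leading b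
        small false = refl
        small true = refl
      decide : form (+ (leading b ℕ.* p)) (+ 2 * B) t ≅ f₁ ⊎ form (+ (leading b ℕ.* p)) (+ 2 * B) t ≅ f₂ → form
          (+ (leading b ℕ.* p)) (+ 2 * B) t ≅ F (b xor κ)
      decide (inj₁ e) = is false e
      decide (inj₂ e) = is true e

    sqrt = ∃sqrt-minus5 p pp (splitResidues⊆ κ p%20∈)
    c₀ = + proj₁ sqrt

    -- Twice 2e² + 2e + 3 is (2e + 1)² + 5, so `f₂` requires an odd square root of -5. As p is odd,
    -- adding p to an even root changes its parity.
    odd-root : (∃ λ e → P ∣ (+ 2 * e + 1ℤ) * (+ 2 * e + 1ℤ) + + 5)
    odd-root = go (proj₁ sqrt ℕ.% 2) (ℕ%.m%n<n (proj₁ sqrt) 2) (p ℕ.% 2) (ℕ%.m%n<n p 2) (c≡ (proj₁ sqrt)) (c≡ p)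
      where
      c≡ : ∀ c → + c ≡ + (c ℕ.% 2) + + 2 * + (c ℕ./ 2)
      c≡ c = trans (cong +_ (trans (ℕ%.m≡m%n+[m/n]*n c 2) (cong (c ℕ.% 2 ℕ.+_) (ℕₚ.*-comm (c ℕ./ 2) 2))))
        (trans (ℤₚ.pos-+ (c ℕ.% 2) (2 ℕ.* (c ℕ./ 2))) (cong (λ z → + (c ℕ.% 2) + z) (ℤₚ.pos-* 2 (c ℕ./ 2))))
      lem₀ : ∀ k → + 0 + + 2 * k ≡ k * + 2
      lem₀ = solve-∀
      lem₁ : ∀ k → + 1 + + 2 * k ≡ + 2 * k + 1ℤ
      lem₁ = solve-∀
      lem₂ : ∀ c p → c * c + + 5 + (+ 2 * c + p) * p ≡ (c + p) * (c + p) + + 5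
      lem₂ = solve-∀
      lem₃ : ∀ k l → (+ 0 + + 2 * k) + (+ 1 + + 2 * l) ≡ + 2 * (k + l) + 1ℤ
      lem₃ = solve-∀
      shifted : P ∣ (c₀ + P) * (c₀ + P) + + 5
      shifted = ≡⇒∣ (lem₂ c₀ P) (∣m∣n⇒∣m+n (proj₂ sqrt) (∣n⇒∣m*n (+ 2 * c₀ + P) (∣-refl {P})))
      go : ∀ i → i ℕ.< 2 → ∀ j → j ℕ.< 2 → c₀ ≡ + i + + 2 * + (proj₁ sqrt ℕ./ 2) → P ≡ + j + + 2 * + (p ℕ./ 2) →
        ∃ λ e → P ∣ (+ 2 * e + 1ℤ) * (+ 2 * e + 1ℤ) + + 5
      go 1 _ _ _ eq _ = + (proj₁ sqrt ℕ./ 2) , ≡⇒∣ (cong (λ c → c * c + + 5)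
          (trans eq (lem₁ (+ (proj₁ sqrt ℕ./ 2))))) (proj₂ sqrt)
      go 0 _ 0 _ _ eq = ⊥-elim (p∤2 (subst (λ q → + q ∣ + 2)
          (prime-∣⇒≡ prime[2] pp (∣⇒∣ℕ (divides (+ (p ℕ./ 2)) (trans eq (lem₀ (+ (p ℕ./ 2))))))) ∣-refl))
      go 0 _ 1 _ eq eq′ = + (proj₁ sqrt ℕ./ 2) + + (p ℕ./ 2) ,
        ≡⇒∣ (cong (λ c → c * c + + 5) (trans (cong₂ _+_ eq eq′) (lem₃ (+ (proj₁ sqrt ℕ./ 2)) (+ (p ℕ./ 2))))) shifted
      go (suc (suc _)) (s≤s (s≤s ())) _ _ _ _
      go _ _ (suc (suc _)) (s≤s (s≤s ())) _ _

    e₂ = proj₁ odd-root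

    root₂ : P ∣ + 2 * e₂ * e₂ + + 2 * e₂ + + 3
    root₂ = [ ⊥-elim ∘ p∤2 , id ]′ (prime-∣* pp (+ 2) (+ 2 * e₂ * e₂ + + 2 * e₂ + + 3) (≡⇒∣ (lem e₂) (proj₂ odd-root)))
      where
      lem : ∀ e → (+ 2 * e + 1ℤ) * (+ 2 * e + 1ℤ) + + 5 ≡ + 2 * (+ 2 * e * e + + 2 * e + + 3)
      lem = solve-∀

    t₁ = _∣_.quotient (proj₂ sqrt)
    t₂ = _∣_.quotient root₂

    module S₁ where
      trace : ∀ c → + 0 ≡ - (+ 1 * (c + - c))
      trace = solve-∀
      r₁ : ∀ c → + 1 * c * c + + 0 * c + + 5 ≡ c * c + + 5
      r₁ = solve-∀
      d₁ : ∀ p t → + 1 * p * t ≡ t * p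
      d₁ = solve-∀
      d₂ : ∀ c → c * c + + 5 ≡ (+ 1 * c + + 0) * (+ 1 * c + + 0) + + 5
      d₂ = solve-∀
      lem : ∀ c → c - - c ≡ + 2 * c
      lem = solve-∀
      distinct : ¬ (P ∣ c₀ - - c₀)
      distinct d = [ p∤2 , (λ d′ → p∤5 (∣m+n∣m⇒∣n {m = c₀ * c₀} (proj₂ sqrt) (∣m⇒∣m*n c₀ d′))) ]′
          (prime-∣* pp (+ 2) c₀ (≡⇒∣ (lem c₀) d))
      open Split p pp false κ 1 (+ 0) (+ 5) c₀ (- c₀) t₁ refl (prime-∤1 pp) (trace c₀)
        (trans (r₁ c₀) (trans (_∣_.equality (proj₂ sqrt)) (ℤₚ.*-comm t₁ P))) distinct
        (classify false (trans (d₁ P t₁) (trans (sym (_∣_.equality (proj₂ sqrt))) (d₂ c₀)))) public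

    module S₂ where
      trace : ∀ e → + 2 ≡ - (+ 2 * (e + (- e - 1ℤ)))
      trace = solve-∀
      d₁ : ∀ p t → + 2 * p * t ≡ + 2 * (t * p)
      d₁ = solve-∀
      d₂ : ∀ e → + 2 * (+ 2 * e * e + + 2 * e + + 3) ≡ (+ 2 * e + + 1) * (+ 2 * e + + 1) + + 5
      d₂ = solve-∀
      lem : ∀ e → e - (- e - 1ℤ) ≡ + 2 * e + 1ℤ
      lem = solve-∀
      distinct : ¬ (P ∣ e₂ - (- e₂ - 1ℤ))
      distinct d = p∤5 (∣m+n∣m⇒∣n {m = (+ 2 * e₂ + 1ℤ) * (+ 2 * e₂ + 1ℤ)} (proj₂ odd-root)
          (∣m⇒∣m*n (+ 2 * e₂ + 1ℤ) (≡⇒∣ (lem e₂) d)))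
      -- The second root is `- e₂ - 1ℤ` because the roots of 2x² + 2x + 3 add up to -1.
      open Split p pp true (true xor κ) 2 (+ 1) (+ 3) e₂ (- e₂ - 1ℤ) t₂ refl p∤2 (trace e₂)
        (trans (_∣_.equality root₂) (ℤₚ.*-comm t₂ P)) distinct
        (classify true (trans (d₁ P t₂) (trans (cong (+ 2 *_) (sym (_∣_.equality root₂))) (d₂ e₂)))) public

  r-split-coprime : ∀ b n → ¬ (p ℕ∣.∣ n) → r b (p ℕ.* n) ≡ r (b xor κ) n ℕ.+ r (b xor κ) n
  r-split-coprime false = S₁.r-coprime
  r-split-coprime true = S₂.r-coprime

  r-split-multiple : ∀ b m → r b (p ℕ.* (p ℕ.* m)) ℕ.+ r b m ≡ r (b xor κ) (p ℕ.* m) ℕ.+ r (b xor κ) (p ℕ.* m)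
  r-split-multiple false = S₁.r-multiple
  r-split-multiple true = S₂.r-multiple

-- Primes modulo which -5 is not a square

prime-inverse : ∀ {p} → Prime p → ∀ y → ¬ (+ p ∣ y) → ∃ λ u → + p ∣ u * y - 1ℤ
prime-inverse {p} pp y p∤y = signed y (natural (abs y) (λ d → p∤y (∣ᵤ⇒∣ d)))
  where
  natural : ∀ n → ¬ (p ℕ∣.∣ n) → ∃ λ u → + p ∣ u * + n - 1ℤ
  natural n p∤n = bezout (coprime-Bézout coprime)
    where
    coprime : Coprime p n
    coprime (d∣p , d∣n) with prime⇒irreducible pp d∣p
    ... | inj₁ eq = eq
    ... | inj₂ refl = ⊥-elim (p∤n d∣n)
    lem₁ : ∀ z n → - z * n - 1ℤ ≡ - (1ℤ + z * n)
    lem₁ = solve-∀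
    lem₂ : ∀ w p → - (w * p) ≡ - w * p
    lem₂ = solve-∀
    lem₃ : ∀ w → 1ℤ + w - 1ℤ ≡ w
    lem₃ = solve-∀
    lift : ∀ {x z m} → 1 ℕ.+ z ℕ.* n ≡ x ℕ.* m → 1ℤ + + z * + n ≡ + x * + m
    lift {x} {z} {m} eq = trans (cong (λ z → 1ℤ + z) (sym (ℤₚ.pos-* z n)))
        (trans (sym (ℤₚ.pos-+ 1 (z ℕ.* n))) (trans (cong +_ eq) (ℤₚ.pos-* x m)))
    bezout : Bézout.Identity 1 p n → ∃ λ u → + p ∣ u * + n - 1ℤ
    bezout (Bézout.+- x z eq) = - + z , divides (- + x) (trans (lem₁ (+ z) (+ n))
        (trans (cong -_ (lift {x} {z} {p} eq)) (lem₂ (+ x) (+ p))))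
    bezout (Bézout.-+ x z eq) = + z , divides (+ x) (trans
        (cong (_- 1ℤ) (trans (sym (ℤₚ.pos-* z n)) (trans (cong +_ (sym eq))
        (trans (ℤₚ.pos-+ 1 (x ℕ.* p)) (cong (λ z → 1ℤ + z) (ℤₚ.pos-* x p)))))) (lem₃ (+ x * + p)))
  signed : ∀ y → (∃ λ u → + p ∣ u * + abs y - 1ℤ) → ∃ λ u → + p ∣ u * y - 1ℤ
  signed (+ n) w = w
  signed -[1+ n ] (u , d) = - u , ≡⇒∣ (lem u (+ suc n)) d
    where
    lem : ∀ u n → u * n - 1ℤ ≡ - u * - n - 1ℤ
    lem = solve-∀

module InertPrime (p : ℕ) (pp : Prime p) (p%20∈ : p ℕ.% 20 ∈ inertResidues) where

  private
    P = + p
    instance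
      p≢0 : ℕ.NonZero p
      p≢0 = prime⇒nonZero pp

    p∤2 : ¬ (P ∣ + 2)
    p∤2 = ∤-prime pp prime[2] (λ eq → from-no (2 ∈? inertResidues) (subst (_∈ inertResidues) (sym eq) p%20∈))

    inert-class : ∀ c {ρ} → ρ ℕ.< 20 → ρ ∈ inertResidues → ρ ∈ values c → ⊥
    inert-class false = from-yes (ℕₚ.allUpTo? (λ ρ → (ρ ∈? inertResidues) →-dec ¬? (ρ ∈? values false)) 20)
    inert-class true = from-yes (ℕₚ.allUpTo? (λ ρ → (ρ ∈? inertResidues) →-dec ¬? (ρ ∈? values true)) 20)

  -- Otherwise p would be the leading coefficient of a form of determinant 5.
  minus5-nonresidue : ∀ c → ¬ (P ∣ c * c + + 5)
  minus5-nonresidue c (divides t eq) = [ excluded false , excluded true ]′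
      (reduction p c t (trans (ℤₚ.*-comm P t) (sym eq)))
    where
    excluded : ∀ b → form P (+ 2 * c) t ≅ F b → ⊥
    excluded b e = inert-class b (ℕ%.m%n<n p 20) p%20∈ (F-values b (proj₁ (≅-leading p e)) (proj₂ (≅-leading p e)))

  -- If y were invertible modulo p, then u / y would be a square root of -5.
  anisotropic : ∀ u y → P ∣ u * u + + 5 * (y * y) → P ∣ u × P ∣ y
  anisotropic u y d = decide (P ∣? y)
    where
    decide : Dec (P ∣ y) → P ∣ u × P ∣ y
    decide (yes dy) = [ id , id ]′ (prime-∣* pp u u (∣m+n∣n⇒∣m {m = u * u} d (∣n⇒∣m*n (+ 5) (∣m⇒∣m*n y dy)))) , dy
    decide (no p∤y) = ⊥-elim (minus5-nonresidue (u * w) (≡⇒∣ (lem u y w)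
      (∣m∣n⇒∣m-n (∣n⇒∣m*n (w * w) d) (∣n⇒∣m*n (+ 5 * (w * y + 1ℤ)) (proj₂ inverse)))))
      where
      inverse = prime-inverse pp y p∤y
      w = proj₁ inverse
      lem : ∀ u y w → w * w * (u * u + + 5 * (y * y)) - + 5 * (w * y + 1ℤ) * (w * y - 1ℤ) ≡ u * w * (u * w) + + 5
      lem = solve-∀

  -- For `f₂` the doubled form (2x + y)² + 5y² is anisotropic, and the factor 2 is then removed from
  -- 2x.
  both-∣ : ∀ b x y n → evalForm (F b) x y ≡ + (p ℕ.* n) → P ∣ x × P ∣ y
  both-∣ false x y n eq = anisotropic x y (≡⇒∣ (trans (sym eq) (lem x y))
      (divides (+ n) (trans (cong +_ (ℕₚ.*-comm p n)) (ℤₚ.pos-* n p))))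
    where
    lem : ∀ x y → + 1 * x * x + + 0 * x * y + + 5 * y * y ≡ x * x + + 5 * (y * y)
    lem = solve-∀
  both-∣ true x y n eq = [ ⊥-elim ∘ p∤2 , id ]′ (prime-∣* pp (+ 2) x
      (≡⇒∣ (lem₁ x y) (∣m∣n⇒∣m-n (proj₁ both) (proj₂ both)))) , proj₂ both
    where
    lem : ∀ x y → + 2 * (+ 2 * x * x + + 2 * x * y + + 3 * y * y) ≡ (+ 2 * x + y) * (+ 2 * x + y) + + 5 * (y * y)
    lem = solve-∀
    lem₁ : ∀ x y → + 2 * x + y - y ≡ + 2 * x
    lem₁ = solve-∀
    both : P ∣ + 2 * x + y × P ∣ y
    both = anisotropic (+ 2 * x + y) y (≡⇒∣ (trans (cong (+ 2 *_) (sym eq)) (lem x y))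
        (∣n⇒∣m*n (+ 2) (divides (+ n) (trans (cong +_ (ℕₚ.*-comm p n)) (ℤₚ.pos-* n p)))))

  r-inert-coprime : ∀ b n → ¬ (p ℕ∣.∣ n) → r b (p ℕ.* n) ≡ 0
  r-inert-coprime b n p∤n = finite-≡ (finiteF b (p ℕ.* n)) (finite-⊥ (λ ()))
      (mk↔ₛ′ empty (λ ()) (λ ()) (λ u → ⊥-elim (empty u)))
    where
    empty : Reps (F b) (p ℕ.* n) → ⊥
    empty ((x , y) , eq) = let dx , dy = both-∣ b x y n eq in p∤n (value-∣² (BQF.fa (F b)) (BQF.fb (F b)) (BQF.fc (F b)) p n x y eq dx dy)

  r-inert-multiple : ∀ b m → r b (p ℕ.* (p ℕ.* m)) ≡ r b m
  r-inert-multiple b m = r-↔ b (p ℕ.* (p ℕ.* m)) b m (↔-trans (mk↔ₛ′ (_, tt) proj₁ (λ _ → refl) (λ _ → refl))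
    (scaled-↔ (BQF.fa (F b)) (BQF.fb (F b)) (BQF.fc (F b)) p m (λ _ → ⊤) (λ _ _ → refl) (λ _ _ → tt)
        (λ x y eq _ → both-∣ b x y (p ℕ.* m) eq)))

-- Valuations and products over primes

-- Ensures that the search in `val p n`, which starts at exponent n, begins high enough.
n<p^n : ∀ p n → 1 ℕ.< p → n ℕ.< p ℕ.^ n
n<p^n p zero _ = s≤s z≤n
n<p^n p (suc n) 1<p = ℕₚ.<-≤-trans (ℕₚ.m<m+n (suc n) {suc n} (s≤s z≤n))
  (ℕₚ.≤-trans (ℕₚ.≤-reflexive (sym (lem (suc n)))) (ℕₚ.*-mono-≤ 1<p (n<p^n p n 1<p)))
  where
  lem : ∀ n → 2 ℕ.* n ≡ n ℕ.+ n
  lem = ℕ-solve-∀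

prime>1 : ∀ {p} → Prime p → 1 ℕ.< p
prime>1 pp = ℕ.nonTrivial⇒n>1 _ {{prime⇒nonTrivial pp}}

prime-∣^ : ∀ {p q} → Prime p → Prime q → ∀ v → p ℕ∣.∣ q ℕ.^ v → p ≡ q
prime-∣^ pp qq zero d = ⊥-elim (¬prime[1] (subst Prime (ℕ∣.∣1⇒≡1 d) pp))
prime-∣^ {p} {q} pp qq (suc v) d with euclidsLemma q (q ℕ.^ v) pp d
... | inj₁ e = prime-∣⇒≡ pp qq e
... | inj₂ e = prime-∣^ pp qq v e

^-∤ : ∀ {p} → Prime p → ∀ v k m → v ℕ.≤ k → ¬ (p ℕ∣.∣ m) → ¬ (p ℕ.^ suc k ℕ∣.∣ p ℕ.^ v ℕ.* m)
^-∤ {p} pp zero k m _ p∤m d = p∤m (subst (p ℕ∣.∣_) (ℕₚ.+-identityʳ m) (ℕ∣.∣-trans (ℕ∣.m∣m*n (p ℕ.^ k)) d))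
^-∤ {p} pp (suc v) (suc k) m (s≤s v≤k) p∤m d = ^-∤ pp v k m v≤k p∤m
  (ℕ∣.*-cancelˡ-∣ p {{prime⇒nonZero pp}} (subst (p ℕ.^ suc (suc k) ℕ∣.∣_) (ℕₚ.*-assoc p (p ℕ.^ v) m) d))

valAux-unique : ∀ {p} → Prime p → ∀ v m k → ¬ (p ℕ∣.∣ m) → v ℕ.≤ k → valAux p (p ℕ.^ v ℕ.* m) k ≡ v
valAux-unique pp zero m zero _ _ = refl
valAux-unique {p} pp v m (suc k) p∤m v≤ with (p ℕ.^ suc k) ℕ∣.∣? (p ℕ.^ v ℕ.* m) | v ℕ.≟ suc k
... | yes _ | yes eq = sym eq
... | yes d | no ne = ⊥-elim (^-∤ pp v k m (ℕ.s≤s⁻¹ (ℕₚ.≤∧≢⇒< v≤ ne)) p∤m d)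
... | no nd | yes refl = ⊥-elim (nd (ℕ∣.m∣m*n m))
... | no _ | no ne = valAux-unique pp v m k p∤m (ℕ.s≤s⁻¹ (ℕₚ.≤∧≢⇒< v≤ ne))

val-unique : ∀ {p} → Prime p → ∀ v m → m ≢ 0 → ¬ (p ℕ∣.∣ m) → val p (p ℕ.^ v ℕ.* m) ≡ v
val-unique {p} pp v m m≢0 p∤m = valAux-unique pp v m (p ℕ.^ v ℕ.* m) p∤m
  (ℕₚ.≤-trans (ℕₚ.<⇒≤ (n<p^n p v (prime>1 pp))) (ℕₚ.m≤m*n (p ℕ.^ v) m {{ℕ.≢-nonZero m≢0}}))

decompose : ∀ {p} → Prime p → ∀ fuel n → n ℕ.≤ fuel → n ≢ 0 → ∃₂ λ v m → n ≡ p ℕ.^ v ℕ.* m × m ≢ 0 × ¬ (p ℕ∣.∣ m)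
decompose pp zero zero _ n≢0 = ⊥-elim (n≢0 refl)
decompose {p} pp (suc fuel) n n≤ n≢0 with p ℕ∣.∣? n
... | no nd = 0 , n , sym (ℕₚ.+-identityʳ n) , n≢0 , nd
... | yes (ℕ∣.divides q eq) = suc v , m , trans eq (trans (cong (ℕ._* p) q≡) (lem p (p ℕ.^ v) m)) , m≢0 , p∤m
  where
  lem : ∀ p u m → u ℕ.* m ℕ.* p ≡ p ℕ.* u ℕ.* m
  lem = ℕ-solve-∀
  q≢0 : q ≢ 0
  q≢0 refl = n≢0 eq
  q<n : q ℕ.< n
  q<n = subst (q ℕ.<_) (sym eq) (ℕₚ.m<m*n q p {{ℕ.≢-nonZero q≢0}} (prime>1 pp))
  rec = decompose pp fuel q (ℕ.s≤s⁻¹ (ℕₚ.<-≤-trans q<n n≤)) q≢0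
  v = proj₁ rec
  m = proj₁ (proj₂ rec)
  q≡ = proj₁ (proj₂ (proj₂ rec))
  m≢0 = proj₁ (proj₂ (proj₂ (proj₂ rec)))
  p∤m = proj₂ (proj₂ (proj₂ (proj₂ rec)))

^≢0 : ∀ {p} → Prime p → ∀ v → p ℕ.^ v ≢ 0
^≢0 {p} pp v = ℕ.≢-nonZero⁻¹ (p ℕ.^ v) {{ℕₚ.m^n≢0 p v {{prime⇒nonZero pp}}}}

*≢0 : ∀ {m n} → m ≢ 0 → n ≢ 0 → m ℕ.* n ≢ 0
*≢0 {m} {n} m≢0 n≢0 eq = [ m≢0 , n≢0 ]′ (ℕₚ.m*n≡0⇒m≡0∨n≡0 m eq)

val-decompose : ∀ {p} → Prime p → ∀ n → n ≢ 0 → ∃ λ m → n ≡ p ℕ.^ val p n ℕ.* m × m ≢ 0 × ¬ (p ℕ∣.∣ m)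
val-decompose {p} pp n n≢0 = let v , m , eq , m≢0 , p∤m = decompose pp n n ℕₚ.≤-refl n≢0 in
  m , trans eq (cong (λ w → p ℕ.^ w ℕ.* m) (sym (trans (cong (val p) eq) (val-unique pp v m m≢0 p∤m)))) , m≢0 , p∤m

val-other : ∀ {p q} → Prime p → Prime q → q ≢ p → ∀ v m → m ≢ 0 → val q (p ℕ.^ v ℕ.* m) ≡ val q m
val-other {p} {q} pp qq q≢p v m m≢0 = let m′ , eq , m′≢0 , q∤m′ = val-decompose qq m m≢0 in
  trans (cong (val q) (trans (cong (p ℕ.^ v ℕ.*_) eq) (lem (p ℕ.^ v) (q ℕ.^ val q m) m′)))
    (val-unique qq (val q m) (p ℕ.^ v ℕ.* m′) (*≢0 (^≢0 pp v) m′≢0)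
      (λ d → [ q≢p ∘ prime-∣^ qq pp v , q∤m′ ]′ (euclidsLemma (p ℕ.^ v) m′ qq d)))
  where
  lem : ∀ a b c → a ℕ.* (b ℕ.* c) ≡ b ℕ.* (a ℕ.* c)
  lem = ℕ-solve-∀

val-∤ : ∀ {p} → Prime p → ∀ m → m ≢ 0 → ¬ (p ℕ∣.∣ m) → val p m ≡ 0
val-∤ {p} pp m m≢0 p∤m = trans (cong (val p) (sym (ℕₚ.+-identityʳ m))) (val-unique pp 0 m m≢0 p∤m)

Supported : List ℕ → ℕ → Set
Supported ps n = ∀ q → Prime q → q ℕ∣.∣ n → q ∈ ps

primeless⇒1 : ∀ n → n ≢ 0 → Supported [] n → n ≡ 1
primeless⇒1 n n≢0 sup = go factors factorsPrime isFactorisation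
  where
  open PrimeFactorisation (factorise n {{ℕ.≢-nonZero n≢0}})
  go : ∀ fs → All Prime fs → n ≡ product fs → n ≡ 1
  go [] _ eq = eq
  go (f ∷ fs) (pf ∷ _) eq with () ← sup f pf (subst (f ℕ∣.∣_) (sym eq) (ℕ∣.m∣m*n (product fs)))

-- The list of primes shrinks together with the number, so that products and sums over the list lose
-- exactly their first term. The exponent may be 0, because `primesUpTo n` also contains primes that
-- do not divide n.
prime-power-induction : (C : List ℕ → ℕ → Set) → C [] 1 →
  (∀ p ps v m → Prime p → m ≢ 0 → ¬ (p ℕ∣.∣ m) → All (p ≢_) ps → All Prime ps → C ps m → C (p ∷ ps) (p ℕ.^ v ℕ.* m)) →
  ∀ ps n → Unique ps → All Prime ps → n ≢ 0 → Supported ps n → C ps n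
prime-power-induction C base step [] n _ _ n≢0 sup = subst (C []) (sym (primeless⇒1 n n≢0 sup)) base
prime-power-induction C base step (p ∷ ps) n (p∉ ∷ u) (pp ∷ pps) n≢0 sup = let m , eq , m≢0 , p∤m = val-decompose pp n n≢0 in
  subst (C (p ∷ ps)) (sym eq) (step p ps (val p n) m pp m≢0 p∤m p∉ pps
    (prime-power-induction C base step ps m u pps m≢0 (λ q qq q∣m → tail p∤m q∣m
        (sup q qq (subst (q ℕ∣.∣_) (sym eq) (ℕ∣.∣n⇒∣m*n (p ℕ.^ val p n) q∣m))))))
  where
  tail : ∀ {m q} → ¬ (p ℕ∣.∣ m) → q ℕ∣.∣ m → q ∈ p ∷ ps → q ∈ ps
  tail p∤m q∣m (here refl) = ⊥-elim (p∤m q∣m)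
  tail _ _ (there q∈) = q∈

-- `countPrimes`, and below it `Λ`, with the list of primes as an argument independent of n. For
-- `primesUpTo n` both unfold to the originals.
primeCount : (m : ℕ) → .{{ℕ.NonZero m}} → List ℕ → List ℕ → ℕ → ℕ
primeCount m rs ps n = sum (map (λ p → val p n) (filter (λ p → (p ℕ.% m) ∈? rs) ps))

Λ-over : List ℕ → ℕ → ℤ
Λ-over ps n = foldr (λ p acc → ΛFactor p (val p n) * acc) 1ℤ ps

Λ-over-cong : ∀ ps n m → (∀ q → q ∈ ps → ΛFactor q (val q n) ≡ ΛFactor q (val q m)) → Λ-over ps n ≡ Λ-over ps m
Λ-over-cong [] n m h = refl
Λ-over-cong (p ∷ ps) n m h = cong₂ _*_ (h p (here refl)) (Λ-over-cong ps n m (λ q q∈ → h q (there q∈)))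

-- The nontrivial character of the group `Bool` under `xor`; `_^ᵇ_` below is the power in that
-- group.
σ : Bool → ℤ
σ false = 1ℤ
σ true = -1ℤ

infixr 8 _^ᵇ_
_^ᵇ_ : Bool → ℕ → Bool
κ ^ᵇ zero = false
κ ^ᵇ suc v = κ xor κ ^ᵇ v

σ-xor : ∀ b c → σ (b xor c) ≡ σ b * σ c
σ-xor false c = sym (ℤₚ.*-identityˡ (σ c))
σ-xor true false = refl
σ-xor true true = refl

sgn-+ : ∀ a b → sgn (a ℕ.+ b) ≡ sgn a * sgn b
sgn-+ = ℤₚ.^-distribˡ-+-* -1ℤ

sgn-σ : ∀ v → sgn v ≡ σ (true ^ᵇ v)
sgn-σ zero = refl
sgn-σ (suc v) = trans (cong (-1ℤ *_) (sgn-σ v)) (sym (σ-xor true (true ^ᵇ v)))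

false^ᵇ : ∀ v → false ^ᵇ v ≡ false
false^ᵇ zero = refl
false^ᵇ (suc v) = false^ᵇ v

xor-^ᵇ : ∀ b c v → (b xor c) ^ᵇ v ≡ b ^ᵇ v xor c ^ᵇ v
xor-^ᵇ b c zero = refl
xor-^ᵇ b c (suc v) = trans (cong ((b xor c) xor_) (xor-^ᵇ b c v)) (swap b c (b ^ᵇ v) (c ^ᵇ v))
  where
  swap : ∀ a b c d → (a xor b) xor (c xor d) ≡ (a xor c) xor (b xor d)
  swap false false c d = refl
  swap false true false d = refl
  swap false true true false = refl
  swap false true true true = refl
  swap true false false d = refl
  swap true false true false = refl
  swap true false true true = refl
  swap true true false false = refl
  swap true true false true = refl
  swap true true true false = refl
  swap true true true true = refl

sgn-if : ∀ b v → sgn (if b then v else 0) ≡ σ (b ^ᵇ v)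
sgn-if true v = sgn-σ v
sgn-if false v = cong σ (sym (false^ᵇ v))

module _ (p : ℕ) (ps : List ℕ) (v m : ℕ) (pp : Prime p) (m≢0 : m ≢ 0) (p∤m : ¬ (p ℕ∣.∣ m)) where

  private n = p ℕ.^ v ℕ.* m

  sgn-val : ∀ {q} → Prime q → sgn (val q n) ≡ σ (does (q ℕ.≟ p) ^ᵇ v) * sgn (val q m)
  sgn-val {q} qq = go (q ℕ.≟ p)
    where
    go : (d : Dec (q ≡ p)) → sgn (val q n) ≡ σ (does d ^ᵇ v) * sgn (val q m)
    go (yes refl) = trans (cong sgn (val-unique pp v m m≢0 p∤m)) (trans (sgn-σ v)
      (trans (sym (ℤₚ.*-identityʳ (σ (true ^ᵇ v)))) (cong (λ w → σ (true ^ᵇ v) * sgn w) (sym (val-∤ pp m m≢0 p∤m)))))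
    go (no q≢p) = trans (cong sgn (val-other pp qq q≢p v m m≢0))
        (trans (sym (ℤₚ.*-identityˡ (sgn (val q m)))) (cong (λ c → σ c * sgn (val q m)) (sym (false^ᵇ v))))

  module _ (p∉ : All (p ≢_) ps) (pps : All Prime ps) where

    val-rest : ∀ q → q ∈ ps → val q n ≡ val q m
    val-rest q q∈ = val-other pp (All.lookup pps q∈) (λ q≡p → All.lookup p∉ q∈ (sym q≡p)) v m m≢0

    Λ-over-∷ : Λ-over (p ∷ ps) n ≡ ΛFactor p v * Λ-over ps m
    Λ-over-∷ = cong₂ _*_ (cong (ΛFactor p) (val-unique pp v m m≢0 p∤m))
        (Λ-over-cong ps n m (λ q q∈ → cong (ΛFactor q) (val-rest q q∈)))

    sgn-primeCount : ∀ M .{{_ : ℕ.NonZero M}} rs → sgn (primeCount M rs (p ∷ ps) n) ≡ σ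
        (does ((p ℕ.% M) ∈? rs) ^ᵇ v) * sgn (primeCount M rs ps m)
    sgn-primeCount M rs = trans (cong sgn head) (trans (sgn-+ (if does ((p ℕ.% M) ∈? rs) then v else 0)
        (primeCount M rs ps m)) (cong (_* sgn (primeCount M rs ps m)) (sgn-if (does ((p ℕ.% M) ∈? rs)) v)))
      where
      rest : ∀ qs → (∀ q → q ∈ qs → val q n ≡ val q m) → primeCount M rs qs n ≡ primeCount M rs qs m
      rest [] _ = refl
      rest (q ∷ qs) h with does ((q ℕ.% M) ∈? rs)
      ... | true = cong₂ ℕ._+_ (h q (here refl)) (rest qs (λ q q∈ → h q (there q∈)))
      ... | false = rest qs (λ q q∈ → h q (there q∈))
      head : primeCount M rs (p ∷ ps) n ≡ (if does ((p ℕ.% M) ∈? rs) then v else 0) ℕ.+ primeCount M rs ps m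
      head with does ((p ℕ.% M) ∈? rs)
      ... | true = cong₂ ℕ._+_ (val-unique pp v m m≢0 p∤m) (rest ps val-rest)
      ... | false = rest ps val-rest

-- The counts for (1,0,5) and (2,2,3)

signA signB signC : List ℕ → ℕ → ℤ
signA ps n = sgn (val 2 n ℕ.+ primeCount 20 (3 ∷ 7 ∷ []) ps n)
signB ps n = sgn (val 2 n ℕ.+ val 5 n ℕ.+ primeCount 60 (23 ∷ 29 ∷ 41 ∷ 47 ∷ []) ps n)
signC ps n = sgn (val 5 n ℕ.+ primeCount 60 (7 ∷ 29 ∷ 41 ∷ 43 ∷ []) ps n)

-- The contribution of one prime to each sign. At ramified and split primes `bitA` is the class of
-- the forms above p, and `bitB` records, for p other than 3, whether p ≡ 2 modulo 3. At inert
-- primes all three are `false`.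
bitA bitB bitC : ℕ → Bool
bitA p = does (2 ℕ.≟ p) xor does ((p ℕ.% 20) ∈? (3 ∷ 7 ∷ []))
bitB p = (does (2 ℕ.≟ p) xor does (5 ℕ.≟ p)) xor does ((p ℕ.% 60) ∈? (23 ∷ 29 ∷ 41 ∷ 47 ∷ []))
bitC p = does (5 ℕ.≟ p) xor does ((p ℕ.% 60) ∈? (7 ∷ 29 ∷ 41 ∷ 43 ∷ []))

sgn-cons : ∀ {a t a′ t′} b c v → sgn a ≡ σ (b ^ᵇ v) * sgn a′ → sgn t ≡ σ (c ^ᵇ v) * sgn t′ →
  sgn (a ℕ.+ t) ≡ σ ((b xor c) ^ᵇ v) * sgn (a′ ℕ.+ t′)
sgn-cons {a} {t} {a′} {t′} b c v ea et = begin
  sgn (a ℕ.+ t) ≡⟨ sgn-+ a t ⟩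
  sgn a * sgn t ≡⟨ cong₂ _*_ ea et ⟩
  σ (b ^ᵇ v) * sgn a′ * (σ (c ^ᵇ v) * sgn t′) ≡⟨ lem (σ (b ^ᵇ v)) (sgn a′) (σ (c ^ᵇ v)) (sgn t′) ⟩
  σ (b ^ᵇ v) * σ (c ^ᵇ v) * (sgn a′ * sgn t′)
    ≡⟨ cong₂ _*_ (trans (sym (σ-xor (b ^ᵇ v) (c ^ᵇ v))) (cong σ (sym (xor-^ᵇ b c v)))) (sym (sgn-+ a′ t′)) ⟩
  σ ((b xor c) ^ᵇ v) * sgn (a′ ℕ.+ t′) ∎
  where
  open ≡-Reasoning
  lem : ∀ a b c d → a * b * (c * d) ≡ a * c * (b * d)
  lem = solve-∀

module _ (p : ℕ) (ps : List ℕ) (v m : ℕ) (pp : Prime p) (m≢0 : m ≢ 0) (p∤m : ¬ (p ℕ∣.∣ m)) (p∉ : All (p ≢_) ps)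
    (pps : All Prime ps) where

  private
    n = p ℕ.^ v ℕ.* m
    ve : ∀ {q} → Prime q → sgn (val q n) ≡ σ (does (q ℕ.≟ p) ^ᵇ v) * sgn (val q m)
    ve = sgn-val p ps v m pp m≢0 p∤m
    ce : ∀ M .{{_ : ℕ.NonZero M}} rs → sgn (primeCount M rs (p ∷ ps) n) ≡ σ (does ((p ℕ.% M) ∈? rs) ^ᵇ v) * sgn
        (primeCount M rs ps m)
    ce = sgn-primeCount p ps v m pp m≢0 p∤m p∉ pps

  signA-∷ : signA (p ∷ ps) n ≡ σ (bitA p ^ᵇ v) * signA ps m
  signA-∷ = sgn-cons {val 2 n} {primeCount 20 (3 ∷ 7 ∷ []) (p ∷ ps) n} {val 2 m} {primeCount 20 (3 ∷ 7 ∷ []) ps m}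
    (does (2 ℕ.≟ p)) (does ((p ℕ.% 20) ∈? (3 ∷ 7 ∷ []))) v (ve prime[2]) (ce 20 (3 ∷ 7 ∷ []))

  signB-∷ : signB (p ∷ ps) n ≡ σ (bitB p ^ᵇ v) * signB ps m
  signB-∷ = sgn-cons {val 2 n ℕ.+ val 5 n} {primeCount 60 rs (p ∷ ps) n} {val 2 m ℕ.+ val 5 m} {primeCount 60 rs ps m}
    (does (2 ℕ.≟ p) xor does (5 ℕ.≟ p)) (does ((p ℕ.% 60) ∈? rs)) v
    (sgn-cons {val 2 n} {val 5 n} {val 2 m} {val 5 m} (does (2 ℕ.≟ p)) (does (5 ℕ.≟ p)) v (ve prime[2])
        (ve prime[5])) (ce 60 rs)
    where rs = 23 ∷ 29 ∷ 41 ∷ 47 ∷ []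

  signC-∷ : signC (p ∷ ps) n ≡ σ (bitC p ^ᵇ v) * signC ps m
  signC-∷ = sgn-cons {val 5 n} {primeCount 60 rs (p ∷ ps) n} {val 5 m} {primeCount 60 rs ps m}
    (does (5 ℕ.≟ p)) (does ((p ℕ.% 60) ∈? rs)) v (ve prime[5]) (ce 60 rs)
    where rs = 7 ∷ 29 ∷ 41 ∷ 43 ∷ []

-- What the multiplicative steps use about a prime. For a split prime `bitB` gives its residue
-- modulo 3. An inert prime has an even exponent unless Λ vanishes, so its square being 1 modulo 3
-- suffices.
data Local (p : ℕ) : Set where
  two : p ≡ 2 → Local p
  three : p ≡ 3 → Local p
  five : p ≡ 5 → Local p
  split : ∀ κ → p ≢ 3 → p ℕ.% 20 ∈ splitResidues κ → bitA p ≡ κ → + 3 ∣ + p - σ (bitB p) → bitA p xor bitB p ≡ bitC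
      p → Local p
  inert : p ≢ 3 → p ℕ.% 20 ∈ inertResidues → bitA p ≡ false → bitB p ≡ false → bitC p ≡ false → + 3 ∣ + p * + p - 1ℤ
      → Local p

rowA rowB rowC : ℕ → Bool
rowA ρ = does ((ρ ℕ.% 20) ∈? (3 ∷ 7 ∷ []))
rowB ρ = does (ρ ∈? (23 ∷ 29 ∷ 41 ∷ 47 ∷ []))
rowC ρ = does (ρ ∈? (7 ∷ 29 ∷ 41 ∷ 43 ∷ []))

SplitRow : Bool → ℕ → Set
SplitRow κ ρ = ρ ℕ.% 20 ∈ splitResidues κ × rowA ρ ≡ κ × ρ ℕ.% 3 ≡ (if rowB ρ then 2 else 1) × rowA ρ xor rowB ρ ≡
    rowC ρ

InertRow : ℕ → Set
InertRow ρ = ρ ℕ.% 20 ∈ inertResidues × rowA ρ ≡ false × rowB ρ ≡ false × rowC ρ ≡ false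

-- The moduli 20, 60 and 3 all divide 60, so every prime other than 2, 3 and 5 is settled by a
-- finite table of residues modulo 60.
Row : ℕ → Set
Row ρ = (2 ℕ∣.∣ ρ ⊎ 3 ℕ∣.∣ ρ ⊎ 5 ℕ∣.∣ ρ) ⊎ SplitRow false ρ ⊎ SplitRow true ρ ⊎ InertRow ρ

row? : ∀ ρ → Dec (Row ρ)
row? ρ = ((2 ℕ∣.∣? ρ) ⊎-dec (3 ℕ∣.∣? ρ) ⊎-dec (5 ℕ∣.∣? ρ)) ⊎-dec splitRow? false ⊎-dec splitRow? true ⊎-dec
  (((ρ ℕ.% 20) ∈? inertResidues) ×-dec (rowA ρ Bool.≟ false) ×-dec (rowB ρ Bool.≟ false) ×-dec (rowC ρ Bool.≟ false))
  where
  splitRow? : ∀ κ → Dec (SplitRow κ ρ)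
  splitRow? κ = ((ρ ℕ.% 20) ∈? splitResidues κ) ×-dec (rowA ρ Bool.≟ κ) ×-dec
      (ρ ℕ.% 3 ℕ.≟ (if rowB ρ then 2 else 1)) ×-dec ((rowA ρ xor rowB ρ) Bool.≟ rowC ρ)

row : ∀ {ρ} → ρ ℕ.< 60 → Row ρ
row = from-yes (ℕₚ.allUpTo? row? 60)

%3-∣ : ∀ b p → p ℕ.% 3 ≡ (if b then 2 else 1) → + 3 ∣ + p - σ b
%3-∣ b p eq = ≡⇒∣ (cong (_- σ b) (sym p≡)) (go b)
  where
  q = + (p ℕ./ 3)
  p≡ : + p ≡ + (if b then 2 else 1) + q * + 3
  p≡ = trans (cong +_ (ℕ%.m≡m%n+[m/n]*n p 3)) (trans (ℤₚ.pos-+ (p ℕ.% 3) (p ℕ./ 3 ℕ.* 3))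
      (cong₂ (λ u w → + u + w) eq (ℤₚ.pos-* (p ℕ./ 3) 3)))
  lem₁ : ∀ q → + 2 + q * + 3 - -1ℤ ≡ (q + 1ℤ) * + 3
  lem₁ = solve-∀
  lem₂ : ∀ q → + 1 + q * + 3 - 1ℤ ≡ q * + 3
  lem₂ = solve-∀
  go : ∀ b → + 3 ∣ + (if b then 2 else 1) + q * + 3 - σ b
  go true = divides (q + 1ℤ) (lem₁ q)
  go false = divides q (lem₂ q)

square-mod3 : ∀ p → ¬ (3 ℕ∣.∣ p) → + 3 ∣ + p * + p - 1ℤ
square-mod3 p 3∤p = go (p ℕ.% 3) refl (ℕ%.m%n<n p 3)
  where
  lem : ∀ p s → (p - s) * (p + s) ≡ p * p - s * s
  lem = solve-∀
  go : ∀ i → p ℕ.% 3 ≡ i → i ℕ.< 3 → + 3 ∣ + p * + p - 1ℤ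
  go 0 eq _ = ⊥-elim (3∤p (ℕ∣.m%n≡0⇒n∣m p 3 eq))
  go 1 eq _ = ≡⇒∣ (lem (+ p) 1ℤ) (∣m⇒∣m*n (+ p + 1ℤ) (%3-∣ false p eq))
  go 2 eq _ = ≡⇒∣ (lem (+ p) -1ℤ) (∣m⇒∣m*n (+ p + -1ℤ) (%3-∣ true p eq))
  go (suc (suc (suc _))) _ (s≤s (s≤s (s≤s ())))

local : ∀ {p} → Prime p → Local p
local {p} pp = go (p ℕ.≟ 2) (p ℕ.≟ 3) (p ℕ.≟ 5)
  where
  go : Dec (p ≡ 2) → Dec (p ≡ 3) → Dec (p ≡ 5) → Local p
  go (yes e) _ _ = two e
  go _ (yes e) _ = three e
  go _ _ (yes e) = five e
  go (no ≢2) (no ≢3) (no ≢5) = [ ⊥-elim ∘ not-unit , [ fromSplit false , [ fromSplit true , fromInert ]′ ]′ ]′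
      (row (ℕ%.m%n<n p 60))
    where
    ρ = p ℕ.% 60
    lift-∣ : ∀ {q} → q ℕ∣.∣ 60 → q ℕ∣.∣ ρ → q ℕ∣.∣ p
    lift-∣ q∣60 q∣ρ = ℕ∣.∣n∣m%n⇒∣m q∣60 q∣ρ
    3∤p : ¬ (3 ℕ∣.∣ p)
    3∤p d = ≢3 (sym (prime-∣⇒≡ prime[3] pp d))
    not-unit : 2 ℕ∣.∣ ρ ⊎ 3 ℕ∣.∣ ρ ⊎ 5 ℕ∣.∣ ρ → ⊥
    not-unit (inj₁ d) = ≢2 (sym (prime-∣⇒≡ prime[2] pp (lift-∣ (ℕ∣.divides 30 refl) d)))
    not-unit (inj₂ (inj₁ d)) = 3∤p (lift-∣ (ℕ∣.divides 20 refl) d)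
    not-unit (inj₂ (inj₂ d)) = ≢5 (sym (prime-∣⇒≡ prime[5] pp (lift-∣ (ℕ∣.divides 12 refl) d)))
    mod20 : ρ ℕ.% 20 ≡ p ℕ.% 20
    mod20 = ℕ%.m∣n⇒o%n%m≡o%m 20 60 p (ℕ∣.divides 3 refl)
    mod3 : ρ ℕ.% 3 ≡ p ℕ.% 3
    mod3 = ℕ%.m∣n⇒o%n%m≡o%m 3 60 p (ℕ∣.divides 20 refl)
    no2 : does (2 ℕ.≟ p) ≡ false
    no2 = dec-false (2 ℕ.≟ p) (≢2 ∘ sym)
    no5 : does (5 ℕ.≟ p) ≡ false
    no5 = dec-false (5 ℕ.≟ p) (≢5 ∘ sym)
    A≡ : bitA p ≡ rowA ρ
    A≡ = cong₂ _xor_ no2 (cong (λ i → does (i ∈? (3 ∷ 7 ∷ []))) (sym mod20))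
    B≡ : bitB p ≡ rowB ρ
    B≡ = cong₂ (λ b c → (b xor c) xor rowB ρ) no2 no5
    C≡ : bitC p ≡ rowC ρ
    C≡ = cong (_xor rowC ρ) no5
    fromSplit : ∀ κ → SplitRow κ ρ → Local p
    fromSplit κ (r20 , a , r3 , abc) = split κ ≢3 (subst (_∈ splitResidues κ) mod20 r20) (trans A≡ a)
      (subst (λ b → + 3 ∣ + p - σ b) (sym B≡) (%3-∣ (rowB ρ) p (trans (sym mod3) r3)))
      (trans (cong₂ _xor_ A≡ B≡) (trans abc (sym C≡)))
    fromInert : InertRow ρ → Local p
    fromInert (r20 , a , b , c) = inert ≢3 (subst (_∈ inertResidues) mod20 r20) (trans A≡ a) (trans B≡ b)
        (trans C≡ c) (square-mod3 p 3∤p)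

-- Counts at prime powers

xor-cancel : ∀ κ w → κ xor (κ xor w) ≡ w
xor-cancel κ w = trans (sym (xor-assoc κ κ w)) (cong (_xor w) (xor-same κ))

^-unfold : ∀ p v m → p ℕ.^ suc v ℕ.* m ≡ p ℕ.* (p ℕ.^ v ℕ.* m)
^-unfold p v m = ℕₚ.*-assoc p (p ℕ.^ v) m

^-unfold₂ : ∀ p v m → p ℕ.^ suc (suc v) ℕ.* m ≡ p ℕ.* (p ℕ.* (p ℕ.^ v ℕ.* m))
^-unfold₂ p v m = trans (^-unfold p (suc v) m) (cong (p ℕ.*_) (^-unfold p v m))

r-2^ : ∀ v b m → r b (2 ℕ.^ v ℕ.* m) ≡ r (b xor true ^ᵇ v) m
r-2^ zero b m = cong₂ r (sym (xor-identityʳ b)) (ℕₚ.+-identityʳ m)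
r-2^ (suc v) b m = trans (cong (r b) (^-unfold 2 v m)) (trans (r-2 b (2 ℕ.^ v ℕ.* m))
  (trans (r-2^ v (b xor true) m) (cong (λ c → r c m) (xor-assoc b true (true ^ᵇ v)))))

r-5^ : ∀ v b m → r b (5 ℕ.^ v ℕ.* m) ≡ r b m
r-5^ zero b m = cong (r b) (ℕₚ.+-identityʳ m)
r-5^ (suc v) b m = trans (cong (r b) (^-unfold 5 v m)) (trans (r-5 b (5 ℕ.^ v ℕ.* m)) (r-5^ v b m))

-- The Hecke relation is the recurrence of an arithmetic progression, with terms (v + 1) X, (v + 2)
-- X, (v + 3) X; the class returns after two steps because κ is its own inverse. Adding (v + 1) X to
-- both sides avoids subtraction of natural numbers.
r-split^ : ∀ {p} → Prime p → ∀ κ → p ℕ.% 20 ∈ splitResidues κ → ∀ m → ¬ (p ℕ∣.∣ m) →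
  ∀ v b → r b (p ℕ.^ v ℕ.* m) ≡ suc v ℕ.* r (b xor κ ^ᵇ v) m
r-split^ pp κ p∈ m p∤m zero b = trans (cong₂ r (sym (xor-identityʳ b)) (ℕₚ.+-identityʳ m)) (sym (ℕₚ.+-identityʳ _))
r-split^ {p} pp κ p∈ m p∤m (suc zero) b = trans (cong (r b) (cong (ℕ._* m) (ℕₚ.*-identityʳ p)))
  (trans (r-split-coprime b m p∤m) (trans (cong (λ c → r c m ℕ.+ r c m) (cong (b xor_) (sym (xor-identityʳ κ))))
      (lem (r (b xor κ xor false) m))))
  where
  open SplitPrime p pp κ p∈
  lem : ∀ x → x ℕ.+ x ≡ 2 ℕ.* x
  lem = ℕ-solve-∀
r-split^ {p} pp κ p∈ m p∤m (suc (suc v)) b = ℕₚ.+-cancelʳ-≡ (suc v ℕ.* X) _ _ (begin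
  r b (p ℕ.^ suc (suc v) ℕ.* m) ℕ.+ suc v ℕ.* X
    ≡⟨ cong₂ ℕ._+_ (cong (r b) (^-unfold₂ p v m)) (trans
        (cong (λ w → suc v ℕ.* r (b xor w) m) (xor-cancel κ (κ ^ᵇ v))) (sym (r-split^ pp κ p∈ m p∤m v b))) ⟩
  r b (p ℕ.* (p ℕ.* (p ℕ.^ v ℕ.* m))) ℕ.+ r b (p ℕ.^ v ℕ.* m)
    ≡⟨ r-split-multiple b (p ℕ.^ v ℕ.* m) ⟩
  r (b xor κ) (p ℕ.* (p ℕ.^ v ℕ.* m)) ℕ.+ r (b xor κ) (p ℕ.* (p ℕ.^ v ℕ.* m))
    ≡⟨ cong (λ x → x ℕ.+ x) (trans (cong (r (b xor κ)) (sym (^-unfold p v m)))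
        (trans (r-split^ pp κ p∈ m p∤m (suc v) (b xor κ))
         (cong (λ c → suc (suc v) ℕ.* r c m) (xor-assoc b κ (κ xor κ ^ᵇ v))))) ⟩
  suc (suc v) ℕ.* X ℕ.+ suc (suc v) ℕ.* X
    ≡⟨ lem v X ⟩
  suc (suc (suc v)) ℕ.* X ℕ.+ suc v ℕ.* X ∎)
  where
  open ≡-Reasoning
  open SplitPrime p pp κ p∈
  X = r (b xor κ ^ᵇ suc (suc v)) m
  lem : ∀ v x → (2 ℕ.+ v) ℕ.* x ℕ.+ (2 ℕ.+ v) ℕ.* x ≡ (3 ℕ.+ v) ℕ.* x ℕ.+ (1 ℕ.+ v) ℕ.* x
  lem = ℕ-solve-∀

sgn-2+ : ∀ v → sgn (suc (suc v)) ≡ sgn v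
sgn-2+ v = lem (sgn v)
  where
  lem : ∀ s → -1ℤ * (-1ℤ * s) ≡ s
  lem = solve-∀

evenIndicator : ℕ → ℤ
evenIndicator v = (1ℤ + sgn v) /ℕ 2

evenIndicator-2+ : ∀ v → evenIndicator (suc (suc v)) ≡ evenIndicator v
evenIndicator-2+ v = cong (λ s → (1ℤ + s) /ℕ 2) (sgn-2+ v)

r-inert^ : ∀ {p} → Prime p → p ℕ.% 20 ∈ inertResidues → ∀ m → ¬ (p ℕ∣.∣ m) →
  ∀ v b → + r b (p ℕ.^ v ℕ.* m) ≡ evenIndicator v * + r b m
r-inert^ pp p∈ m p∤m zero b = trans (cong (λ k → + r b k) (ℕₚ.+-identityʳ m)) (sym (ℤₚ.*-identityˡ (+ r b m)))
r-inert^ {p} pp p∈ m p∤m (suc zero) b = cong +_ (trans (cong (r b) (cong (ℕ._* m) (ℕₚ.*-identityʳ p)))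
    (InertPrime.r-inert-coprime p pp p∈ b m p∤m))
r-inert^ {p} pp p∈ m p∤m (suc (suc v)) b = trans (cong (λ k → + r b k) (^-unfold₂ p v m))
  (trans (cong +_ (InertPrime.r-inert-multiple p pp p∈ b (p ℕ.^ v ℕ.* m)))
      (trans (r-inert^ pp p∈ m p∤m v b) (cong (_* + r b m) (sym (evenIndicator-2+ v)))))

ΛFactor-split : ∀ {p} → 3 ℕ.< p → p ℕ.% 20 ∈ (1 ∷ 3 ∷ 7 ∷ 9 ∷ []) → ∀ v → ΛFactor p v ≡ + suc v
ΛFactor-split {p} 3<p p∈ v rewrite dec-true (3 ℕ.<? p) 3<p | dec-true ((p ℕ.% 20) ∈? (1 ∷ 3 ∷ 7 ∷ 9 ∷ [])) p∈ = refl

inert-not-split : ∀ {ρ} → ρ ∈ inertResidues → ¬ (ρ ∈ (1 ∷ 3 ∷ 7 ∷ 9 ∷ []))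
inert-not-split (here refl) = from-no (11 ∈? (1 ∷ 3 ∷ 7 ∷ 9 ∷ []))
inert-not-split (there (here refl)) = from-no (13 ∈? (1 ∷ 3 ∷ 7 ∷ 9 ∷ []))
inert-not-split (there (there (here refl))) = from-no (17 ∈? (1 ∷ 3 ∷ 7 ∷ 9 ∷ []))
inert-not-split (there (there (there (here refl)))) = from-no (19 ∈? (1 ∷ 3 ∷ 7 ∷ 9 ∷ []))

ΛFactor-inert : ∀ {p} → p ℕ.% 20 ∈ inertResidues → ∀ v → ΛFactor p v ≡ evenIndicator v
ΛFactor-inert {p} p∈ v
  rewrite dec-false ((p ℕ.% 20) ∈? (1 ∷ 3 ∷ 7 ∷ 9 ∷ [])) (inert-not-split p∈) | dec-true
      ((p ℕ.% 20) ∈? inertResidues) p∈ = if-∧-false (does (3 ℕ.<? p))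
  where
  if-∧-false : ∀ b → (if b ∧ false then + suc v else evenIndicator v) ≡ evenIndicator v
  if-∧-false true = refl
  if-∧-false false = refl

prime>3 : ∀ {p} → Prime p → p ≢ 2 → p ≢ 3 → 3 ℕ.< p
prime>3 {0} pp _ _ = ⊥-elim (¬prime[0] pp)
prime>3 {1} pp _ _ = ⊥-elim (¬prime[1] pp)
prime>3 {2} _ n _ = ⊥-elim (n refl)
prime>3 {3} _ _ n = ⊥-elim (n refl)
prime>3 {suc (suc (suc (suc p)))} _ _ _ = s≤s (s≤s (s≤s (s≤s z≤n)))

-- The factor at 3 is kept apart because ΛFactor ignores it.
local-count : ∀ {p} → Prime p → ∀ v m → m ≢ 0 → ¬ (p ℕ∣.∣ m) → ∃ λ c →
  (∀ b → + r b (p ℕ.^ v ℕ.* m) ≡ c * + r (b xor bitA p ^ᵇ v) m) ×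
  c * + suc (val 3 m) ≡ ΛFactor p v * + suc (val 3 (p ℕ.^ v ℕ.* m))
local-count {p} pp v m m≢0 p∤m = go (local pp)
  where
  away : p ≢ 3 → val 3 (p ℕ.^ v ℕ.* m) ≡ val 3 m
  away p≢3 = val-other pp prime[3] (p≢3 ∘ sym) v m m≢0
  cof : ∀ {c} → p ≢ 3 → c ≡ ΛFactor p v → c * + suc (val 3 m) ≡ ΛFactor p v * + suc (val 3 (p ℕ.^ v ℕ.* m))
  cof p≢3 eq = cong₂ (λ x y → x * + suc y) eq (sym (away p≢3))
  go : Local p → ∃ λ c → (∀ b → + r b (p ℕ.^ v ℕ.* m) ≡ c * + r (b xor bitA p ^ᵇ v) m) ×
    c * + suc (val 3 m) ≡ ΛFactor p v * + suc (val 3 (p ℕ.^ v ℕ.* m))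
  go (two refl) = 1ℤ , (λ b → trans (cong +_ (r-2^ v b m)) (sym (ℤₚ.*-identityˡ _))) , cof (λ ()) refl
  go (five refl) = 1ℤ , (λ b → trans (cong +_ (trans (r-5^ v b m)
      (cong (λ c → r c m) (trans (sym (xor-identityʳ b)) (cong (b xor_) (sym (false^ᵇ v)))))))
      (sym (ℤₚ.*-identityˡ _))) , cof (λ ()) refl
  -- For the forms of discriminant -20 the prime 3 splits and lies in the class of `f₂`; its factor
  -- v + 1 is exactly `suc (val 3 _)`, while `ΛFactor 3 v` is 1.
  go (three refl) = + suc v , (λ b → trans (cong +_ (r-split^ pp true (here refl) m p∤m v b)) (ℤₚ.pos-* (suc v) _)) ,
    trans (cong (λ w → + suc v * + suc w) (val-∤ pp m m≢0 p∤m))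
        (trans (ℤₚ.*-comm (+ suc v) 1ℤ) (cong (λ w → 1ℤ * + suc w) (sym (val-unique pp v m m≢0 p∤m))))
  go (split κ p≢3 p∈ A≡ _ _) = + suc v ,
    (λ b → trans (cong +_ (r-split^ pp κ p∈ m p∤m v b)) (trans (ℤₚ.pos-* (suc v) _)
        (cong (λ a → + suc v * + r (b xor a ^ᵇ v) m) (sym A≡)))) ,
    cof p≢3 (sym (ΛFactor-split (prime>3 pp p≢2 p≢3) (splitResidues⊆ κ p∈) v))
    where
    p≢2 : p ≢ 2
    p≢2 refl = from-no (2 ∈? (1 ∷ 3 ∷ 7 ∷ 9 ∷ [])) (splitResidues⊆ κ p∈)
  go (inert p≢3 p∈ A≡ _ _ _) = evenIndicator v ,
    (λ b → trans (r-inert^ pp p∈ m p∤m v b) (cong (λ c → evenIndicator v * + r c m)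
        (trans (sym (xor-identityʳ b)) (cong (b xor_) (trans (sym (false^ᵇ v)) (cong (_^ᵇ v) (sym A≡))))))) ,
    cof p≢3 (sym (ΛFactor-inert {p} p∈ v))

-- For n = 1 there are the two representations ±(1, 0) by `f₁` and none by `f₂`. A prime power
-- shifts the class by `bitA p ^ᵇ v` and multiplies `signA` by the corresponding sign, so the
-- product `σ b * signA ps n` accounts for both.
count-formula : ∀ ps n → Unique ps → All Prime ps → n ≢ 0 → Supported ps n →
  ∀ b → + r b n ≡ (1ℤ + σ b * signA ps n) * Λ-over ps n * + suc (val 3 n)
count-formula = prime-power-induction Count base step
  where
  Count : List ℕ → ℕ → Set
  Count ps n = ∀ b → + r b n ≡ (1ℤ + σ b * signA ps n) * Λ-over ps n * + suc (val 3 n)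
  base : Count [] 1
  base false = cong +_ (finiteF-1 false)
  base true = cong +_ (finiteF-1 true)
  step : ∀ p ps v m → Prime p → m ≢ 0 → ¬ (p ℕ∣.∣ m) → All (p ≢_) ps → All Prime ps → Count ps m → Count (p ∷ ps)
      (p ℕ.^ v ℕ.* m)
  step p ps v m pp m≢0 p∤m p∉ pps ih b = let c , rec , cof = local-count pp v m m≢0 p∤m in begin
    + r b n ≡⟨ rec b ⟩
    c * + r (b xor bitA p ^ᵇ v) m ≡⟨ cong (c *_) (ih (b xor bitA p ^ᵇ v)) ⟩
    c * ((1ℤ + σ (b xor bitA p ^ᵇ v) * signA ps m) * Λ-over ps m * + suc (val 3 m))
      ≡⟨ lem₁ c (1ℤ + σ (b xor bitA p ^ᵇ v) * signA ps m) (Λ-over ps m) (+ suc (val 3 m)) ⟩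
    (1ℤ + σ (b xor bitA p ^ᵇ v) * signA ps m) * Λ-over ps m * (c * + suc (val 3 m))
      ≡⟨ cong₂ (λ s w → (1ℤ + s * signA ps m) * Λ-over ps m * w) (σ-xor b (bitA p ^ᵇ v)) cof ⟩
    (1ℤ + σ b * σ (bitA p ^ᵇ v) * signA ps m) * Λ-over ps m * (ΛFactor p v * + suc (val 3 n))
      ≡⟨ lem₂ (σ b) (σ (bitA p ^ᵇ v)) (signA ps m) (Λ-over ps m) (ΛFactor p v) (+ suc (val 3 n)) ⟩
    (1ℤ + σ b * (σ (bitA p ^ᵇ v) * signA ps m)) * (ΛFactor p v * Λ-over ps m) * + suc (val 3 n)
      ≡⟨ cong₂ (λ s l → (1ℤ + σ b * s) * l * + suc (val 3 n)) (sym (signA-∷ p ps v m pp m≢0 p∤m p∉ pps))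
          (sym (Λ-over-∷ p ps v m pp m≢0 p∤m p∉ pps)) ⟩
    (1ℤ + σ b * signA (p ∷ ps) n) * Λ-over (p ∷ ps) n * + suc (val 3 n) ∎
    where
    open ≡-Reasoning
    n = p ℕ.^ v ℕ.* m
    lem₁ : ∀ c s l w → c * (s * l * w) ≡ s * l * (c * w)
    lem₁ = solve-∀
    lem₂ : ∀ b k a l f w → (1ℤ + b * k * a) * l * (f * w) ≡ (1ℤ + b * (k * a)) * (f * l) * w
    lem₂ = solve-∀

-- The residue modulo 3 and the relation between the signs

^-mod3 : ∀ p β → + 3 ∣ + p - σ β → ∀ v → + 3 ∣ + (p ℕ.^ v) - σ (β ^ᵇ v)
^-mod3 p β d zero = divides 0ℤ refl
^-mod3 p β d (suc v) = ≡⇒∣ (trans (lem (+ p) (+ (p ℕ.^ v)) (σ β) (σ (β ^ᵇ v)))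
    (cong₂ _-_ (sym (ℤₚ.pos-* p (p ℕ.^ v))) (sym (σ-xor β (β ^ᵇ v)))))
  (∣m∣n⇒∣m+n (∣n⇒∣m*n (+ p) (^-mod3 p β d v)) (∣m⇒∣m*n (σ (β ^ᵇ v)) d))
  where
  lem : ∀ p q s t → p * (q - t) + (p - s) * t ≡ p * q - s * t
  lem = solve-∀

even-^-mod3 : ∀ p → + 3 ∣ + p * + p - 1ℤ → ∀ v → evenIndicator v ≡ 0ℤ ⊎ + 3 ∣ + (p ℕ.^ v) - 1ℤ
even-^-mod3 p d zero = inj₂ (divides 0ℤ refl)
even-^-mod3 p d (suc zero) = inj₁ refl
even-^-mod3 p d (suc (suc v)) = Sum.map (trans (evenIndicator-2+ v)) lift (even-^-mod3 p d v)
  where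
  lem : ∀ p q → p * p * (q - 1ℤ) + (p * p - 1ℤ) ≡ p * (p * q) - 1ℤ
  lem = solve-∀
  lift : + 3 ∣ + (p ℕ.^ v) - 1ℤ → + 3 ∣ + (p ℕ.^ suc (suc v)) - 1ℤ
  lift e = ≡⇒∣ (trans (lem (+ p) (+ (p ℕ.^ v))) (cong (_- 1ℤ)
      (sym (trans (ℤₚ.pos-* p (p ℕ.^ suc v)) (cong (+ p *_) (ℤₚ.pos-* p (p ℕ.^ v)))))))
    (∣m∣n⇒∣m+n (∣n⇒∣m*n (+ p * + p) e) d)

zero-exponent : ∀ {v m} → ¬ (3 ℕ∣.∣ 3 ℕ.^ v ℕ.* m) → v ≡ 0
zero-exponent {zero} _ = refl
zero-exponent {suc v} {m} 3∤ = ⊥-elim (3∤ (ℕ∣.∣m⇒∣m*n m (ℕ∣.m∣m*n (3 ℕ.^ v))))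

local-mod3 : ∀ {p} → Prime p → ∀ v m → ¬ (3 ℕ∣.∣ p ℕ.^ v ℕ.* m) → ΛFactor p v ≡ 0ℤ ⊎ + 3 ∣ + (p ℕ.^ v) - σ (bitB p ^ᵇ v)
local-mod3 {p} pp v m 3∤n = go (local pp)
  where
  go : Local p → ΛFactor p v ≡ 0ℤ ⊎ + 3 ∣ + (p ℕ.^ v) - σ (bitB p ^ᵇ v)
  go (two refl) = inj₂ (^-mod3 2 true (divides 1ℤ refl) v)
  go (five refl) = inj₂ (^-mod3 5 true (divides (+ 2) refl) v)
  go (three refl) = inj₂ (subst (λ w → + 3 ∣ + (3 ℕ.^ w) - σ (bitB 3 ^ᵇ w)) (sym (zero-exponent {v} {m} 3∤n))
      (divides 0ℤ refl))
  go (split κ _ _ _ d _) = inj₂ (^-mod3 p (bitB p) d v)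
  go (inert _ p∈ _ B≡ _ d) = Sum.map (trans (ΛFactor-inert {p} p∈ v))
    (≡⇒∣ (cong (λ b → + (p ℕ.^ v) - σ b) (trans (sym (false^ᵇ v)) (cong (_^ᵇ v) (sym B≡))))) (even-^-mod3 p d v)

-- Multiplicative in n. An inert prime with odd exponent makes `Λ-over` vanish; all remaining prime
-- powers are congruent to their B-sign modulo 3. This is how `signB` decides between the two forms
-- above `f₁`, or above `f₂`.
residue-formula : ∀ ps n → Unique ps → All Prime ps → n ≢ 0 → Supported ps n →
  ¬ (3 ℕ∣.∣ n) → Λ-over ps n ≡ 0ℤ ⊎ + 3 ∣ + n - signB ps n
residue-formula = prime-power-induction Residue (λ _ → inj₂ (divides 0ℤ refl)) step
  where
  Residue : List ℕ → ℕ → Set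
  Residue ps n = ¬ (3 ℕ∣.∣ n) → Λ-over ps n ≡ 0ℤ ⊎ + 3 ∣ + n - signB ps n
  step : ∀ p ps v m → Prime p → m ≢ 0 → ¬ (p ℕ∣.∣ m) → All (p ≢_) ps → All Prime ps → Residue ps m → Residue
      (p ∷ ps) (p ℕ.^ v ℕ.* m)
  step p ps v m pp m≢0 p∤m p∉ pps ih 3∤n = combine (local-mod3 pp v m 3∤n) (ih (3∤n ∘ ℕ∣.∣n⇒∣m*n (p ℕ.^ v)))
    where
    n = p ℕ.^ v ℕ.* m
    Λ∷ = Λ-over-∷ p ps v m pp m≢0 p∤m p∉ pps
    lem : ∀ q m s t → q * (m - t) + (q - s) * t ≡ q * m - s * t
    lem = solve-∀
    combine : ΛFactor p v ≡ 0ℤ ⊎ + 3 ∣ + (p ℕ.^ v) - σ (bitB p ^ᵇ v) → Λ-over ps m ≡ 0ℤ ⊎ + 3 ∣ + m - signB ps m →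
      Λ-over (p ∷ ps) n ≡ 0ℤ ⊎ + 3 ∣ + n - signB (p ∷ ps) n
    combine (inj₁ e) _ = inj₁ (trans Λ∷ (cong (_* Λ-over ps m) e))
    combine (inj₂ _) (inj₁ e) = inj₁ (trans Λ∷ (trans (cong (ΛFactor p v *_) e) (ℤₚ.*-zeroʳ (ΛFactor p v))))
    combine (inj₂ d) (inj₂ e) = inj₂ (≡⇒∣ (trans (lem (+ (p ℕ.^ v)) (+ m) (σ (bitB p ^ᵇ v)) (signB ps m))
        (cong₂ _-_ (sym (ℤₚ.pos-* (p ℕ.^ v) m)) (sym (signB-∷ p ps v m pp m≢0 p∤m p∉ pps))))
      (∣m∣n⇒∣m+n (∣n⇒∣m*n (+ (p ℕ.^ v)) e) (∣m⇒∣m*n (signB ps m) d)))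

local-signs : ∀ {p} → Prime p → ∀ v m → ¬ (3 ℕ∣.∣ p ℕ.^ v ℕ.* m) → σ (bitA p ^ᵇ v) * σ (bitB p ^ᵇ v) ≡ σ (bitC p ^ᵇ v)
local-signs {p} pp v m 3∤n = trans (sym (σ-xor (bitA p ^ᵇ v) (bitB p ^ᵇ v))) (cong σ (go (local pp)))
  where
  from-bits : bitA p xor bitB p ≡ bitC p → bitA p ^ᵇ v xor bitB p ^ᵇ v ≡ bitC p ^ᵇ v
  from-bits eq = trans (sym (xor-^ᵇ (bitA p) (bitB p) v)) (cong (_^ᵇ v) eq)
  go : Local p → bitA p ^ᵇ v xor bitB p ^ᵇ v ≡ bitC p ^ᵇ v
  go (two refl) = from-bits refl
  go (five refl) = from-bits refl
  go (three refl) = subst (λ w → bitA 3 ^ᵇ w xor bitB 3 ^ᵇ w ≡ bitC 3 ^ᵇ w) (sym (zero-exponent {v} {m} 3∤n)) refl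
  go (split _ _ _ _ _ eq) = from-bits eq
  go (inert _ _ A≡ B≡ C≡ _) = from-bits (trans (cong₂ _xor_ A≡ B≡) (sym C≡))

-- Prime by prime this is `bitA p xor bitB p ≡ bitC p`, true away from 3; the exponent of 3 is 0
-- here.
sign-formula : ∀ ps n → Unique ps → All Prime ps → n ≢ 0 → Supported ps n →
  ¬ (3 ℕ∣.∣ n) → signA ps n * signB ps n ≡ signC ps n
sign-formula = prime-power-induction Signs (λ _ → refl) step
  where
  Signs : List ℕ → ℕ → Set
  Signs ps n = ¬ (3 ℕ∣.∣ n) → signA ps n * signB ps n ≡ signC ps n
  step : ∀ p ps v m → Prime p → m ≢ 0 → ¬ (p ℕ∣.∣ m) → All (p ≢_) ps → All Prime ps → Signs ps m → Signs (p ∷ ps)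
      (p ℕ.^ v ℕ.* m)
  step p ps v m pp m≢0 p∤m p∉ pps ih 3∤n = begin
    signA (p ∷ ps) n * signB (p ∷ ps) n
      ≡⟨ cong₂ _*_ (signA-∷ p ps v m pp m≢0 p∤m p∉ pps) (signB-∷ p ps v m pp m≢0 p∤m p∉ pps) ⟩
    σ (bitA p ^ᵇ v) * signA ps m * (σ (bitB p ^ᵇ v) * signB ps m)
      ≡⟨ lem (σ (bitA p ^ᵇ v)) (signA ps m) (σ (bitB p ^ᵇ v)) (signB ps m) ⟩
    σ (bitA p ^ᵇ v) * σ (bitB p ^ᵇ v) * (signA ps m * signB ps m)
      ≡⟨ cong₂ _*_ (local-signs pp v m 3∤n) (ih (3∤n ∘ ℕ∣.∣n⇒∣m*n (p ℕ.^ v))) ⟩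
    σ (bitC p ^ᵇ v) * signC ps m
      ≡⟨ sym (signC-∷ p ps v m pp m≢0 p∤m p∉ pps) ⟩
    signC (p ∷ ps) n ∎
    where
    open ≡-Reasoning
    n = p ℕ.^ v ℕ.* m
    lem : ∀ a b c d → a * b * (c * d) ≡ a * c * (b * d)
    lem = solve-∀

-- Passage from discriminant -20 to -180

-- Representations by g come from F b₀: those of 9m from m, and those of n prime to 3 when n ≡ σ β (mod 3).
record Related (g : BQF) (b₀ β : Bool) : Set where
  field
    ninefold : ∀ m → Reps g (9 ℕ.* m) ↔ Reps (F b₀) m
    nine-∣ : ∀ n → 3 ℕ∣.∣ n → Reps g n → 9 ℕ∣.∣ n
    same : ∀ n → n ℕ.% 3 ≡ (if β then 2 else 1) → Reps (F b₀) n ↔ Reps g n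
    none : ∀ n → n ℕ.% 3 ≡ (if β then 1 else 2) → ¬ Reps g n

-- In each application the matrix product βα is three times the identity: g is `F b₀` composed with
-- β, hence g composed with α is 9 times `F b₀`. Modulo 3 each such g is plus or minus the square of
-- a linear form, so it omits one unit class and is divisible by 3 only on the lattice of α.
related : ∀ a b c b₀ β α₁ α₂ α₃ α₄ β₁ β₂ β₃ β₄ {D E} .{{_ : ℤ.NonZero D}} .{{_ : ℤ.NonZero E}} →
  let g = form (+ a) (+ b) (+ c) in
  α₁ * α₄ - α₂ * α₃ ≡ D → β₁ * β₄ - β₂ * β₃ ≡ E →
  (∀ x y → value g (linear α₁ α₂ α₃ α₄ (x , y)) ≡ + 9 * value (F b₀) (x , y)) →
  (∀ x y → value (F b₀) (linear β₁ β₂ β₃ β₄ (x , y)) ≡ + 1 * value g (x , y)) →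
  (∀ x y {v} → evalForm g x y ≡ + v → v ℕ.% 3 ≡ 0 → ∃ λ w → linear α₁ α₂ α₃ α₄ w ≡ (x , y)) →
  (∀ x y {v} → evalForm (F b₀) x y ≡ + v → v ℕ.% 3 ≡ (if β then 2 else 1) → ∃ λ w → linear β₁ β₂ β₃ β₄ w ≡ (x , y)) →
  {_ : True (ℕₚ.allUpTo? (λ i → ℕₚ.allUpTo? (λ j → ¬? (valueℕ a b c i j ℕ.% 3 ℕ.≟ (if β then 1 else 2))) 3) 3)} →
  Related g b₀ β
related a b c b₀ β α₁ α₂ α₃ α₄ β₁ β₂ β₃ β₄ detα detβ scaleα scaleβ ontoα ontoβ {check} = record
  { ninefold = λ m → sublattice-full-↔ g (F b₀) 9 m α₁ α₂ α₃ α₄ detα (λ (x , y) → scaleα x y)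
      (λ (x , y) e → ontoα x y e (ℕ∣.n∣m⇒m%n≡0 (9 ℕ.* m) 3 (ℕ∣.∣m⇒∣m*n m (ℕ∣.divides 3 refl))))
  ; nine-∣ = λ n 3∣n ((x , y) , e) → nine-∣ n x y e (ontoα x y e (ℕ∣.n∣m⇒m%n≡0 n 3 3∣n))
  ; same = λ n eq → subst (λ k → Reps (F b₀) k ↔ Reps g n) (ℕₚ.+-identityʳ n)
      (sublattice-full-↔ (F b₀) g 1 n β₁ β₂ β₃ β₄ detβ (λ (x , y) → scaleβ x y)
        (λ (x , y) e → ontoβ x y e (trans (cong (ℕ._% 3) (ℕₚ.+-identityʳ n)) eq)))
  ; none = λ n eq ((x , y) , e) → residue-check 3 (λ i j → ¬? (valueℕ a b c i j ℕ.% 3 ℕ.≟ (if β then 1 else 2)))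
      {check} x y
      (trans (sym (residues a b c 3 {x} {y} e)) eq) }
  where
  g = form (+ a) (+ b) (+ c)
  nine-∣ : ∀ n x y → evalForm g x y ≡ + n → (∃ λ w → linear α₁ α₂ α₃ α₄ w ≡ (x , y)) → 9 ℕ∣.∣ n
  nine-∣ n x y e (w , eq) = ∣⇒∣ℕ (divides (value (F b₀) w)
    (trans (sym e) (trans (cong (value g) (sym eq)) (trans (scaleα (proj₁ w) (proj₂ w))
        (ℤₚ.*-comm (+ 9) (value (F b₀) w))))))

private
  1x+0y : ∀ x y → + 1 * x + + 0 * y ≡ x
  1x+0y = solve-∀
  0x+1y : ∀ x y → + 0 * x + + 1 * y ≡ y
  0x+1y = solve-∀
  3x+0y : ∀ x y → + 3 * x + + 0 * y ≡ x * + 3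
  3x+0y = solve-∀
  0x+3y : ∀ x y → + 0 * x + + 3 * y ≡ y * + 3
  0x+3y = solve-∀

-- Modulo 3, `f₁` is x² - y². The value 1 forces y ≡ 0, a lattice on which `f₁` becomes (1, 0, 45);
-- the value 2 forces x ≡ 0, which gives (5, 0, 9).
related-1-0-45 : Related (form (+ 1) (+ 0) (+ 45)) false false
related-1-0-45 = related 1 0 45 false false (+ 3) (+ 0) (+ 0) (+ 1) (+ 1) (+ 0) (+ 0) (+ 3) refl refl scaleα scaleβ
  (λ x y e z → ontoα x y (form-∣ 1 0 45 3 0 1 0 x y e z)) (λ x y e z → ontoβ x y (form-∣ 1 0 5 3 1 0 1 x y e z))
  where
  scaleα : ∀ x y → + 1 * (+ 3 * x + + 0 * y) * (+ 3 * x + + 0 * y) + + 0 * (+ 3 * x + + 0 * y) * (+ 0 * x + + 1 * y)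
      + + 45 * (+ 0 * x + + 1 * y) * (+ 0 * x + + 1 * y)
    ≡ + 9 * (+ 1 * x * x + + 0 * x * y + + 5 * y * y)
  scaleα = solve-∀
  scaleβ : ∀ x y → + 1 * (+ 1 * x + + 0 * y) * (+ 1 * x + + 0 * y) + + 0 * (+ 1 * x + + 0 * y) * (+ 0 * x + + 3 * y)
      + + 5 * (+ 0 * x + + 3 * y) * (+ 0 * x + + 3 * y)
    ≡ + 1 * (+ 1 * x * x + + 0 * x * y + + 45 * y * y)
  scaleβ = solve-∀
  ontoα : ∀ x y → + 3 ∣ + 1 * x + + 0 * y → ∃ λ w → linear (+ 3) (+ 0) (+ 0) (+ 1) w ≡ (x , y)
  ontoα x y (divides q eq) = (q , y) , cong₂ _,_ (trans (3x+0y q y) (trans (sym eq) (1x+0y x y))) (0x+1y q y)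
  ontoβ : ∀ x y → + 3 ∣ + 0 * x + + 1 * y → ∃ λ w → linear (+ 1) (+ 0) (+ 0) (+ 3) w ≡ (x , y)
  ontoβ x y (divides q eq) = (x , q) , cong₂ _,_ (1x+0y x q) (trans (0x+3y x q) (trans (sym eq) (0x+1y x y)))

related-5-0-9 : Related (form (+ 5) (+ 0) (+ 9)) false true
related-5-0-9 = related 5 0 9 false true (+ 0) (+ 3) (+ 1) (+ 0) (+ 0) (+ 3) (+ 1) (+ 0) refl refl scaleα scaleβ
  (λ x y e z → onto x y (form-∣ 5 0 9 3 0 1 0 x y e z)) (λ x y e z → onto x y (form-∣ 1 0 5 3 2 1 0 x y e z))
  where
  scaleα : ∀ x y → + 5 * (+ 0 * x + + 3 * y) * (+ 0 * x + + 3 * y) + + 0 * (+ 0 * x + + 3 * y) * (+ 1 * x + + 0 * y)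
      + + 9 * (+ 1 * x + + 0 * y) * (+ 1 * x + + 0 * y)
    ≡ + 9 * (+ 1 * x * x + + 0 * x * y + + 5 * y * y)
  scaleα = solve-∀
  scaleβ : ∀ x y → + 1 * (+ 0 * x + + 3 * y) * (+ 0 * x + + 3 * y) + + 0 * (+ 0 * x + + 3 * y) * (+ 1 * x + + 0 * y)
      + + 5 * (+ 1 * x + + 0 * y) * (+ 1 * x + + 0 * y)
    ≡ + 1 * (+ 5 * x * x + + 0 * x * y + + 9 * y * y)
  scaleβ = solve-∀
  onto : ∀ x y → + 3 ∣ + 1 * x + + 0 * y → ∃ λ w → linear (+ 0) (+ 3) (+ 1) (+ 0) w ≡ (x , y)
  onto x y (divides q eq) = (y , q) , cong₂ _,_ (trans (0x+3y y q) (trans (sym eq) (1x+0y x y))) (1x+0y y q)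

-- Modulo 3, `f₂` is 2x(x + y). The value 1 forces x + 2y ≡ 0, which gives (7, 4, 7) in a basis
-- whose matrix squares to 3 and so serves both ways; the value 2 forces y ≡ 0, which gives (2, 2,
-- 23).
related-7-4-7 : Related (form (+ 7) (+ 4) (+ 7)) true false
related-7-4-7 = related 7 4 7 true false (+ 1) (+ 2) (+ 1) -1ℤ (+ 1) (+ 2) (+ 1) -1ℤ refl refl scaleα scaleβ
  (λ x y e z → onto x y (form-∣ 7 4 7 3 0 1 2 x y e z)) (λ x y e z → onto x y (form-∣ 2 2 3 3 1 1 2 x y e z))
  where
  scaleα : ∀ x y → + 7 * (+ 1 * x + + 2 * y) * (+ 1 * x + + 2 * y) + + 4 * (+ 1 * x + + 2 * y) * (+ 1 * x + -1ℤ * y)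
      + + 7 * (+ 1 * x + -1ℤ * y) * (+ 1 * x + -1ℤ * y)
    ≡ + 9 * (+ 2 * x * x + + 2 * x * y + + 3 * y * y)
  scaleα = solve-∀
  scaleβ : ∀ x y → + 2 * (+ 1 * x + + 2 * y) * (+ 1 * x + + 2 * y) + + 2 * (+ 1 * x + + 2 * y) * (+ 1 * x + -1ℤ * y)
      + + 3 * (+ 1 * x + -1ℤ * y) * (+ 1 * x + -1ℤ * y)
    ≡ + 1 * (+ 7 * x * x + + 4 * x * y + + 7 * y * y)
  scaleβ = solve-∀
  lem₁ : ∀ q y → + 1 * q + + 2 * (q - y) ≡ q * + 3 - + 2 * y
  lem₁ = solve-∀
  lem₂ : ∀ x y → + 1 * x + + 2 * y - + 2 * y ≡ x
  lem₂ = solve-∀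
  lem₃ : ∀ q y → + 1 * q + -1ℤ * (q - y) ≡ y
  lem₃ = solve-∀
  onto : ∀ x y → + 3 ∣ + 1 * x + + 2 * y → ∃ λ w → linear (+ 1) (+ 2) (+ 1) -1ℤ w ≡ (x , y)
  onto x y (divides q eq) = (q , q - y) , cong₂ _,_ (trans (lem₁ q y)
      (trans (cong (_- + 2 * y) (sym eq)) (lem₂ x y))) (lem₃ q y)

related-2-2-23 : Related (form (+ 2) (+ 2) (+ 23)) true true
related-2-2-23 = related 2 2 23 true true (+ 3) (+ 1) (+ 0) (+ 1) (+ 1) -1ℤ (+ 0) (+ 3) refl refl scaleα scaleβ
  (λ x y e z → ontoα x y (form-∣ 2 2 23 3 0 1 2 x y e z)) (λ x y e z → ontoβ x y (form-∣ 2 2 3 3 2 0 1 x y e z))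
  where
  scaleα : ∀ x y → + 2 * (+ 3 * x + + 1 * y) * (+ 3 * x + + 1 * y) + + 2 * (+ 3 * x + + 1 * y) * (+ 0 * x + + 1 * y)
      + + 23 * (+ 0 * x + + 1 * y) * (+ 0 * x + + 1 * y)
    ≡ + 9 * (+ 2 * x * x + + 2 * x * y + + 3 * y * y)
  scaleα = solve-∀
  scaleβ : ∀ x y → + 2 * (+ 1 * x + -1ℤ * y) * (+ 1 * x + -1ℤ * y) + + 2 * (+ 1 * x + -1ℤ * y) * (+ 0 * x + + 3 * y)
      + + 3 * (+ 0 * x + + 3 * y) * (+ 0 * x + + 3 * y)
    ≡ + 1 * (+ 2 * x * x + + 2 * x * y + + 23 * y * y)
  scaleβ = solve-∀
  lem₁ : ∀ q y → + 3 * (q - y) + + 1 * y ≡ q * + 3 - + 2 * y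
  lem₁ = solve-∀
  lem₂ : ∀ x y → + 1 * x + + 2 * y - + 2 * y ≡ x
  lem₂ = solve-∀
  lem₃ : ∀ x q → + 1 * (x + q) + -1ℤ * q ≡ x
  lem₃ = solve-∀
  ontoα : ∀ x y → + 3 ∣ + 1 * x + + 2 * y → ∃ λ w → linear (+ 3) (+ 1) (+ 0) (+ 1) w ≡ (x , y)
  ontoα x y (divides q eq) = (q - y , y) , cong₂ _,_ (trans (lem₁ q y)
      (trans (cong (_- + 2 * y) (sym eq)) (lem₂ x y))) (0x+1y (q - y) y)
  ontoβ : ∀ x y → + 3 ∣ + 0 * x + + 1 * y → ∃ λ w → linear (+ 1) -1ℤ (+ 0) (+ 3) w ≡ (x , y)
  ontoβ x y (divides q eq) = (x + q , q) , cong₂ _,_ (lem₃ x q) (trans (0x+3y (x + q) q) (trans (sym eq) (0x+1y x y)))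

sgn-primeCount-cong : ∀ M .{{_ : ℕ.NonZero M}} rs ps n m → (∀ q → q ∈ ps → sgn (val q n) ≡ sgn (val q m)) →
  sgn (primeCount M rs ps n) ≡ sgn (primeCount M rs ps m)
sgn-primeCount-cong M rs [] n m h = refl
sgn-primeCount-cong M rs (q ∷ ps) n m h with does ((q ℕ.% M) ∈? rs)
... | true = trans (sgn-+ (val q n) (primeCount M rs ps n))
    (trans (cong₂ _*_ (h q (here refl)) (sgn-primeCount-cong M rs ps n m (λ q q∈ → h q (there q∈))))
  (sym (sgn-+ (val q m) (primeCount M rs ps m))))
... | false = sgn-primeCount-cong M rs ps n m (λ q q∈ → h q (there q∈))

σ-mod3-injective : ∀ b c → + 3 ∣ σ b - σ c → b ≡ c
σ-mod3-injective false false _ = refl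
σ-mod3-injective true true _ = refl
σ-mod3-injective false true d = ⊥-elim (from-no (+ 3 ∣? + 2) d)
σ-mod3-injective true false d = ⊥-elim (from-no (+ 3 ∣? (- + 2)) d)

-- E collects the signs in the case 3 ∤ n and H those in the case 3 ∣ n.
rep-count : ∀ g b₀ β → Related g b₀ β → (E : ℤ → ℤ → ℤ → ℤ) (H : ℤ → ℤ) →
  (∀ a → E (σ a) (σ β) (σ a * σ β) /ℕ 2 ≡ 1ℤ + σ b₀ * σ a) →
  (∀ a → E (σ a) (- σ β) (σ a * - σ β) /ℕ 2 ≡ 0ℤ) →
  (∀ a → 1ℤ + σ b₀ * a ≡ H a) →
  ∀ n → 0 < n → let ps = primesUpTo n in
  Σ ℕ λ k → RepCount g n k × (+ k ≡ (if val 3 n ≡ᵇ 0 then (E (signA ps n) (signB ps n) (signC ps n) /ℕ 2) * Λ n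
                                       else (+ val 3 n - 1ℤ) * H (signA ps n) * Λ n))
rep-count g b₀ β rel E H E-same E-other H≡ n 0<n = go (val 3 n) refl
  where
  open Related rel
  ps = primesUpTo n
  n≢0 : n ≢ 0
  n≢0 refl = ℕₚ.<-irrefl refl 0<n
  unique : Unique ps
  unique = Unique.filter⁺ prime? (Unique.upTo⁺ (suc n))
  primes : All Prime ps
  primes = all-filter prime? (upTo (suc n))
  supported : Supported ps n
  supported q qq q∣n = ∈-filter⁺ prime? (∈-upTo⁺ (s≤s (ℕ∣.∣⇒≤ {{ℕ.≢-nonZero n≢0}} q∣n))) qq
  m₀ = proj₁ (val-decompose prime[3] n n≢0)
  n≡ : n ≡ 3 ℕ.^ val 3 n ℕ.* m₀
  n≡ = proj₁ (proj₂ (val-decompose prime[3] n n≢0))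
  m₀≢0 : m₀ ≢ 0
  m₀≢0 = proj₁ (proj₂ (proj₂ (val-decompose prime[3] n n≢0)))
  3∤m₀ : ¬ (3 ℕ∣.∣ m₀)
  3∤m₀ = proj₂ (proj₂ (proj₂ (val-decompose prime[3] n n≢0)))
  a = true ^ᵇ (val 2 n ℕ.+ primeCount 20 (3 ∷ 7 ∷ []) ps n)
  bb = true ^ᵇ (val 2 n ℕ.+ val 5 n ℕ.+ primeCount 60 (23 ∷ 29 ∷ 41 ∷ 47 ∷ []) ps n)
  A≡ : signA ps n ≡ σ a
  A≡ = sgn-σ (val 2 n ℕ.+ primeCount 20 (3 ∷ 7 ∷ []) ps n)
  B≡ : signB ps n ≡ σ bb
  B≡ = sgn-σ (val 2 n ℕ.+ val 5 n ℕ.+ primeCount 60 (23 ∷ 29 ∷ 41 ∷ 47 ∷ []) ps n)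

  Goal : ℕ → Set
  Goal w = Σ ℕ λ k → RepCount g n k × (+ k ≡ (if w ≡ᵇ 0 then (E (signA ps n) (signB ps n) (signC ps n) /ℕ 2) * Λ n
                                              else (+ w - 1ℤ) * H (signA ps n) * Λ n))

  module Coprime (w≡0 : val 3 n ≡ 0) where
    3∤n : ¬ (3 ℕ∣.∣ n)
    3∤n d = 3∤m₀ (subst (3 ℕ∣.∣_) (trans n≡ (trans (cong (λ w → 3 ℕ.^ w ℕ.* m₀) w≡0) (ℕₚ.+-identityʳ m₀))) d)
    E≡ : ∀ s → signB ps n ≡ s → E (signA ps n) (signB ps n) (signC ps n) ≡ E (σ a) s (σ a * s)
    E≡ s eq = trans (cong₂ (λ x y → E x y (signC ps n)) A≡ eq)
      (cong (E (σ a) s) (trans (sym (sign-formula ps n unique primes n≢0 supported 3∤n)) (cong₂ _*_ A≡ eq)))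
    -- Unless Λ vanishes, n is congruent modulo 3 both to B and to `σ c`, and the signs 1 and -1 are
    -- incongruent modulo 3.
    B-cases : ∀ c → n ℕ.% 3 ≡ (if c then 2 else 1) → Λ n ≡ 0ℤ ⊎ signB ps n ≡ σ c
    B-cases c eq = Sum.map id (λ d → trans B≡ (cong σ (σ-mod3-injective bb c
        (≡⇒∣ (trans (lem (+ n) (signB ps n) (σ c)) (cong (_- σ c) B≡))
      (∣m∣n⇒∣m-n (%3-∣ c n eq) d))))) (residue-formula ps n unique primes n≢0 supported 3∤n)
      where
      lem : ∀ n b c → n - c - (n - b) ≡ b - c
      lem = solve-∀
    same-case : n ℕ.% 3 ≡ (if β then 2 else 1) → Goal 0
    same-case eq = r b₀ n , ↔-trans (proj₂ (finiteF b₀ n)) (same n eq) ,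
      trans (count-formula ps n unique primes n≢0 supported b₀)
        (trans (cong (λ w → (1ℤ + σ b₀ * signA ps n) * Λ n * + suc w) w≡0)
            (trans (ℤₚ.*-identityʳ ((1ℤ + σ b₀ * signA ps n) * Λ n))
          ([ (λ Λ≡0 → trans (cong ((1ℤ + σ b₀ * signA ps n) *_) Λ≡0) (trans (ℤₚ.*-zeroʳ (1ℤ + σ b₀ * signA ps n))
               (sym (trans (cong ((E (signA ps n) (signB ps n) (signC ps n) /ℕ 2) *_) Λ≡0)
                   (ℤₚ.*-zeroʳ (E (signA ps n) (signB ps n) (signC ps n) /ℕ 2))))))
           , (λ B≡β → cong (_* Λ n) (trans (cong (λ x → 1ℤ + σ b₀ * x) A≡)
               (trans (sym (E-same a)) (cong (_/ℕ 2) (sym (E≡ (σ β) B≡β)))))) ]′ (B-cases β eq))))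
    -- `g` does not represent n, and the formula agrees: either Λ is 0 or B has the sign for which
    -- `E` vanishes.
    other-case : ∀ c → σ c ≡ - σ β → n ℕ.% 3 ≡ (if c then 2 else 1) → n ℕ.% 3 ≡ (if β then 1 else 2) → Goal 0
    other-case c σc eq eq′ = 0 , proj₂ (finite-⊥ (none n eq′)) ,
      [ (λ Λ≡0 → sym (trans (cong ((E (signA ps n) (signB ps n) (signC ps n) /ℕ 2) *_) Λ≡0)
          (ℤₚ.*-zeroʳ (E (signA ps n) (signB ps n) (signC ps n) /ℕ 2))))
      , (λ B≡c → sym (cong (_* Λ n) (trans (cong (_/ℕ 2) (E≡ (- σ β) (trans B≡c σc))) (E-other a)))) ]′ (B-cases c eq)
    decide : ∀ i → n ℕ.% 3 ≡ i → i ℕ.< 3 → ∀ c → β ≡ c → Goal 0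
    decide 0 eq _ _ _ = ⊥-elim (3∤n (ℕ∣.m%n≡0⇒n∣m n 3 eq))
    decide 1 eq _ false refl = same-case eq
    decide 1 eq _ true refl = other-case false refl eq eq
    decide 2 eq _ false refl = other-case true refl eq eq
    decide 2 eq _ true refl = same-case eq
    decide (suc (suc (suc _))) _ (s≤s (s≤s (s≤s ()))) _ _

  go : ∀ w → val 3 n ≡ w → Goal w
  go 0 w≡ = Coprime.decide w≡ (n ℕ.% 3) refl (ℕ%.m%n<n n 3) β refl
  -- A value of `g` divisible by 3 is divisible by 9, so nothing is represented; the formula has the
  -- factor b - 1 = 0.
  go 1 w≡ = 0 , proj₂ (finite-⊥ empty) , sym (lem (H (signA ps n)) (Λ n))
    where
    lem : ∀ h l → 0ℤ * h * l ≡ 0ℤ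
    lem = solve-∀
    n≡3m : n ≡ 3 ℕ.* m₀
    n≡3m = trans n≡ (cong (λ w → 3 ℕ.^ w ℕ.* m₀) w≡)
    empty : ¬ Reps g n
    empty rep = 3∤m₀ (ℕ∣.*-cancelˡ-∣ 3 (subst (9 ℕ∣.∣_) n≡3m (nine-∣ n (subst (3 ℕ∣.∣_) (sym n≡3m) (ℕ∣.m∣m*n m₀)) rep)))
  -- Here b = w + 2, and the factor `suc (val 3 m)` for m = n / 9 is w + 1 = b - 1. The list of
  -- primes up to n is retained for m.
  go (suc (suc w)) w≡ = r b₀ m , ↔-trans (proj₂ (finiteF b₀ m))
      (subst (λ k → Reps (F b₀) m ↔ Reps g k) (sym n≡9m) (↔-sym (ninefold m))) ,
    (begin
      + r b₀ m ≡⟨ count-formula ps m unique primes m≢0 (λ q qq q∣m → supported q qq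
          (subst (q ℕ∣.∣_) (sym n≡9m) (ℕ∣.∣n⇒∣m*n 9 q∣m))) b₀ ⟩
      (1ℤ + σ b₀ * signA ps m) * Λ-over ps m * + suc (val 3 m)
        ≡⟨ cong₂ (λ s l → (1ℤ + σ b₀ * s) * l * + suc (val 3 m)) signA-m Λ-m ⟩
      (1ℤ + σ b₀ * signA ps n) * Λ n * + suc (val 3 m)
        ≡⟨ cong₂ (λ s k → s * Λ n * + suc k) (H≡ (signA ps n)) val-3-m ⟩
      H (signA ps n) * Λ n * + suc w
        ≡⟨ lem₁ (H (signA ps n)) (Λ n) (+ suc w) ⟩
      + suc w * H (signA ps n) * Λ n ∎)
    where
    open ≡-Reasoning
    m = 3 ℕ.^ w ℕ.* m₀
    lem₀ : ∀ u k → 3 ℕ.* (3 ℕ.* u) ℕ.* k ≡ 9 ℕ.* (u ℕ.* k)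
    lem₀ = ℕ-solve-∀
    lem₁ : ∀ h l k → h * l * k ≡ k * h * l
    lem₁ = solve-∀
    n≡9m : n ≡ 9 ℕ.* m
    n≡9m = trans n≡ (trans (cong (λ w → 3 ℕ.^ w ℕ.* m₀) w≡) (lem₀ (3 ℕ.^ w) m₀))
    m≢0 : m ≢ 0
    m≢0 = *≢0 (^≢0 prime[3] w) m₀≢0
    val-3-m : val 3 m ≡ w
    val-3-m = val-unique prime[3] w m₀ m₀≢0 3∤m₀
    val-m : ∀ {q} → Prime q → q ≢ 3 → val q n ≡ val q m
    val-m {q} qq q≢3 = trans (cong (val q) n≡9m) (val-other prime[3] qq q≢3 2 m m≢0)
    -- The prime 3 is counted in t₁, being 3 modulo 20; its exponent drops by two, which leaves the
    -- sign unchanged.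
    sgn-m : ∀ q → q ∈ ps → sgn (val q m) ≡ sgn (val q n)
    sgn-m q q∈ with q ℕ.≟ 3
    ... | yes refl = trans (cong sgn val-3-m) (trans (sym (sgn-2+ w)) (cong sgn (sym w≡)))
    ... | no q≢3 = cong sgn (sym (val-m (All.lookup primes q∈) q≢3))
    signA-m : signA ps m ≡ signA ps n
    signA-m = trans (sgn-+ (val 2 m) (primeCount 20 (3 ∷ 7 ∷ []) ps m))
      (trans (cong₂ _*_ (cong sgn (sym (val-m prime[2] (λ ())))) (sgn-primeCount-cong 20 (3 ∷ 7 ∷ []) ps m n sgn-m))
        (sym (sgn-+ (val 2 n) (primeCount 20 (3 ∷ 7 ∷ []) ps n))))
    factor-m : ∀ q → q ∈ ps → ΛFactor q (val q m) ≡ ΛFactor q (val q n)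
    factor-m q q∈ with q ℕ.≟ 3
    -- `ΛFactor 3` is 1 whatever the exponent.
    ... | yes refl = refl
    ... | no q≢3 = cong (ΛFactor q) (sym (val-m (All.lookup primes q∈) q≢3))
    Λ-m : Λ-over ps m ≡ Λ n
    Λ-m = Λ-over-cong ps m n factor-m

theorem4p3 : (n : ℕ) → 0 < n →
    let a = val 2 n
        b = val 3 n
        c = val 5 n
        t₁ = countPrimes n 20 (3 ∷ 7 ∷ [])
        t₂ = countPrimes n 60 (23 ∷ 29 ∷ 41 ∷ 47 ∷ [])
        t₃ = countPrimes n 60 (7 ∷ 29 ∷ 41 ∷ 43 ∷ [])
        A = sgn (a Data.Nat.+ t₁)
        B = sgn (a Data.Nat.+ c Data.Nat.+ t₂)
        C = sgn (c Data.Nat.+ t₃)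
    in (Σ ℕ λ k → RepCount (form (+ 1) (+ 0) (+ 45)) n k ×
          (+ k ≡ (if b ≡ᵇ 0 then ((1ℤ + A + B + C) /ℕ 2) * Λ n
                  else (+ b - 1ℤ) * (1ℤ + A) * Λ n)))
     × (Σ ℕ λ k → RepCount (form (+ 5) (+ 0) (+ 9)) n k ×
          (+ k ≡ (if b ≡ᵇ 0 then ((1ℤ + A - B - C) /ℕ 2) * Λ n
                  else (+ b - 1ℤ) * (1ℤ + A) * Λ n)))
     × (Σ ℕ λ k → RepCount (form (+ 7) (+ 4) (+ 7)) n k ×
          (+ k ≡ (if b ≡ᵇ 0 then ((1ℤ - A + B - C) /ℕ 2) * Λ n
                  else (+ b - 1ℤ) * (1ℤ - A) * Λ n)))
     × (Σ ℕ λ k → RepCount (form (+ 2) (+ 2) (+ 23)) n k ×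
          (+ k ≡ (if b ≡ᵇ 0 then ((1ℤ - A - B + C) /ℕ 2) * Λ n
                  else (+ b - 1ℤ) * (1ℤ - A) * Λ n)))
theorem4p3 n 0<n =
    rep-count (form (+ 1) (+ 0) (+ 45)) false false related-1-0-45 (λ A B C → 1ℤ + A + B + C) (λ A → 1ℤ + A)
      (λ { false → refl ; true → refl }) (λ { false → refl ; true → refl }) plus n 0<n
  , rep-count (form (+ 5) (+ 0) (+ 9)) false true related-5-0-9 (λ A B C → 1ℤ + A - B - C) (λ A → 1ℤ + A)
      (λ { false → refl ; true → refl }) (λ { false → refl ; true → refl }) plus n 0<n
  , rep-count (form (+ 7) (+ 4) (+ 7)) true false related-7-4-7 (λ A B C → 1ℤ - A + B - C) (λ A → 1ℤ - A)
      (λ { false → refl ; true → refl }) (λ { false → refl ; true → refl }) minus n 0<n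
  , rep-count (form (+ 2) (+ 2) (+ 23)) true true related-2-2-23 (λ A B C → 1ℤ - A - B + C) (λ A → 1ℤ - A)
      (λ { false → refl ; true → refl }) (λ { false → refl ; true → refl }) minus n 0<n
  where
  plus : ∀ a → 1ℤ + 1ℤ * a ≡ 1ℤ + a
  plus = solve-∀
  minus : ∀ a → 1ℤ + -1ℤ * a ≡ 1ℤ - a
  minus = solve-∀
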